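{- Let $n\ge3$. The Haglund–Loehr zeta map of type $D_n$, $\zeta_D:\operatorname{Vert}(D_n)\to\operatorname{Diag}(D_n)$, $(\pi,v)\mapsto(\zeta_D(\pi),d_D(\pi,v))$, is a (well-defined) bijection from vertically labelled signed lattice paths to diagonally labelled signed ballot paths.
   Context: Signed permutations: $\mathfrak S_n^B$ is the group of bijections $w$ of $\{\pm1,\dots,\pm n\}$ with $w(-i)=-w(i)$, written $[w(1),\dots,w(n)]$; $\mathfrak S_n^D$ is the subgroup of those with an even number of $i\in[n]$ with $w(i)<0$. Rise $i$ of a path: its $i$-th North step is immediately followed by a North step; valley $(i,j)$: its $i$-th East step is immediately followed by its $j$-th North step, and additionally, if a ballot path with $i$ East and $j$ North steps ends with an East step, $(i,j+1)$ counts as a valley (signed East steps $E^\pm$ count as East steps). A signed lattice path is a word with $n-1$ East steps and $n$ North steps, except that if its first step is East, this step is replaced by $E^+$ or $E^-$; the set is $\mathcal L^\bullet_{n-1,n}$ and $\epsilon(\pi)=-1$ if $\pi$ contains $E^-$, else $1$. For such $\pi$ let $\pi_i$ be the number of East steps before the $i$-th North step and set $\lambda_1=\epsilon(\pi)\pi_1$, $\lambda_i=\pi_i$ for $1<i<n$, $\lambda_n=2\pi_n-\pi_{n-1}$ if $\pi_1+\dots+\pi_{n-2}$ is even and $\lambda_n=2n-1-2\pi_n+\pi_{n-1}$ otherwise. If $n-1\equiv0,3\pmod 4$ let $\nu=(0,1,\dots,n-2,n-1)$; if $n-1\equiv1,2\pmod4$ let $\nu=(0,1,\dots,n-2,n)$.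 The area vector $\mu$ is $\mu=(\lambda_1,\lambda_2-1,\dots,\lambda_{n-1}-(n-2),\lambda_n-(n-1))$ if $n-1\equiv0,3\pmod4$ and $\mu=(-\lambda_1,\lambda_2-1,\dots,\lambda_{n-1}-(n-2),n-\lambda_n)$ if $n-1\equiv1,2\pmod4$. For $a\in\mathbb Z^n$, $j\ge0$: $\overrightarrow{S}^+_j(a)$ reads $a$ left to right writing $N$ for entries $j$ and $E$ for entries $j+1$; $\overleftarrow{S}^+_j(a)$ reads right to left; $\overrightarrow{S}^-_j,\overleftarrow{S}^-_j$ likewise with $N$ for $-j$ and $E$ for $-j-1$. $\zeta_D(\pi)$: take $\overleftarrow{S}^-_{2n-1}(\mu)\overrightarrow{S}^+_{2n-1}(\mu)\overleftarrow{S}^-_{2n-2}(\mu)\overrightarrow{S}^+_{2n-2}(\mu)\cdots\overleftarrow{S}^-_0(\mu)\overrightarrow{S}^+_0(\mu)$, delete its last letter, and if the $n$-th North step is immediately followed by an East step, replace that East step by $E^+$ if $\#\{r:\mu_r>0\}$ is even and by $E^-$ if it is odd. A signed ballot path is a word of length $2n-1$ in $\{N,E\}$ all of whose prefixes have at least as many $N$'s as $E$'s, except that if its $n$-th North step is immediately followed by an East step, this East step is replaced by $E^+$ or $E^-$; set $\mathcal B^\bullet_{2n-1}$, sign $\epsilon(\beta)$ as before. $\operatorname{Vert}(D_n)$: pairs $(\pi,v)$ with $\pi\in\mathcal L^\bullet_{n-1,n}$, $v\in\mathfrak S_n^B$, such that $v(i)<v(i+1)$ for each rise $i$ of $\pi$,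 $|v(1)|<v(2)$ if $\pi$ begins with two North steps, and $\prod_{i=1}^n\operatorname{sgn}(v(i))=\epsilon(\pi)(-1)^{\lambda_{n-1}+\lambda_n}$. Diagonal reading word $d_D(\pi,v)$: for $i=0,1,2,\dots$ first write $v(j)$ for all rows $j$ with $\mu_j=-i$ in increasing order of $j$, then $-v(j)$ for all rows $j$ with $\mu_j=i+1$ in decreasing order of $j$; then multiply the entry coming from row $n$ by $(-1)^{1+\mu_{n-1}+\mu_n}$ and the entry coming from row $1$ by $\epsilon(\pi)(-1)^{1+\nu_{n-1}+\nu_n}$; finally change the sign of the first entry if $\mu$ has an odd number of positive entries. The result is the window of $d_D(\pi,v)$. $\operatorname{Diag}(D_n)$: pairs $(\beta,w)$ with $\beta\in\mathcal B^\bullet_{2n-1}$, $w\in\mathfrak S_n^D$, such that for each valley $(i,j)$ of $\beta$: $w(n+1-i)>w(n+1-j)$ if $j\le n-1$, $>\epsilon(\beta)w(1)$ if $j=n$, $>-\epsilon(\beta)w(1)$ if $j=n+1$, $>w(n-j)$ if $j\ge n+2$ (with $w(-k)=-w(k)$); and moreover $w(n+1-i)>|w(1)|$ if $\beta$ has a valley $(i,n)$ and its $n$-th North step is not followed by an East step. -}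

module Defs where

open import Data.Bool using (Bool; true; false; if_then_else_; not; _∧_; _∨_)
open import Data.Nat as ℕ using (ℕ; zero; suc; _∸_; _≡ᵇ_; _<ᵇ_)
open import Data.Integer as ℤ using (ℤ; +_; -[1+_]; ∣_∣; _+_; _-_; _*_; -_; _<_; 0ℤ; 1ℤ; -1ℤ)
open import Data.List using (List; []; _∷_; _++_; map; length; concat; downFrom; upTo; reverse; take; foldr)
open import Data.List.Relation.Unary.All using (All)
open import Data.List.Membership.Propositional using (_∈_)
open import Data.List.Relation.Binary.Permutation.Propositional using (_↭_)
open import Data.Product using (Σ; _×_; _,_)
open import Data.Sum using (_⊎_)
open import Data.Unit using (⊤)
open import Data.Empty using (⊥)
open import Relation.Binary.PropositionalEquality using (_≡_)
open import Relation.Nullary using (does)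

-- 1-indexed lookup with a default value (index 0 or out of range gives d)
atD : {A : Set} → A → List A → ℕ → A
atD d [] _ = d
atD d (x ∷ xs) zero = d
atD d (x ∷ xs) (suc zero) = x
atD d (x ∷ xs) (suc (suc k)) = atD d xs (suc k)

at : List ℤ → ℕ → ℤ
at = atD 0ℤ

range1 : ℕ → List ℕ
range1 n = map suc (upTo n)

isEven : ℕ → Bool
isEven zero = true
isEven (suc zero) = false
isEven (suc (suc k)) = isEven k

infix 4 _==ℤ_
_==ℤ_ : ℤ → ℤ → Bool
x ==ℤ y = does (x ℤ.≟ y)

countᵇ : {A : Set} → (A → Bool) → List A → ℕ
countᵇ p [] = 0
countᵇ p (x ∷ xs) = if p x then suc (countᵇ p xs) else countᵇ p xs

sumℕ : List ℕ → ℕ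
sumℕ = foldr ℕ._+_ 0

negOnePow : ℤ → ℤ
negOnePow k = if isEven ∣ k ∣ then 1ℤ else -1ℤ

isPos : ℤ → Bool
isPos (+ zero) = false
isPos (+ (suc _)) = true
isPos -[1+ _ ] = false

isNeg : ℤ → Bool
isNeg (+ _) = false
isNeg -[1+ _ ] = true

sgn : ℤ → ℤ
sgn (+ zero) = 0ℤ
sgn (+ (suc _)) = 1ℤ
sgn -[1+ _ ] = -1ℤ

dropLast : {A : Set} → List A → List A
dropLast [] = []
dropLast (x ∷ []) = []
dropLast (x ∷ y ∷ xs) = x ∷ dropLast (y ∷ xs)

data Step : Set where
  N E E⁺ E⁻ : Step

isN : Step → Bool
isN N = true
isN _ = false

isEast : Step → Bool
isEast N = false
isEast _ = true

isE⁻ : Step → Bool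
isE⁻ E⁻ = true
isE⁻ _ = false

countN countE : List Step → ℕ
countN = countᵇ isN
countE = countᵇ isEast

Plain : Step → Set
Plain s = (s ≡ N) ⊎ (s ≡ E)

ε : List Step → ℤ
ε p = if countᵇ isE⁻ p ≡ᵇ 0 then 1ℤ else -1ℤ

FirstSigned : List Step → Set
FirstSigned [] = ⊤
FirstSigned (N ∷ xs) = All Plain xs
FirstSigned (E ∷ xs) = ⊥
FirstSigned (E⁺ ∷ xs) = All Plain xs
FirstSigned (E⁻ ∷ xs) = All Plain xs

SignedLatticePath : ℕ → List Step → Set
SignedLatticePath n p = (countN p ≡ n) × (countE p ≡ n ∸ 1) × FirstSigned p

Special : Step → Set
Special s = (s ≡ N) ⊎ (s ≡ E⁺) ⊎ (s ≡ E⁻)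

SignShape : ℕ → List Step → Set
SignShape _ [] = ⊤
SignShape zero xs = All Plain xs
SignShape (suc zero) (N ∷ []) = ⊤
SignShape (suc zero) (N ∷ x ∷ xs) = Special x × All Plain xs
SignShape (suc (suc k)) (N ∷ xs) = SignShape (suc k) xs
SignShape (suc k) (E ∷ xs) = SignShape (suc k) xs
SignShape (suc k) (E⁺ ∷ xs) = ⊥
SignShape (suc k) (E⁻ ∷ xs) = ⊥

SignedBallotPath : ℕ → List Step → Set
SignedBallotPath n b =
  (length b ≡ 2 ℕ.* n ∸ 1)
  × (∀ k → countE (take k b) ℕ.≤ countN (take k b))
  × SignShape n b

nthNFollowedByEast : ℕ → List Step → Bool
nthNFollowedByEast _ [] = false
nthNFollowedByEast zero _ = false
nthNFollowedByEast (suc zero) (N ∷ []) = false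
nthNFollowedByEast (suc zero) (N ∷ x ∷ xs) = isEast x
nthNFollowedByEast (suc (suc k)) (N ∷ xs) = nthNFollowedByEast (suc k) xs
nthNFollowedByEast (suc k) (x ∷ xs) = nthNFollowedByEast (suc k) xs

signAfterNthN : ℕ → Step → List Step → List Step
signAfterNthN zero s xs = xs
signAfterNthN (suc k) s [] = []
signAfterNthN (suc zero) s (N ∷ []) = N ∷ []
signAfterNthN (suc zero) s (N ∷ x ∷ xs) = N ∷ (if isEast x then s else x) ∷ xs
signAfterNthN (suc (suc k)) s (N ∷ xs) = N ∷ signAfterNthN (suc k) s xs
signAfterNthN (suc k) s (x ∷ xs) = x ∷ signAfterNthN (suc k) s xs

rises : List Step → List ℕ
rises = go 0
  where
  go : ℕ → List Step → List ℕ
  go m [] = []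
  go m (N ∷ N ∷ xs) = suc m ∷ go (suc m) (N ∷ xs)
  go m (N ∷ xs) = go (suc m) xs
  go m (x ∷ xs) = go m xs

valleys : List Step → List (ℕ × ℕ)
valleys = go 0 0
  where
  go : ℕ → ℕ → List Step → List (ℕ × ℕ)
  go e m [] = []
  go e m (N ∷ xs) = go e (suc m) xs
  go e m (x ∷ []) = (suc e , suc m) ∷ []
  go e m (x ∷ N ∷ xs) = (suc e , suc m) ∷ go (suc e) m (N ∷ xs)
  go e m (x ∷ y ∷ xs) = go (suc e) m (y ∷ xs)

startsNN : List Step → Bool
startsNN (N ∷ N ∷ _) = true
startsNN _ = false

-- Signed permutations (as windows [w(1), ..., w(n)])

IsSignedPerm : ℕ → List ℤ → Set
IsSignedPerm n w = map ∣_∣ w ↭ range1 n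

IsTypeD : List ℤ → Set
IsTypeD w = isEven (countᵇ isNeg w) ≡ true

wAt : List ℤ → ℤ → ℤ
wAt w (+ k) = at w k
wAt w -[1+ k ] = - at w (suc k)

eastsBefore : List Step → List ℕ
eastsBefore = go 0
  where
  go : ℕ → List Step → List ℕ
  go e [] = []
  go e (N ∷ xs) = e ∷ go e xs
  go e (x ∷ xs) = go (suc e) xs

piAt : List Step → ℕ → ℕ
piAt p i = atD 0 (eastsBefore p) i

case03 : ℕ → Bool
case03 n = ((n ∸ 1) ℕ.% 4 ≡ᵇ 0) ∨ ((n ∸ 1) ℕ.% 4 ≡ᵇ 3)

lamN : ℕ → List Step → ℤ
lamN n p =
  if isEven (sumℕ (map (piAt p) (range1 (n ∸ 2))))
  then (+ (2 ℕ.* piAt p n)) - (+ piAt p (n ∸ 1))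
  else (+ (2 ℕ.* n ∸ 1)) - (+ (2 ℕ.* piAt p n)) + (+ piAt p (n ∸ 1))

lam : ℕ → List Step → ℕ → ℤ
lam n p i =
  if i ≡ᵇ 1 then ε p * (+ piAt p 1)
  else if i ≡ᵇ n then lamN n p
  else + piAt p i

nu : ℕ → ℕ → ℤ
nu n i =
  if i ≡ᵇ n then (if case03 n then + (n ∸ 1) else + n)
  else + (i ∸ 1)

mu : ℕ → List Step → ℕ → ℤ
mu n p i =
  if case03 n
  then (if i ≡ᵇ 1 then lam n p 1 else lam n p i - + (i ∸ 1))
  else (if i ≡ᵇ 1 then - lam n p 1
        else if i ≡ᵇ n then + n - lam n p n
        else lam n p i - + (i ∸ 1))

muVec : ℕ → List Step → List ℤ
muVec n p = map (mu n p) (range1 n)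

S⁺→ : ℕ → List ℤ → List Step
S⁺→ j [] = []
S⁺→ j (x ∷ xs) =
  (if x ==ℤ (+ j) then N ∷ [] else if x ==ℤ (+ suc j) then E ∷ [] else []) ++ S⁺→ j xs

S⁻→ : ℕ → List ℤ → List Step
S⁻→ j [] = []
S⁻→ j (x ∷ xs) =
  (if x ==ℤ - (+ j) then N ∷ [] else if x ==ℤ - (+ suc j) then E ∷ [] else []) ++ S⁻→ j xs

S⁺← : ℕ → List ℤ → List Step
S⁺← j a = S⁺→ j (reverse a)

S⁻← : ℕ → List ℤ → List Step
S⁻← j a = S⁻→ j (reverse a)

zetaRaw : ℕ → List Step → List Step
zetaRaw n p =
  let m = muVec n p in
  dropLast (concat (map (λ k → S⁻← k m ++ S⁺→ k m) (downFrom (2 ℕ.* n))))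

zetaD : ℕ → List Step → List Step
zetaD n p =
  signAfterNthN n (if isEven (countᵇ isPos (muVec n p)) then E⁺ else E⁻) (zetaRaw n p)

readingRaw : ℕ → List Step → List ℤ → List (ℕ × ℤ)
readingRaw n p v =
  concat (map step (upTo (suc (sumℕ (map ∣_∣ (muVec n p))))))
  where
  step : ℕ → List (ℕ × ℤ)
  step i =
    concat (map (λ j → if mu n p j ==ℤ - (+ i) then (j , at v j) ∷ [] else [])
                (range1 n))
    ++
    concat (map (λ j → if mu n p j ==ℤ (+ suc i) then (j , - at v j) ∷ [] else [])
                (reverse (range1 n)))

dD : ℕ → List Step → List ℤ → List ℤ
dD n p v = flipFirst (map adjust (readingRaw n p v))
  where
  adjust : ℕ × ℤ → ℤ
  adjust (j , x) =
    if j ≡ᵇ n then negOnePow (1ℤ + mu n p (n ∸ 1) + mu n p n) * x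
    else if j ≡ᵇ 1 then ε p * negOnePow (1ℤ + nu n (n ∸ 1) + nu n n) * x
    else x
  flipFirst : List ℤ → List ℤ
  flipFirst [] = []
  flipFirst (x ∷ xs) = (if isEven (countᵇ isPos (muVec n p)) then x else - x) ∷ xs

signProduct : List ℤ → ℤ
signProduct = foldr (λ x acc → sgn x * acc) 1ℤ

Vert : ℕ → List Step → List ℤ → Set
Vert n p v =
  SignedLatticePath n p
  × IsSignedPerm n v
  × All (λ i → at v i < at v (suc i)) (rises p)
  × (startsNN p ≡ true → + ∣ at v 1 ∣ < at v 2)
  × (signProduct v ≡ ε p * negOnePow (lam n p (n ∸ 1) + lam n p n))

valleyBound : ℕ → List Step → List ℤ → ℕ → ℤ
valleyBound n b w j =
  if j <ᵇ n then wAt w (+ (n ℕ.+ 1 ∸ j))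
  else if j ≡ᵇ n then ε b * at w 1
  else if j ≡ᵇ suc n then - (ε b * at w 1)
  else wAt w (+ n - + j)

ValleyCond : ℕ → List Step → List ℤ → ℕ × ℕ → Set
ValleyCond n b w (i , j) = valleyBound n b w j < at w (n ℕ.+ 1 ∸ i)

Diag : ℕ → List Step → List ℤ → Set
Diag n b w =
  SignedBallotPath n b
  × IsSignedPerm n w
  × IsTypeD w
  × All (ValleyCond n b w) (valleys b)
  × (∀ i → (i , n) ∈ valleys b → nthNFollowedByEast n b ≡ false →
       + ∣ at w 1 ∣ < at w (n ℕ.+ 1 ∸ i))

{-# OPTIONS --safe #-}
module Submission where

-- The area vectors μ are the integer vectors of even sum with μ_i ≤ μ_{i+1} + 1, μ_1 + μ_2 ≥ −1 and
-- μ_{n−1} + μ_n ≤ 2. Neither the word nor the reading changes under (μ_n, v_n) ↦ (1 − μ_n, −v_n) or,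
-- apart from the sign of the first label when μ_1 = 0, under (μ_1, v_1) ↦ (−μ_1, −v_1). Hence one may
-- assume μ_1 ≥ 0 ≥ μ_n; the parity conditions on both sides recover the lost signs.
-- Between consecutive zeros such a μ has first negative and then positive entries, and either kind is
-- the depth sequence of an ordered forest. Reversed, the word records the numbers of children of the
-- vertices of this forest in breadth-first order, and the diagonal reading lists its labels in the same
-- order, so a queue rebuilds the labelled forest from the image. Finally both rises and valleys
-- correspond to the pairs (vertex, first child), and both labelling conditions say that the label of
-- the vertex is smaller than that of its first child.

open import Defs
open import Data.Bool as Bool using (Bool; true; false; if_then_else_; not)
open import Data.Empty using (⊥; ⊥-elim)
open import Data.Integer as ℤ using (ℤ; +_; -[1+_]; -_; 0ℤ; 1ℤ; -1ℤ; +≤+; -≤+; ∣_∣)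
import Data.Integer.Properties as ℤₚ
open import Data.Integer.Solver using (module +-*-Solver)
open import Data.List using (List; []; _∷_; _++_; map; length; concat; concatMap; replicate; reverse; _∷ʳ_; take; drop; initLast; _∷ʳ′_; _ʳ++_; upTo; downFrom; applyUpTo)
open import Data.List.Membership.Propositional using (_∈_)
import Data.List.Properties as Lₚ
open import Data.List.Relation.Binary.Permutation.Propositional as Perm using (_↭_; ↭-sym; ↭-refl; ↭-trans; ↭-reflexive)
open import Data.List.Relation.Binary.Permutation.Propositional.Properties using (All-resp-↭; ↭-reverse; ++⁺; ++⁺ˡ; ++-comm; map⁺; ↭-length)
open import Data.List.Relation.Unary.All as All using (All; []; _∷_)
import Data.List.Relation.Unary.All.Properties as Allₚ
open import Data.Nat as ℕ using (ℕ; zero; suc; _≤_; _<_; z≤n; s≤s)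
import Data.Nat.Properties as ℕₚ
import Data.Nat.Solver as ℕSolver
open import Data.Product using (Σ; ∃; ∃₂; _×_; _,_; proj₁; proj₂)
open import Data.Sum using (_⊎_; inj₁; inj₂)
open import Data.Unit using (⊤; tt)
open import Function using (_∘_; id)
open import Relation.Binary.Definitions using (tri<; tri≈; tri>)
open import Relation.Binary.PropositionalEquality using (_≡_; _≢_; refl; sym; trans; cong; cong₂; subst; subst₂; module ≡-Reasoning)
open import Relation.Nullary using (Dec; yes; no)
open import Relation.Nullary.Decidable using (dec-true; dec-false)

-- Labelled forests, depth-first and breadth-first

-- The obstacle is that a zero of μ writes two N's, one in each scan of level 0, while the reading
-- lists its label only once. Every zero therefore becomes two roots, labelled `v` and `- v`; the
-- copies missing from the reading are restored from the head of the window, and the number of zeros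
-- is the excess over `n` of the N's of the complete word. These copies also explain why the bounds
-- of late valleys are negated entries of the window. The letter deleted at the end of the word
-- carries no information, since a vector in normal form always produces N there. If μ_1 = 0, the
-- first label may be given either sign: the two conditions that mention an absolute value demand
-- exactly that both signs be admissible, and only the parity conditions tell which one is meant. If
-- μ_1 ≠ 0, the sign of the first East step is what parity decides. The relation between a vertex
-- and its first child is kept abstract, so that one argument yields both the shape of μ and the
-- labelling condition.

data Tree : Set where
  node : ℤ → List Tree → Tree

root : Tree → ℤ
root (node l _) = l

node-injective : ∀ {l l′ C C′} → node l C ≡ node l′ C′ → l ≡ l′ × C ≡ C′
node-injective refl = refl , refl

kids : List Tree → List Tree
kids [] = []
kids (node _ C ∷ F) = C ++ kids F

kids^ : ℕ → List Tree → List Tree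
kids^ zero F = F
kids^ (suc k) F = kids^ k (kids F)

-- Applied to level `k` of a forest this is block `k` of the reversed word: a vertex of depth `k`
-- supplies the N, its children of depth `k + 1` supply the E's.
degrees : List Tree → List Step
degrees [] = []
degrees (node _ C ∷ F) = N ∷ map (λ _ → E) C ++ degrees F

kids-++ : ∀ F G → kids (F ++ G) ≡ kids F ++ kids G
kids-++ [] G = refl
kids-++ (node _ C ∷ F) G = trans (cong (C ++_) (kids-++ F G)) (sym (Lₚ.++-assoc C _ _))

kids^-++ : ∀ k F G → kids^ k (F ++ G) ≡ kids^ k F ++ kids^ k G
kids^-++ zero F G = refl
kids^-++ (suc k) F G = trans (cong (kids^ k) (kids-++ F G)) (kids^-++ k (kids F) (kids G))

degrees-++ : ∀ F G → degrees (F ++ G) ≡ degrees F ++ degrees G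
degrees-++ [] G = refl
degrees-++ (node _ C ∷ F) G =
  cong (N ∷_) (trans (cong (map _ C ++_) (degrees-++ F G)) (sym (Lₚ.++-assoc (map _ C) _ _)))

dfs : ℕ → List Tree → List (ℕ × ℤ)
dfs d [] = []
dfs d (node l C ∷ F) = (d , l) ∷ dfs (suc d) C ++ dfs d F

dfs-++ : ∀ d F G → dfs d (F ++ G) ≡ dfs d F ++ dfs d G
dfs-++ d [] G = refl
dfs-++ d (node l C ∷ F) G =
  cong ((d , l) ∷_) (trans (cong (dfs (suc d) C ++_) (dfs-++ d F G)) (sym (Lₚ.++-assoc (dfs (suc d) C) _ _)))

dfs-deep : ∀ d F → All (λ x → d ≤ proj₁ x) (dfs d F)
dfs-deep d [] = []
dfs-deep d (node l C ∷ F) =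
  ℕₚ.≤-refl ∷ Allₚ.++⁺ (All.map (ℕₚ.≤-trans (ℕₚ.n≤1+n d)) (dfs-deep (suc d) C)) (dfs-deep d F)

module _ {A B : Set} (φ : A → List B) where

  concatMap-null : ∀ {xs} → All (λ x → φ x ≡ []) xs → concatMap φ xs ≡ []
  concatMap-null [] = refl
  concatMap-null (px ∷ pxs) = cong₂ _++_ px (concatMap-null pxs)

module _ {B : Set} (φ : ℕ × ℤ → List B) where

  concatMap-dfs-null : ∀ d F → (∀ e l → d ≤ e → φ (e , l) ≡ []) → concatMap φ (dfs d F) ≡ []
  concatMap-dfs-null d F h = concatMap-null φ (All.map (λ {x} → h (proj₁ x) (proj₂ x)) (dfs-deep d F))

  concatMap-dfs-kids : ∀ d F → (∀ l → φ (d , l) ≡ []) →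
    concatMap φ (dfs d F) ≡ concatMap φ (dfs (suc d) (kids F))
  concatMap-dfs-kids d [] h = refl
  concatMap-dfs-kids d (node l C ∷ F) h = begin
    φ (d , l) ++ concatMap φ (dfs (suc d) C ++ dfs d F)
      ≡⟨ cong₂ _++_ (h l) (Lₚ.concatMap-++ φ (dfs (suc d) C) (dfs d F)) ⟩
    concatMap φ (dfs (suc d) C) ++ concatMap φ (dfs d F)
      ≡⟨ cong (concatMap φ (dfs (suc d) C) ++_) (concatMap-dfs-kids d F h) ⟩
    concatMap φ (dfs (suc d) C) ++ concatMap φ (dfs (suc d) (kids F))
      ≡⟨ Lₚ.concatMap-++ φ (dfs (suc d) C) (dfs (suc d) (kids F)) ⟨
    concatMap φ (dfs (suc d) C ++ dfs (suc d) (kids F))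
      ≡⟨ cong (concatMap φ) (dfs-++ (suc d) C (kids F)) ⟨
    concatMap φ (dfs (suc d) (C ++ kids F)) ∎
    where open ≡-Reasoning

  -- Removing the roots of a forest keeps the depth-first order of the other vertices. A selection
  -- that ignores the first `k` levels can therefore be made in the forest below them.
  concatMap-dfs-kids^ : ∀ k d F → (∀ e l → e < d ℕ.+ k → φ (e , l) ≡ []) →
    concatMap φ (dfs d F) ≡ concatMap φ (dfs (d ℕ.+ k) (kids^ k F))
  concatMap-dfs-kids^ zero d F h = cong (λ e → concatMap φ (dfs e F)) (sym (ℕₚ.+-identityʳ d))
  concatMap-dfs-kids^ (suc k) d F h = begin
    concatMap φ (dfs d F)
      ≡⟨ concatMap-dfs-kids d F (λ l → h d l (ℕₚ.m<m+n d (s≤s z≤n))) ⟩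
    concatMap φ (dfs (suc d) (kids F))
      ≡⟨ concatMap-dfs-kids^ k (suc d) (kids F) (λ e l lt → h e l (subst (e <_) (sym (ℕₚ.+-suc d k)) lt)) ⟩
    concatMap φ (dfs (suc d ℕ.+ k) (kids^ (suc k) F))
      ≡⟨ cong (λ e → concatMap φ (dfs e (kids^ (suc k) F))) (sym (ℕₚ.+-suc d k)) ⟩
    concatMap φ (dfs (d ℕ.+ suc k) (kids^ (suc k) F)) ∎
    where open ≡-Reasoning

  concatMap-dfs-roots : ∀ d F (g : Tree → List B) →
    (∀ l → φ (d , l) ≡ g (node l [])) → (∀ l C → g (node l C) ≡ g (node l [])) → (∀ e l → d < e → φ (e , l) ≡ []) →
    concatMap φ (dfs d F) ≡ concatMap g F
  concatMap-dfs-roots d [] g hd hg h = refl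
  concatMap-dfs-roots d (node l C ∷ F) g hd hg h =
    cong₂ _++_ (trans (hd l) (sym (hg l C)))
      (trans (Lₚ.concatMap-++ φ (dfs (suc d) C) (dfs d F))
             (cong₂ _++_ (concatMap-dfs-null (suc d) C h) (concatMap-dfs-roots d F g hd hg h)))

-- In depth-first order the children of a vertex come before the next vertex of its own level, and
-- anything deeper is discarded. So the E's right after an N count the children of its vertex.
concatMap-dfs-degrees : ∀ (φ : ℕ × ℤ → List Step) d F →
  (∀ l → φ (d , l) ≡ N ∷ []) → (∀ l → φ (suc d , l) ≡ E ∷ []) → (∀ i l → suc d < i → φ (i , l) ≡ []) →
  concatMap φ (dfs d F) ≡ degrees F
concatMap-dfs-degrees φ d [] hn he h = refl
concatMap-dfs-degrees φ d (node l C ∷ F) hn he h =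
  cong₂ _++_ (hn l) (trans (Lₚ.concatMap-++ φ (dfs (suc d) C) (dfs d F))
    (cong₂ _++_ (children C) (concatMap-dfs-degrees φ d F hn he h)))
  where
  children : ∀ C → concatMap φ (dfs (suc d) C) ≡ map (λ _ → E) C
  children [] = refl
  children (node l C ∷ F) =
    cong₂ _++_ (he l) (trans (Lₚ.concatMap-++ φ (dfs (suc (suc d)) C) (dfs (suc d) F))
      (cong₂ _++_ (concatMap-dfs-null φ (suc (suc d)) C h) (children F)))

-- A word is read as instructions for a queue of trees (N closes a new tree over
-- the collected children, E moves the oldest tree to the children); words, labels
-- and queues are listed with the latest item first.
data Reads : List Step → List ℤ → List Tree → List Tree → Set where
  start : Reads [] [] [] []
  north : ∀ {ρ ls Q C l} → Reads ρ ls Q C → Reads (N ∷ ρ) (l ∷ ls) (node l C ∷ Q) []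
  east  : ∀ {ρ ls Q C t} → Reads ρ ls (Q ∷ʳ t) C → Reads (E ∷ ρ) ls Q (t ∷ C)

Reads-functional : ∀ {ρ ls Q Q′ C C′} → Reads ρ ls Q C → Reads ρ ls Q′ C′ → Q ≡ Q′ × C ≡ C′
Reads-functional start start = refl , refl
Reads-functional (north d) (north d′) with Reads-functional d d′
... | refl , refl = refl , refl
Reads-functional (east {Q = Q} d) (east {Q = Q′} d′) with Reads-functional d d′
... | eq , refl with Lₚ.∷ʳ-injective Q Q′ eq
... | refl , refl = refl , refl

-- A state reveals the step that led to it: collected children come from an E, and an empty
-- collection over a nonempty queue comes from an N. Hence the forest determines the word and the
-- labels.
Reads-cofunctional : ∀ {ρ ρ′ ls ls′ Q C} → Reads ρ ls Q C → Reads ρ′ ls′ Q C → ρ ≡ ρ′ × ls ≡ ls′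
Reads-cofunctional start start = refl , refl
Reads-cofunctional (north d) (north d′) with Reads-cofunctional d d′
... | refl , refl = refl , refl
Reads-cofunctional (east d) (east d′) with Reads-cofunctional d d′
... | refl , refl = refl , refl

recast : ∀ {ρ ls Q Q′ C} → Q ≡ Q′ → Reads ρ ls Q C → Reads ρ ls Q′ C
recast refl d = d

Reads-easts : ∀ {ρ ls} Q C → Reads ρ ls (Q ++ C) [] → Reads (map (λ _ → E) C ++ ρ) ls Q C
Reads-easts Q [] d = recast (Lₚ.++-identityʳ Q) d
Reads-easts Q (t ∷ C) d = east (Reads-easts (Q ∷ʳ t) C (recast (sym (Lₚ.++-assoc Q (t ∷ []) C)) d))

-- The children of `F` are the oldest trees of the queue and stand at its end. Reading the level of
-- `F` consumes exactly these and enters the trees of `F` at the front, so deeper levels have to be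
-- read earlier.
Reads-degrees : ∀ {ρ ls} F Q → Reads ρ ls (Q ++ kids F) [] → Reads (degrees F ++ ρ) (map root F ++ ls) (F ++ Q) []
Reads-degrees [] Q d = recast (Lₚ.++-identityʳ Q) d
Reads-degrees {ρ} (node l C ∷ F) Q d =
  north (subst (λ w → Reads w _ (F ++ Q) C) (sym (Lₚ.++-assoc (map _ C) (degrees F) ρ))
    (Reads-easts (F ++ Q) C (recast (sym (Lₚ.++-assoc F Q C))
      (Reads-degrees F (Q ++ C) (recast (sym (Lₚ.++-assoc Q C (kids F))) d)))))

levels : {A : Set} → ℕ → (List Tree → List A) → List Tree → List A
levels zero f F = []
levels (suc K) f F = f F ++ levels K f (kids F)

Reads-levels : ∀ K F → kids^ K F ≡ [] → Reads (levels K degrees F) (levels K (map root) F) F []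
Reads-levels zero F refl = start
Reads-levels (suc K) F h = recast (Lₚ.++-identityʳ F) (Reads-degrees F [] (Reads-levels K (kids F) h))

-- With the latest letter stored first, the suffixes of the list are the prefixes of the path.
Ballot : List Step → Set
Ballot [] = ⊤
Ballot (x ∷ ρ) = countE (x ∷ ρ) ≤ countN (x ∷ ρ) × Ballot ρ

Reads-countN : ∀ {ρ ls Q C} → Reads ρ ls Q C → countN ρ ≡ length ls
Reads-countN start = refl
Reads-countN (north d) = cong suc (Reads-countN d)
Reads-countN (east d) = Reads-countN d

Reads-balance : ∀ {ρ ls Q C} → Reads ρ ls Q C → countN ρ ≡ length Q ℕ.+ countE ρ
Reads-balance start = refl
Reads-balance (north d) = cong suc (Reads-balance d)
Reads-balance (east {Q = Q} d) =
  trans (Reads-balance d) (trans (cong (ℕ._+ _) (trans (Lₚ.length-++ Q) (ℕₚ.+-comm (length Q) 1))) (sym (ℕₚ.+-suc (length Q) _)))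

Reads-ballot : ∀ {ρ ls Q C} → Reads ρ ls Q C → Ballot ρ
Reads-ballot start = tt
Reads-ballot d₀@(north d) = ℕₚ.≤-trans (ℕₚ.m≤n+m _ _) (ℕₚ.≤-reflexive (sym (Reads-balance d₀))) , Reads-ballot d
Reads-ballot d₀@(east {Q = Q} d) = ℕₚ.≤-trans (ℕₚ.m≤n+m _ (length Q)) (ℕₚ.≤-reflexive (sym (Reads-balance d₀))) , Reads-ballot d

Reads-plain : ∀ {ρ ls Q C} → Reads ρ ls Q C → All Plain ρ
Reads-plain start = []
Reads-plain (north d) = inj₁ refl ∷ Reads-plain d
Reads-plain (east d) = inj₂ refl ∷ Reads-plain d

Reads-total : ∀ ρ ls → All Plain ρ → Ballot ρ → countN ρ ≡ length ls → ∃₂ λ Q C → Reads ρ ls Q C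
Reads-total [] [] _ _ _ = [] , [] , start
Reads-total (N ∷ ρ) (l ∷ ls) (_ ∷ pl) (_ , bal) eq with Reads-total ρ ls pl bal (ℕₚ.suc-injective eq)
... | Q , C , d = node l C ∷ Q , [] , north d
Reads-total (E ∷ ρ) ls (_ ∷ pl) (le , bal) eq with Reads-total ρ ls pl bal eq
... | Q , C , d with initLast Q
-- An empty queue would mean as many E's as N's so far, and the present E would break the ballot
-- condition.
... | [] = ⊥-elim (ℕₚ.1+n≰n (ℕₚ.≤-trans le (ℕₚ.≤-reflexive (Reads-balance d))))
... | Q′ ∷ʳ′ t = Q′ , t ∷ C , east d
Reads-total (E⁺ ∷ ρ) ls (inj₁ () ∷ _)
Reads-total (E⁺ ∷ ρ) ls (inj₂ () ∷ _)
Reads-total (E⁻ ∷ ρ) ls (inj₁ () ∷ _)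
Reads-total (E⁻ ∷ ρ) ls (inj₂ () ∷ _)

-- A valley is an E followed by an N in the path, hence N before E in the reversed list. The
-- remaining letters precede it in the path and give the two indices.
Val : (ℕ × ℕ → Set) → List Step → Set
Val P [] = ⊤
Val P (N ∷ E ∷ ρ) = P (suc (countE ρ) , suc (countN ρ)) × Val P ρ
Val P (_ ∷ ρ) = Val P ρ

-- The labels are listed latest first, so the one with `k` labels behind it belongs to N number
-- `k + 1` of the path.
Agree : (ℕ → ℤ) → List ℤ → Set
Agree ℓ [] = ⊤
Agree ℓ (l ∷ ls) = ℓ (suc (length ls)) ≡ l × Agree ℓ ls

Agree-++ : ∀ {ℓ} xs {ys} → Agree ℓ (xs ++ ys) → Agree ℓ ys
Agree-++ [] a = a
Agree-++ (x ∷ xs) (_ , a) = Agree-++ xs a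

Below : (ℤ → ℤ → Set) → ℤ → List Tree → Set
Below _◁_ l [] = ⊤
Below _◁_ l (t ∷ _) = l ◁ root t

OK : (ℤ → ℤ → Set) → List Tree → Set
OK _◁_ [] = ⊤
OK _◁_ (node l C ∷ F) = Below _◁_ l C × OK _◁_ C × OK _◁_ F

Chain : {A : Set} → (A → A → Set) → A → List A → Set
Chain R x [] = ⊤
Chain R x (y ∷ ys) = R x y × Chain R y ys

-- In depth-first order depth grows by at most one from a vertex to the next, and it grows exactly
-- when the next vertex is the first child.
Down : (ℤ → ℤ → Set) → ℕ × ℤ → ℕ × ℤ → Set
Down _◁_ (d , l) (d′ , l′) = d′ ≤ suc d × (d′ ≡ suc d → l ◁ l′)

module _ {_◁_ : ℤ → ℤ → Set} where

  OK-++⁺ : ∀ {F G} → OK _◁_ F → OK _◁_ G → OK _◁_ (F ++ G)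
  OK-++⁺ {[]} _ g = g
  OK-++⁺ {node l C ∷ F} (h , c , f) g = h , c , OK-++⁺ {F} f g

  OK-++⁻ : ∀ F {G} → OK _◁_ (F ++ G) → OK _◁_ F × OK _◁_ G
  OK-++⁻ [] g = tt , g
  OK-++⁻ (node l C ∷ F) (h , c , fg) with OK-++⁻ F fg
  ... | f , g = (h , c , f) , g

  level-Down : ∀ {d e l l′} → d ≤ e → Down _◁_ (e , l) (d , l′)
  level-Down le = ℕₚ.m≤n⇒m≤1+n le , λ { refl → ⊥-elim (ℕₚ.1+n≰n le) }

  mutual
    -- The vertex that precedes `rest` may be any descendant of the last tree, or the given
    -- predecessor if there is no tree. Only its depth can be bounded, which is why the hypothesis
    -- on `rest` quantifies over all vertices that deep.
    Chain-dfs : ∀ {d e l} F {rest} → OK _◁_ F → d ≤ e →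
      (∀ x → d ≤ proj₁ x → Chain (Down _◁_) x rest) → Chain (Down _◁_) (e , l) (dfs d F ++ rest)
    Chain-dfs [] ok le h = h _ le
    Chain-dfs {d} (node l C ∷ F) {rest} (b , c , f) le h =
      level-Down le ,
      subst (Chain _ _) (sym (Lₚ.++-assoc (dfs (suc d) C) (dfs d F) rest))
        (Chain-dfs-child C b c (λ x le′ → Chain-dfs F f le′ h))

    Chain-dfs-child : ∀ {d l} C {rest} → Below _◁_ l C → OK _◁_ C →
      (∀ x → d ≤ proj₁ x → Chain (Down _◁_) x rest) → Chain (Down _◁_) (d , l) (dfs (suc d) C ++ rest)
    Chain-dfs-child [] b ok h = h _ ℕₚ.≤-refl
    Chain-dfs-child {d} (node l C ∷ F) {rest} b (b′ , c , f) h =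
      (ℕₚ.≤-refl , λ _ → b) ,
      subst (Chain _ _) (sym (Lₚ.++-assoc (dfs (suc (suc d)) C) (dfs (suc d) F) rest))
        (Chain-dfs-child C b′ c (λ x le → Chain-dfs F f le (λ y le′ → h y (ℕₚ.<⇒≤ le′))))

  mutual
    OK-dfs : ∀ {d x} F {rest} → Chain (Down _◁_) x (dfs d F ++ rest) → OK _◁_ F × ∃ λ y → Chain (Down _◁_) y rest
    OK-dfs [] ch = tt , _ , ch
    OK-dfs {d} (node l C ∷ F) {rest} (_ , ch)
      with OK-dfs-child C (subst (Chain _ _) (Lₚ.++-assoc (dfs (suc d) C) (dfs d F) rest) ch)
    ... | b , c , _ , ch′ with OK-dfs F ch′
    ... | f , y , ch″ = (b , c , f) , y , ch″

    OK-dfs-child : ∀ {d l} C {rest} → Chain (Down _◁_) (d , l) (dfs (suc d) C ++ rest) →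
      Below _◁_ l C × OK _◁_ C × ∃ λ y → Chain (Down _◁_) y rest
    OK-dfs-child [] ch = tt , tt , _ , ch
    OK-dfs-child {d} (node l C ∷ F) {rest} (r , ch)
      with OK-dfs-child C (subst (Chain _ _) (Lₚ.++-assoc (dfs (suc (suc d)) C) (dfs (suc d) F) rest) ch)
    ... | b , c , _ , ch′ with OK-dfs F ch′
    ... | f , y , ch″ = proj₂ r refl , (b , c , f) , y , ch″

  OK⇒Chain : ∀ {d l} C → Below _◁_ l C × OK _◁_ C → Chain (Down _◁_) (d , l) (dfs (suc d) C)
  OK⇒Chain C (b , ok) = subst (Chain _ _) (Lₚ.++-identityʳ _) (Chain-dfs-child C b ok (λ _ _ → tt))

  Chain⇒OK : ∀ {d l} C → Chain (Down _◁_) (d , l) (dfs (suc d) C) → Below _◁_ l C × OK _◁_ C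
  Chain⇒OK C ch with OK-dfs-child C (subst (Chain _ _) (sym (Lₚ.++-identityʳ _)) ch)
  ... | b , ok , _ = b , ok

-- With this relation `Drop` and `Down` describe bare area vectors and bare depth sequences; with
-- the order of the integers they also express the conditions on labels.
Any◁ : ℤ → ℤ → Set
Any◁ _ _ = ⊤

OK-Any : ∀ F → OK Any◁ F
OK-Any [] = tt
OK-Any (node l []  ∷ F) = tt , tt , OK-Any F
OK-Any (node l C@(_ ∷ _) ∷ F) = tt , OK-Any C , OK-Any F

-- The queue is first in, first out, so the i-th E moves the tree made by the i-th N.
Reads-fifo : ∀ {ρ ls Q C} → Reads ρ ls Q C →
  ∃ λ rest → ls ≡ map root Q ++ map root C ++ rest × countE ρ ≡ length C ℕ.+ length rest
Reads-fifo start = [] , refl , refl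
Reads-fifo (north {Q = Q} {C = C} {l = l} d) with Reads-fifo d
... | rest , eq , eq′ = map root C ++ rest , cong (l ∷_) eq ,
  trans eq′ (sym (trans (Lₚ.length-++ (map root C)) (cong (ℕ._+ length rest) (Lₚ.length-map root C))))
Reads-fifo (east {Q = Q} {C = C} {t = t} d) with Reads-fifo d
... | rest , eq , eq′ = rest ,
  trans eq (trans (cong (_++ map root C ++ rest) (Lₚ.map-++ root Q (t ∷ []))) (Lₚ.++-assoc (map root Q) _ _)) ,
  cong suc eq′

module _ {ℓ : ℕ → ℤ} where

  private
    P : ℕ × ℕ → Set
    P (i , j) = ℓ j ℤ.< ℓ i

    fifo-label : ∀ {ρ ls Q C t} → Reads ρ ls (Q ∷ʳ t) C → Agree ℓ ls → ℓ (suc (countE ρ)) ≡ root t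
    fifo-label {Q = Q} {C} {t} d a with Reads-fifo (east d)
    ... | rest , refl , eq′ =
      trans (cong ℓ (trans eq′ (cong suc (sym (trans (Lₚ.length-++ (map root C)) (cong (ℕ._+ length rest) (Lₚ.length-map root C)))))))
            (proj₁ (Agree-++ (map root Q) a))

  -- The E directly before an N moves the first child of the vertex that this N creates, and by the
  -- queue order the `i`-th E moves vertex number `i`. So valley `(i , j)` compares first child `i`
  -- with its parent `j`; an N without an E before it creates a leaf.
  OK⇒Val : ∀ {ρ ls Q C} → Reads ρ ls Q C → Agree ℓ ls → OK ℤ._<_ Q → OK ℤ._<_ C → Val P ρ
  OK⇒Val start a q c = tt
  OK⇒Val (north start) a q c = tt
  OK⇒Val (north d@(north _)) (_ , a) (_ , c , q) _ = OK⇒Val d a q c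
  OK⇒Val (north d@(east d′)) (e , a) (b , c , q) _ =
    subst (ℤ._< _) (trans (sym e) (cong (λ k → ℓ (suc k)) (sym (Reads-countN d′)))) (subst (_ ℤ.<_) (sym (fifo-label d′ a)) b) , OK⇒Val d a q c
  OK⇒Val (east {Q = Q} {t = node _ _} d) a q (b , c′ , c) = OK⇒Val d a (OK-++⁺ {F = Q} q (b , c′ , tt)) c

  Val⇒OK : ∀ {ρ ls Q C} → Reads ρ ls Q C → Agree ℓ ls → Val P ρ → OK ℤ._<_ Q × OK ℤ._<_ C
  Val⇒OK start a v = tt , tt
  Val⇒OK (north start) a v = (tt , tt , tt) , tt
  Val⇒OK (north d@(north _)) (_ , a) v with Val⇒OK d a v
  ... | q , c = (tt , c , q) , tt
  Val⇒OK (north d@(east d′)) (e , a) (p , v) with Val⇒OK d a v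
  ... | q , c =
    (subst (ℤ._< _) (trans (cong (λ k → ℓ (suc k)) (Reads-countN d′)) e) (subst (_ ℤ.<_) (fifo-label d′ a) p) , c , q) , tt
  Val⇒OK (east {Q = Q} {t = node _ _} d) a v with Val⇒OK d a v
  ... | qt , c with OK-++⁻ Q qt
  ... | q , (b , c′ , _) = q , b , c′ , c

-- Parsing a depth sequence from the right: a suffix is a sequence of trees of
-- weakly decreasing depth, and a new vertex adopts the leading ones one level below it.
flatT : List (ℕ × Tree) → List (ℕ × ℤ)
flatT [] = []
flatT ((d , t) ∷ ts) = dfs d (t ∷ []) ++ flatT ts

Decreasing : ℕ → List (ℕ × Tree) → Set
Decreasing d [] = ⊤
Decreasing d ((e , _) ∷ ts) = e ≤ d × Decreasing e ts

adopt : ∀ d ts → Decreasing (suc d) ts → ∃₂ λ G ts′ → flatT ts ≡ dfs (suc d) G ++ flatT ts′ × Decreasing d ts′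
adopt d [] _ = [] , [] , refl , tt
adopt d ((e , t) ∷ ts) (le , dec) with e ℕ.≟ suc d
... | no ne = [] , (e , t) ∷ ts , refl , (ℕ.s≤s⁻¹ (ℕₚ.≤∧≢⇒< le ne) , dec)
adopt d ((_ , t@(node l C)) ∷ ts) (le , dec) | yes refl with adopt d ts dec
... | G , ts′ , eq , dec′ =
  t ∷ G , ts′ , trans (cong (dfs (suc d) (t ∷ []) ++_) eq)
    (trans (sym (Lₚ.++-assoc (dfs (suc d) (t ∷ [])) (dfs (suc d) G) _))
           (cong (_++ flatT ts′) (sym (dfs-++ (suc d) (t ∷ []) G)))) , dec′

parse : ∀ d l xs → Chain (Down Any◁) (d , l) xs →
  ∃₂ λ C ts → xs ≡ dfs (suc d) C ++ flatT ts × Decreasing d ts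
parse d l [] _ = [] , [] , refl , tt
parse d l ((d′ , l′) ∷ xs) ((le , _) , ch) with parse d′ l′ xs ch
... | C′ , ts′ , eq , dec with d′ ℕ.≟ suc d
... | no ne = [] , (d′ , node l′ C′) ∷ ts′ ,
  cong ((d′ , l′) ∷_) (trans eq (cong (_++ flatT ts′) (sym (Lₚ.++-identityʳ _)))) , ℕ.s≤s⁻¹ (ℕₚ.≤∧≢⇒< le ne) , dec
... | yes refl with adopt d ts′ dec
... | G , ts″ , eq′ , dec′ = node l′ C′ ∷ G , ts″ ,
  cong ((d′ , l′) ∷_) (trans eq (trans (cong (dfs (suc d′) C′ ++_) eq′) (sym (Lₚ.++-assoc (dfs (suc d′) C′) _ _)))) , dec′

parse-deep : ∀ d l xs → Chain (Down Any◁) (d , l) xs → All (λ x → d < proj₁ x) xs → ∃ λ C → xs ≡ dfs (suc d) C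
parse-deep d l xs ch deep with parse d l xs ch
... | C , [] , eq , _ = C , trans eq (Lₚ.++-identityʳ _)
... | C , (e , node _ _) ∷ ts , refl , le , _ with Allₚ.++⁻ʳ (dfs (suc d) C) deep
... | px ∷ _ = ⊥-elim (ℕₚ.<⇒≱ px le)

-- Area vectors in normal form as forests

Row : Set
Row = ℤ × ℤ

Linked : {A : Set} → (A → A → Set) → List A → Set
Linked R [] = ⊤
Linked R (x ∷ xs) = Chain R x xs

-- The case `m ≡ suc m′` is that of two North steps on the same vertical line, that is, of a rise.
Drop : (ℤ → ℤ → Set) → Row → Row → Set
Drop _◁_ (m , v) (m′ , v′) = m ℤ.≤ ℤ.suc m′ × (m ≡ ℤ.suc m′ → v ◁ v′)

StartNonNeg EndNonPos : List Row → Set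
StartNonNeg [] = ⊤
StartNonNeg ((m , _) ∷ _) = 0ℤ ℤ.≤ m
EndNonPos [] = ⊤
EndNonPos ((m , _) ∷ []) = m ℤ.≤ 0ℤ
EndNonPos (_ ∷ L@(_ ∷ _)) = EndNonPos L

-- Positive entries form depth sequences from right to left, which reverses the inequality at a
-- rise; negating their labels restores it.
posRow negRow : ℕ × ℤ → Row
posRow (d , l) = + d , - l
negRow (d , l) = - + d , l

-- Both stand for a zero of the area vector together with the positive entries before it, stored
-- from right to left, and the negative entries after it; in `Zero` the two lists have been parsed
-- into forests.
Seg Zero : Set
Seg = List (ℕ × ℤ) × ℤ × List (ℕ × ℤ)
Zero = List Tree × ℤ × List Tree

segFlat : List Seg → List Row
segFlat [] = []
segFlat ((Ps , v , Qs) ∷ ss) = map posRow Ps ʳ++ ((0ℤ , v) ∷ map negRow Qs ++ segFlat ss)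

toSeg : Zero → Seg
toSeg (P , v , Q) = dfs 1 P , v , dfs 1 Q

flat : List Zero → List Row
flat zs = segFlat (map toSeg zs)

-- Each zero is the root of its positive entries under the label `- v` and of its negative entries
-- under `v`. The positive trees come last zero first because positive entries are scanned from
-- right to left.
posTrees negTrees trees : List Zero → List Tree
posTrees [] = []
posTrees ((P , v , Q) ∷ zs) = posTrees zs ∷ʳ node (- v) P
negTrees [] = []
negTrees ((P , v , Q) ∷ zs) = node v Q ∷ negTrees zs
trees zs = posTrees zs ++ negTrees zs

suc-neg : ∀ k → ℤ.suc -[1+ k ] ≡ - + k
suc-neg zero = refl
suc-neg (suc k) = refl

neg+≤0 : ∀ d → - + d ℤ.≤ 0ℤ
neg+≤0 zero = +≤+ z≤n
neg+≤0 (suc d) = -≤+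

module _ {_◁_ : ℤ → ℤ → Set} (anti : ∀ {a b} → a ◁ b → (- b) ◁ (- a)) where

  anti⁻ : ∀ {a b} → (- b) ◁ (- a) → a ◁ b
  anti⁻ {a} {b} h = subst (λ x → x ◁ b) (ℤₚ.neg-involutive a) (subst (λ y → (- - a) ◁ y) (ℤₚ.neg-involutive b) (anti h))

  Drop-pos⁺ : ∀ {x y} → Down _◁_ y x → Drop _◁_ (posRow x) (posRow y)
  Drop-pos⁺ (le , t) = +≤+ le , λ { refl → anti (t refl) }

  Drop-pos⁻ : ∀ {x y} → Drop _◁_ (posRow x) (posRow y) → Down _◁_ y x
  Drop-pos⁻ (le , t) = ℤₚ.drop‿+≤+ le , λ { refl → anti⁻ (t refl) }

  Drop-neg⁺ : ∀ {x y} → Down _◁_ y x → Drop _◁_ (negRow y) (negRow x)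
  Drop-neg⁺ {zero , l′} {d , l} (le , t) =
    ℤₚ.≤-trans (neg+≤0 d) (+≤+ z≤n) , λ eq → ⊥-elim (ℤₚ.<⇒≢ (ℤₚ.≤-<-trans (neg+≤0 d) (ℤ.+<+ (s≤s z≤n))) eq)
  Drop-neg⁺ {suc k , l′} {d , l} (le , t) rewrite suc-neg k =
    ℤₚ.neg-mono-≤ (+≤+ (ℕ.s≤s⁻¹ le)) , λ eq → t (cong suc (sym (ℤₚ.+-injective (ℤₚ.neg-injective eq))))

  Drop-neg⁻ : ∀ {x y} → Drop _◁_ (negRow y) (negRow x) → Down _◁_ y x
  Drop-neg⁻ {zero , l′} {d , l} (le , t) = z≤n , λ ()
  Drop-neg⁻ {suc k , l′} {d , l} (le , t) rewrite suc-neg k =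
    s≤s (ℤₚ.drop‿+≤+ (ℤₚ.neg-cancel-≤ le)) , λ { refl → t refl }

  -- From a nonpositive to a nonnegative entry the inequality is strict, so it is never a rise and
  -- neighbouring segments put no condition on each other.
  Drop-up : ∀ d {l x} → 0ℤ ℤ.≤ proj₁ x → Drop _◁_ (negRow (d , l)) x
  Drop-up d {x = m , _} h =
    ℤₚ.<⇒≤ lt , λ eq → ⊥-elim (ℤₚ.<⇒≢ lt eq)
    where
    lt : - + d ℤ.< ℤ.suc m
    lt = ℤₚ.≤-<-trans (ℤₚ.≤-trans (neg+≤0 d) h) (ℤₚ.suc[i]≤j⇒i<j ℤₚ.≤-refl)

  Linked-pos⁺ : ∀ y Ps {rest} → Chain (Down _◁_) y Ps → Linked (Drop _◁_) (posRow y ∷ rest) →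
    Linked (Drop _◁_) (map posRow Ps ʳ++ (posRow y ∷ rest))
  Linked-pos⁺ y [] ch lk = lk
  Linked-pos⁺ y (p ∷ Ps) (r , ch) lk = Linked-pos⁺ p Ps ch (Drop-pos⁺ r , lk)

  Linked-pos⁻ : ∀ y Ps {rest} → Linked (Drop _◁_) (map posRow Ps ʳ++ (posRow y ∷ rest)) →
    Chain (Down _◁_) y Ps × Linked (Drop _◁_) (posRow y ∷ rest)
  Linked-pos⁻ y [] lk = tt , lk
  Linked-pos⁻ y (p ∷ Ps) lk with Linked-pos⁻ p Ps lk
  ... | ch , r , lk′ = (Drop-pos⁻ r , ch) , lk′

  Linked-neg⁺ : ∀ y Qs {rest} → Chain (Down _◁_) y Qs → StartNonNeg rest → Linked (Drop _◁_) rest →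
    Chain (Drop _◁_) (negRow y) (map negRow Qs ++ rest)
  Linked-neg⁺ y [] {[]} ch st lk = tt
  Linked-neg⁺ (d , l) [] {x ∷ rest} ch st lk = Drop-up d st , lk
  Linked-neg⁺ y (q ∷ Qs) (r , ch) st lk = Drop-neg⁺ r , Linked-neg⁺ q Qs ch st lk

  Linked-neg⁻ : ∀ y Qs {rest} → Chain (Drop _◁_) (negRow y) (map negRow Qs ++ rest) →
    Chain (Down _◁_) y Qs × Linked (Drop _◁_) rest
  Linked-neg⁻ y [] {[]} lk = tt , tt
  Linked-neg⁻ y [] {x ∷ rest} (_ , lk) = tt , lk
  Linked-neg⁻ y (q ∷ Qs) (r , lk) with Linked-neg⁻ q Qs lk
  ... | ch , lk′ = (Drop-neg⁻ r , ch) , lk′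

StartNonNeg-pos : ∀ Ps {rest} → StartNonNeg rest → StartNonNeg (map posRow Ps ʳ++ rest)
StartNonNeg-pos [] st = st
StartNonNeg-pos (p ∷ Ps) st = StartNonNeg-pos Ps (+≤+ z≤n)

segFlat-start : ∀ ss → StartNonNeg (segFlat ss)
segFlat-start [] = tt
segFlat-start ((Ps , v , Qs) ∷ ss) = StartNonNeg-pos Ps (+≤+ z≤n)

EndNonPos-∷ : ∀ {x} L → proj₁ x ℤ.≤ 0ℤ → EndNonPos L → EndNonPos (x ∷ L)
EndNonPos-∷ [] le _ = le
EndNonPos-∷ (_ ∷ _) _ e = e

EndNonPos-pos : ∀ Ps {x L} → EndNonPos (x ∷ L) → EndNonPos (map posRow Ps ʳ++ (x ∷ L))
EndNonPos-pos [] e = e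
EndNonPos-pos (p ∷ Ps) e = EndNonPos-pos Ps e

EndNonPos-neg : ∀ Qs {L} → EndNonPos L → EndNonPos (map negRow Qs ++ L)
EndNonPos-neg [] e = e
EndNonPos-neg ((d , l) ∷ Qs) {L} e = EndNonPos-∷ (map negRow Qs ++ L) (neg+≤0 d) (EndNonPos-neg Qs e)

segFlat-end : ∀ ss → EndNonPos (segFlat ss)
segFlat-end [] = tt
segFlat-end ((Ps , v , Qs) ∷ ss) =
  EndNonPos-pos Ps (EndNonPos-∷ (map negRow Qs ++ segFlat ss) (+≤+ z≤n) (EndNonPos-neg Qs (segFlat-end ss)))

module _ {_◁_ : ℤ → ℤ → Set} (anti : ∀ {a b} → a ◁ b → (- b) ◁ (- a)) where

  segFlat-Linked⁺ : ∀ ss → All (λ (Ps , v , Qs) → Chain (Down _◁_) (0 , - v) Ps × Chain (Down _◁_) (0 , v) Qs) ss →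
    Linked (Drop _◁_) (segFlat ss)
  segFlat-Linked⁺ [] [] = tt
  segFlat-Linked⁺ ((Ps , v , Qs) ∷ ss) ((p , q) ∷ h) =
    subst (λ w → Linked (Drop _◁_) (map posRow Ps ʳ++ ((0ℤ , w) ∷ map negRow Qs ++ segFlat ss))) (ℤₚ.neg-involutive v)
      (Linked-pos⁺ anti (0 , - v) Ps p
        (subst (λ w → Linked (Drop _◁_) ((0ℤ , w) ∷ map negRow Qs ++ segFlat ss)) (sym (ℤₚ.neg-involutive v))
          (Linked-neg⁺ anti (0 , v) Qs q (segFlat-start ss) (segFlat-Linked⁺ ss h))))

  segFlat-Linked⁻ : ∀ ss → Linked (Drop _◁_) (segFlat ss) →
    All (λ (Ps , v , Qs) → Chain (Down _◁_) (0 , - v) Ps × Chain (Down _◁_) (0 , v) Qs) ss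
  segFlat-Linked⁻ [] lk = []
  segFlat-Linked⁻ ((Ps , v , Qs) ∷ ss) lk
    with Linked-pos⁻ anti (0 , - v) Ps
           (subst (λ w → Linked (Drop _◁_) (map posRow Ps ʳ++ ((0ℤ , w) ∷ map negRow Qs ++ segFlat ss))) (sym (ℤₚ.neg-involutive v)) lk)
  ... | p , lk′ with Linked-neg⁻ anti (0 , v) Qs
           (subst (λ w → Linked (Drop _◁_) ((0ℤ , w) ∷ map negRow Qs ++ segFlat ss)) (ℤₚ.neg-involutive v) lk′)
  ... | q , lk″ = (p , q) ∷ segFlat-Linked⁻ ss lk″

  flat-Linked⁺ : ∀ zs → OK _◁_ (trees zs) → Linked (Drop _◁_) (flat zs)
  flat-Linked⁺ zs ok = segFlat-Linked⁺ (map toSeg zs) (chains zs (proj₁ (OK-++⁻ (posTrees zs) ok)) (proj₂ (OK-++⁻ (posTrees zs) ok)))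
    where
    chains : ∀ zs → OK _◁_ (posTrees zs) → OK _◁_ (negTrees zs) →
      All (λ (Ps , v , Qs) → Chain (Down _◁_) (0 , - v) Ps × Chain (Down _◁_) (0 , v) Qs) (map toSeg zs)
    chains [] _ _ = []
    chains ((P , v , Q) ∷ zs) p (b , q , n) with OK-++⁻ (posTrees zs) p
    ... | p′ , (b′ , q′ , _) = (OK⇒Chain P (b′ , q′) , OK⇒Chain Q (b , q)) ∷ chains zs p′ n

  flat-Linked⁻ : ∀ zs → Linked (Drop _◁_) (flat zs) → OK _◁_ (trees zs)
  flat-Linked⁻ zs lk = OK-++⁺ {F = posTrees zs} (proj₁ (oks zs (segFlat-Linked⁻ (map toSeg zs) lk))) (proj₂ (oks zs (segFlat-Linked⁻ (map toSeg zs) lk)))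
    where
    oks : ∀ zs → All (λ (Ps , v , Qs) → Chain (Down _◁_) (0 , - v) Ps × Chain (Down _◁_) (0 , v) Qs) (map toSeg zs) →
      OK _◁_ (posTrees zs) × OK _◁_ (negTrees zs)
    oks [] _ = tt , tt
    oks ((P , v , Q) ∷ zs) ((p , q) ∷ h) with oks zs h | Chain⇒OK P p | Chain⇒OK Q q
    ... | ps , ns | b , c | b′ , c′ = OK-++⁺ {F = posTrees zs} ps (b , c , tt) , (b′ , c′ , ns)

Deep : List (ℕ × ℤ) → Set
Deep = All (λ x → 0 < proj₁ x)

DeepSeg : Seg → Set
DeepSeg (Ps , _ , Qs) = Deep Ps × Deep Qs

-- The vector is cut from the right, where `Q` holds negative entries still waiting for their zero.
-- A positive entry cannot stand directly before a negative one, as the drop is at most one, nor at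
-- the end by `EndNonPos`; so it joins the positive entries of the next zero.
segment : ∀ L → Linked (Drop Any◁) L → EndNonPos L →
  ∃₂ λ Q ss → L ≡ map negRow Q ++ segFlat ss × Deep Q × All DeepSeg ss
segment-cons : ∀ x L → Linked (Drop Any◁) (x ∷ L) → EndNonPos (x ∷ L) →
  (∃₂ λ Q ss → L ≡ map negRow Q ++ segFlat ss × Deep Q × All DeepSeg ss) →
  ∃₂ λ Q ss → x ∷ L ≡ map negRow Q ++ segFlat ss × Deep Q × All DeepSeg ss

segment [] lk e = [] , [] , refl , [] , []
segment (x ∷ []) lk e = segment-cons x [] lk e ([] , [] , refl , [] , [])
segment (x ∷ L@(_ ∷ _)) lk e = segment-cons x L lk e (segment L (proj₂ lk) e)

segment-cons (+ zero , v) L lk e (Q , ss , eq , dq , ds) =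
  [] , ([] , v , Q) ∷ ss , cong (_ ∷_) eq , [] , ([] , dq) ∷ ds
segment-cons (-[1+ d ] , v) L lk e (Q , ss , eq , dq , ds) =
  (suc d , v) ∷ Q , ss , cong (_ ∷_) eq , s≤s z≤n ∷ dq , ds
segment-cons (+ suc d , v) _ ((le , _) , lk) e ((suc k , l) ∷ Q , ss , refl , dq , ds) =
  ⊥-elim (ℤₚ.<⇒≱ (ℤ.+<+ (s≤s z≤n)) (ℤₚ.≤-trans le (ℤₚ.≤-trans (ℤₚ.≤-reflexive (suc-neg k)) (neg+≤0 k))))
segment-cons (+ suc d , v) _ lk e ((zero , l) ∷ Q , ss , refl , () ∷ _ , ds)
segment-cons (+ suc d , v) _ lk (+≤+ ()) ([] , [] , refl , dq , ds)
segment-cons (+ suc d , v) _ lk e ([] , (Ps , w , Qs) ∷ ss , refl , dq , (dp , dq′) ∷ ds) =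
  [] , (Ps ∷ʳ (suc d , - v) , w , Qs) ∷ ss ,
  sym (trans (cong (_ʳ++ rest) (Lₚ.map-++ posRow Ps _))
    (trans (Lₚ.++-ʳ++ (map posRow Ps)) (cong (λ u → (+ suc d , u) ∷ (map posRow Ps ʳ++ rest)) (ℤₚ.neg-involutive v)))) ,
  [] , (Allₚ.++⁺ dp (s≤s z≤n ∷ []) , dq′) ∷ ds
  where rest = (0ℤ , w) ∷ map negRow Qs ++ segFlat ss

flat-surjective : ∀ L → Linked (Drop Any◁) L → StartNonNeg L → EndNonPos L → ∃ λ zs → L ≡ flat zs
flat-surjective L lk st e with segment L lk e
... | (suc d , l) ∷ Q , ss , refl , dq , ds = ⊥-elim (ℤₚ.<⇒≱ ℤ.-<+ st)
... | (zero , l) ∷ Q , ss , refl , () ∷ _ , ds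
... | [] , ss , refl , _ , ds with zeros ss (segFlat-Linked⁻ _ ss lk) ds
  where
  zeros : ∀ ss → All (λ (Ps , v , Qs) → Chain (Down Any◁) (0 , - v) Ps × Chain (Down Any◁) (0 , v) Qs) ss →
    All DeepSeg ss → ∃ λ zs → ss ≡ map toSeg zs
  zeros [] [] [] = [] , refl
  zeros ((Ps , v , Qs) ∷ ss) ((p , q) ∷ h) ((dp , dq) ∷ ds)
    with zeros ss h ds | parse-deep 0 (- v) Ps p dp | parse-deep 0 v Qs q dq
  ... | zs , refl | P , refl | Q , refl = (P , v , Q) ∷ zs , refl
... | zs , refl = zs , refl

-- The word and the reading of a forest

==-true : ∀ {x y} → x ≡ y → (x ==ℤ y) ≡ true
==-true {x} {y} eq = dec-true (x ℤ.≟ y) eq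

==-false : ∀ {x y} → x ≢ y → (x ==ℤ y) ≡ false
==-false {x} {y} ne = dec-false (x ℤ.≟ y) ne

==-neg : ∀ x y → (- x ==ℤ - y) ≡ (x ==ℤ y)
==-neg x y with x ℤ.≟ y
... | yes refl = ==-true {x = - x} refl
... | no ne = ==-false (λ eq → ne (ℤₚ.neg-injective eq))

step⁺ step⁻ : ℕ → ℤ → List Step
step⁺ k x = if x ==ℤ (+ k) then N ∷ [] else if x ==ℤ (+ suc k) then E ∷ [] else []
step⁻ k x = if x ==ℤ - (+ k) then N ∷ [] else if x ==ℤ - (+ suc k) then E ∷ [] else []

step⁺-N : ∀ k → step⁺ k (+ k) ≡ N ∷ []
step⁺-N k rewrite ==-true {+ k} refl = refl

step⁺-E : ∀ k → step⁺ k (+ suc k) ≡ E ∷ []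
step⁺-E k rewrite ==-false {+ suc k} {+ k} (λ eq → ℕₚ.1+n≢n (ℤₚ.+-injective eq)) | ==-true {+ suc k} refl = refl

step⁺-null : ∀ k {x} → x ≢ + k → x ≢ + suc k → step⁺ k x ≡ []
step⁺-null k ne ne′ rewrite ==-false ne | ==-false ne′ = refl

step⁻-neg : ∀ k x → step⁻ k (- x) ≡ step⁺ k x
step⁻-neg k x rewrite ==-neg x (+ k) | ==-neg x (+ suc k) = refl

step⁺-neg : ∀ k x → step⁺ k (- x) ≡ step⁻ k x
step⁺-neg k x = trans (sym (step⁻-neg k (- x))) (cong (step⁻ k) (ℤₚ.neg-involutive x))

palindrome : ∀ (b c : Bool) → reverse (if b then N ∷ [] else if c then E ∷ [] else []) ≡ (if b then N ∷ [] else if c then E ∷ [] else [])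
palindrome true c = refl
palindrome false true = refl
palindrome false false = refl

S⁺-concatMap : ∀ k ms → S⁺→ k ms ≡ concatMap (step⁺ k) ms
S⁺-concatMap k [] = refl
S⁺-concatMap k (m ∷ ms) = cong (step⁺ k m ++_) (S⁺-concatMap k ms)

S⁻-concatMap : ∀ k ms → S⁻→ k ms ≡ concatMap (step⁻ k) ms
S⁻-concatMap k [] = refl
S⁻-concatMap k (m ∷ ms) = cong (step⁻ k m ++_) (S⁻-concatMap k ms)

concatMap-∷ʳ : {A B : Set} (f : A → List B) → ∀ xs x → concatMap f (xs ∷ʳ x) ≡ concatMap f xs ++ f x
concatMap-∷ʳ f xs x = trans (Lₚ.concatMap-++ f xs (x ∷ [])) (cong (concatMap f xs ++_) (Lₚ.++-identityʳ (f x)))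

concatMap-reverse : {A B : Set} (f : A → List B) → (∀ x → reverse (f x) ≡ f x) →
  ∀ xs → reverse (concatMap f xs) ≡ concatMap f (reverse xs)
concatMap-reverse f h [] = refl
concatMap-reverse f h (x ∷ xs) = begin
  reverse (f x ++ concatMap f xs)
    ≡⟨ Lₚ.reverse-++ (f x) (concatMap f xs) ⟩
  reverse (concatMap f xs) ++ reverse (f x)
    ≡⟨ cong₂ _++_ (concatMap-reverse f h xs) (h x) ⟩
  concatMap f (reverse xs) ++ f x
    ≡⟨ concatMap-∷ʳ f (reverse xs) x ⟨
  concatMap f (reverse xs ∷ʳ x)
    ≡⟨ cong (concatMap f) (Lₚ.unfold-reverse x xs) ⟨
  concatMap f (reverse (x ∷ xs)) ∎
  where open ≡-Reasoning

block : ℕ → List ℤ → List Step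
block k ms = concatMap (step⁺ k) (reverse ms) ++ concatMap (step⁻ k) ms

zetaFull : ℕ → List ℤ → List Step
zetaFull K ms = concat (map (λ k → S⁻← k ms ++ S⁺→ k ms) (downFrom K))

reverse-block : ∀ k ms → reverse (S⁻← k ms ++ S⁺→ k ms) ≡ block k ms
reverse-block k ms = begin
  reverse (S⁻→ k (reverse ms) ++ S⁺→ k ms)
    ≡⟨ Lₚ.reverse-++ (S⁻→ k (reverse ms)) (S⁺→ k ms) ⟩
  reverse (S⁺→ k ms) ++ reverse (S⁻→ k (reverse ms))
    ≡⟨ cong₂ _++_ (cong reverse (S⁺-concatMap k ms)) (cong reverse (S⁻-concatMap k (reverse ms))) ⟩
  reverse (concatMap (step⁺ k) ms) ++ reverse (concatMap (step⁻ k) (reverse ms))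
    ≡⟨ cong₂ _++_ (concatMap-reverse (step⁺ k) (λ x → palindrome (x ==ℤ + k) (x ==ℤ + suc k)) ms)
                  (concatMap-reverse (step⁻ k) (λ x → palindrome (x ==ℤ - + k) (x ==ℤ - + suc k)) (reverse ms)) ⟩
  concatMap (step⁺ k) (reverse ms) ++ concatMap (step⁻ k) (reverse (reverse ms))
    ≡⟨ cong (λ xs → concatMap (step⁺ k) (reverse ms) ++ concatMap (step⁻ k) xs) (Lₚ.reverse-involutive ms) ⟩
  block k ms ∎
  where open ≡-Reasoning

concat-∷ʳ : {A : Set} (xss : List (List A)) (xs : List A) → concat (xss ∷ʳ xs) ≡ concat xss ++ xs
concat-∷ʳ xss xs = trans (sym (Lₚ.concat-++ xss (xs ∷ []))) (cong (concat xss ++_) (Lₚ.++-identityʳ xs))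

reverse-zetaFull : ∀ K ms → reverse (zetaFull K ms) ≡ concat (applyUpTo (λ k → block k ms) K)
reverse-zetaFull zero ms = refl
reverse-zetaFull (suc K) ms = begin
  reverse ((S⁻← K ms ++ S⁺→ K ms) ++ zetaFull K ms)
    ≡⟨ Lₚ.reverse-++ (S⁻← K ms ++ S⁺→ K ms) (zetaFull K ms) ⟩
  reverse (zetaFull K ms) ++ reverse (S⁻← K ms ++ S⁺→ K ms)
    ≡⟨ cong₂ _++_ (reverse-zetaFull K ms) (reverse-block K ms) ⟩
  concat (applyUpTo (λ k → block k ms) K) ++ block K ms
    ≡⟨ concat-∷ʳ (applyUpTo (λ k → block k ms) K) (block K ms) ⟨
  concat (applyUpTo (λ k → block k ms) K ∷ʳ block K ms)
    ≡⟨ cong concat (Lₚ.applyUpTo-∷ʳ (λ k → block k ms) K) ⟩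
  concat (applyUpTo (λ k → block k ms) (suc K)) ∎
  where open ≡-Reasoning

levels-applyUpTo : {A : Set} (f : List Tree → List A) → ∀ K F → levels K f F ≡ concat (applyUpTo (λ k → f (kids^ k F)) K)
levels-applyUpTo f zero F = refl
levels-applyUpTo f (suc K) F = cong (f F ++_) (levels-applyUpTo f K (kids F))

concat-applyUpTo-cong : {A : Set} {f g : ℕ → List A} → (∀ k → f k ≡ g k) → ∀ K → concat (applyUpTo f K) ≡ concat (applyUpTo g K)
concat-applyUpTo-cong h zero = refl
concat-applyUpTo-cong h (suc K) = cong₂ _++_ (h 0) (concat-applyUpTo-cong (h ∘ suc) K)

-- The word treats equal levels of positive and negative entries together, while the reading
-- combines level `i` of the negative entries with level `i + 1` of the positive ones. This
-- regrouping by half a period mediates between them and also moves contributions across a block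
-- boundary.
concat-shift : {A : Set} (a b : ℕ → List A) → ∀ K →
  concat (applyUpTo (λ i → a i ++ b i) K) ++ a K ≡ a 0 ++ concat (applyUpTo (λ i → b i ++ a (suc i)) K)
concat-shift a b zero = sym (Lₚ.++-identityʳ (a 0))
concat-shift a b (suc K) = begin
  ((a 0 ++ b 0) ++ rest) ++ a (suc K)    ≡⟨ Lₚ.++-assoc (a 0 ++ b 0) rest (a (suc K)) ⟩
  (a 0 ++ b 0) ++ rest ++ a (suc K)      ≡⟨ cong ((a 0 ++ b 0) ++_) (concat-shift (a ∘ suc) (b ∘ suc) K) ⟩
  (a 0 ++ b 0) ++ a 1 ++ rest′           ≡⟨ Lₚ.++-assoc (a 0) (b 0) _ ⟩
  a 0 ++ b 0 ++ a 1 ++ rest′             ≡⟨ cong (a 0 ++_) (sym (Lₚ.++-assoc (b 0) (a 1) rest′)) ⟩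
  a 0 ++ (b 0 ++ a 1) ++ rest′           ∎
  where
  open ≡-Reasoning
  rest = concat (applyUpTo (λ i → a (suc i) ++ b (suc i)) K)
  rest′ = concat (applyUpTo (λ i → b (suc i) ++ a (suc (suc i))) K)

module _ {B : Set} (φ : Row → List B) where

  concatMap-ʳ++-null : ∀ Ds (f : ℕ × ℤ → Row) {W} → All (λ x → φ (f x) ≡ []) Ds →
    concatMap φ (map f Ds ʳ++ W) ≡ concatMap φ W
  concatMap-ʳ++-null [] f [] = refl
  concatMap-ʳ++-null (x ∷ Ds) f {W} (h ∷ hs) =
    trans (concatMap-ʳ++-null Ds f hs) (cong (_++ concatMap φ W) h)

  -- Read from right to left, the vector shows each zero before its positive entries and the last
  -- zero first, which is the depth-first order of `posTrees`.
  positivePart : (∀ d l → φ (negRow (suc d , l)) ≡ []) → ∀ zs →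
    concatMap φ (reverse (flat zs)) ≡ concatMap (φ ∘ posRow) (dfs 0 (posTrees zs))
  positivePart h [] = refl
  positivePart h ((P , v , Q) ∷ zs) = begin
    concatMap φ (reverse (map posRow (dfs 1 P) ʳ++ rest))
      ≡⟨ cong (concatMap φ) (trans (Lₚ.ʳ++-ʳ++ (map posRow (dfs 1 P))) (cong (rest ʳ++_) (Lₚ.++-identityʳ _))) ⟩
    concatMap φ ((map negRow (dfs 1 Q) ++ flat zs) ʳ++ ((0ℤ , v) ∷ map posRow (dfs 1 P)))
      ≡⟨ cong (concatMap φ) (Lₚ.++-ʳ++ (map negRow (dfs 1 Q))) ⟩
    concatMap φ (flat zs ʳ++ tail)
      ≡⟨ cong (concatMap φ) (Lₚ.ʳ++-defn (flat zs)) ⟩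
    concatMap φ (reverse (flat zs) ++ tail)
      ≡⟨ Lₚ.concatMap-++ φ (reverse (flat zs)) tail ⟩
    concatMap φ (reverse (flat zs)) ++ concatMap φ tail
      ≡⟨ cong₂ _++_ (positivePart h zs) (concatMap-ʳ++-null (dfs 1 Q) negRow negs) ⟩
    concatMap (φ ∘ posRow) (dfs 0 (posTrees zs)) ++ φ (0ℤ , v) ++ concatMap φ (map posRow (dfs 1 P))
      ≡⟨ cong₂ (λ u w → concatMap (φ ∘ posRow) (dfs 0 (posTrees zs)) ++ φ (0ℤ , u) ++ w)
               (sym (ℤₚ.neg-involutive v)) (Lₚ.concatMap-map φ posRow (dfs 1 P)) ⟩
    concatMap (φ ∘ posRow) (dfs 0 (posTrees zs)) ++ concatMap (φ ∘ posRow) ((0 , - v) ∷ dfs 1 P)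
      ≡⟨ Lₚ.concatMap-++ (φ ∘ posRow) (dfs 0 (posTrees zs)) ((0 , - v) ∷ dfs 1 P) ⟨
    concatMap (φ ∘ posRow) (dfs 0 (posTrees zs) ++ (0 , - v) ∷ dfs 1 P)
      ≡⟨ cong (λ xs → concatMap (φ ∘ posRow) (dfs 0 (posTrees zs) ++ (0 , - v) ∷ xs)) (Lₚ.++-identityʳ (dfs 1 P)) ⟨
    concatMap (φ ∘ posRow) (dfs 0 (posTrees zs) ++ dfs 0 (node (- v) P ∷ []))
      ≡⟨ cong (concatMap (φ ∘ posRow)) (dfs-++ 0 (posTrees zs) _) ⟨
    concatMap (φ ∘ posRow) (dfs 0 (posTrees zs ∷ʳ node (- v) P)) ∎
    where
    open ≡-Reasoning
    rest = (0ℤ , v) ∷ map negRow (dfs 1 Q) ++ flat zs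
    tail = map negRow (dfs 1 Q) ʳ++ ((0ℤ , v) ∷ map posRow (dfs 1 P))
    negs : All (λ x → φ (negRow x) ≡ []) (dfs 1 Q)
    negs = All.map (λ { {suc d , l} (s≤s _) → h d l }) (dfs-deep 1 Q)

  negativePart : (∀ d l → φ (posRow (suc d , l)) ≡ []) → ∀ zs →
    concatMap φ (flat zs) ≡ concatMap (φ ∘ negRow) (dfs 0 (negTrees zs))
  negativePart h [] = refl
  negativePart h ((P , v , Q) ∷ zs) = begin
    concatMap φ (map posRow (dfs 1 P) ʳ++ ((0ℤ , v) ∷ map negRow (dfs 1 Q) ++ flat zs))
      ≡⟨ concatMap-ʳ++-null (dfs 1 P) posRow (All.map (λ { {suc d , l} (s≤s _) → h d l }) (dfs-deep 1 P)) ⟩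
    φ (0ℤ , v) ++ concatMap φ (map negRow (dfs 1 Q) ++ flat zs)
      ≡⟨ cong (φ (0ℤ , v) ++_) (Lₚ.concatMap-++ φ (map negRow (dfs 1 Q)) (flat zs)) ⟩
    φ (0ℤ , v) ++ concatMap φ (map negRow (dfs 1 Q)) ++ concatMap φ (flat zs)
      ≡⟨ cong (φ (0ℤ , v) ++_) (cong₂ _++_ (Lₚ.concatMap-map φ negRow (dfs 1 Q)) (negativePart h zs)) ⟩
    φ (0ℤ , v) ++ concatMap (φ ∘ negRow) (dfs 1 Q) ++ concatMap (φ ∘ negRow) (dfs 0 (negTrees zs))
      ≡⟨ cong (φ (0ℤ , v) ++_) (Lₚ.concatMap-++ (φ ∘ negRow) (dfs 1 Q) (dfs 0 (negTrees zs))) ⟨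
    concatMap (φ ∘ negRow) (dfs 0 (node v Q ∷ negTrees zs)) ∎
    where open ≡-Reasoning

module _ (k : ℕ) where
  private
    degrees-lemma : (φ : ℕ × ℤ → List Step) → (∀ d l → φ (d , l) ≡ step⁺ k (+ d)) → ∀ F →
      concatMap φ (dfs 0 F) ≡ degrees (kids^ k F)
    degrees-lemma φ h F =
      trans (concatMap-dfs-kids^ φ k 0 F
              (λ e l lt → trans (h e l) (step⁺-null k (λ eq → ℕₚ.<⇒≢ lt (ℤₚ.+-injective eq)) (λ eq → ℕₚ.<⇒≢ (ℕₚ.m<n⇒m<1+n lt) (ℤₚ.+-injective eq)))))
            (concatMap-dfs-degrees φ k (kids^ k F) (λ l → trans (h k l) (step⁺-N k)) (λ l → trans (h (suc k) l) (step⁺-E k))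
              (λ i l lt → trans (h i l) (step⁺-null k (λ eq → ℕₚ.<⇒≢ (ℕₚ.<⇒≤ lt) (sym (ℤₚ.+-injective eq))) (λ eq → ℕₚ.<⇒≢ lt (sym (ℤₚ.+-injective eq))))))

  block-flat : ∀ zs → block k (map proj₁ (flat zs)) ≡ degrees (kids^ k (trees zs))
  block-flat zs = begin
    concatMap (step⁺ k) (reverse (map proj₁ (flat zs))) ++ concatMap (step⁻ k) (map proj₁ (flat zs))
      ≡⟨ cong₂ _++_ (trans (cong (concatMap (step⁺ k)) (sym (Lₚ.reverse-map proj₁ (flat zs)))) (Lₚ.concatMap-map (step⁺ k) proj₁ (reverse (flat zs))))
                    (Lₚ.concatMap-map (step⁻ k) proj₁ (flat zs)) ⟩
    concatMap (step⁺ k ∘ proj₁) (reverse (flat zs)) ++ concatMap (step⁻ k ∘ proj₁) (flat zs)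
      ≡⟨ cong₂ _++_ (positivePart (step⁺ k ∘ proj₁) (λ d l → step⁺-null k { -[1+ d ]} (λ ()) (λ ())) zs)
                    (negativePart (step⁻ k ∘ proj₁) (λ d l → trans (sym (step⁺-neg k (+ suc d))) (step⁺-null k { -[1+ d ]} (λ ()) (λ ()))) zs) ⟩
    concatMap (step⁺ k ∘ proj₁ ∘ posRow) (dfs 0 (posTrees zs)) ++ concatMap (step⁻ k ∘ proj₁ ∘ negRow) (dfs 0 (negTrees zs))
      ≡⟨ cong₂ _++_ (degrees-lemma _ (λ d l → refl) (posTrees zs)) (degrees-lemma _ (λ d l → step⁻-neg k (+ d)) (negTrees zs)) ⟩
    degrees (kids^ k (posTrees zs)) ++ degrees (kids^ k (negTrees zs))
      ≡⟨ degrees-++ (kids^ k (posTrees zs)) (kids^ k (negTrees zs)) ⟨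
    degrees (kids^ k (posTrees zs) ++ kids^ k (negTrees zs))
      ≡⟨ cong degrees (kids^-++ k (posTrees zs) (negTrees zs)) ⟨
    degrees (kids^ k (trees zs)) ∎
    where open ≡-Reasoning

sel⁻ sel⁺ : ℕ → Row → List ℤ
sel⁻ i (m , v) = if m ==ℤ - (+ i) then v ∷ [] else []
sel⁺ i (m , v) = if m ==ℤ + suc i then (- v) ∷ [] else []

reading : ℕ → List Row → List ℤ
reading K L = concat (applyUpTo (λ i → concatMap (sel⁻ i) L ++ concatMap (sel⁺ i) (reverse L)) K)

roots-lemma : ∀ k (φ : ℕ × ℤ → List ℤ) → (∀ l → φ (k , l) ≡ l ∷ []) → (∀ d l → d ≢ k → φ (d , l) ≡ []) →
  ∀ F → concatMap φ (dfs 0 F) ≡ map root (kids^ k F)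
roots-lemma k φ h h′ F = begin
  concatMap φ (dfs 0 F)
    ≡⟨ concatMap-dfs-kids^ φ k 0 F (λ e l lt → h′ e l (ℕₚ.<⇒≢ lt)) ⟩
  concatMap φ (dfs k (kids^ k F))
    ≡⟨ concatMap-dfs-roots φ k (kids^ k F) (λ t → root t ∷ []) h (λ _ _ → refl) (λ e l lt → h′ e l (ℕₚ.<⇒≢ lt ∘ sym)) ⟩
  concatMap (λ t → root t ∷ []) (kids^ k F)
    ≡⟨ singletons (kids^ k F) ⟩
  map root (kids^ k F) ∎
  where
  open ≡-Reasoning
  singletons : ∀ F → concatMap (λ t → root t ∷ []) F ≡ map root F
  singletons [] = refl
  singletons (t ∷ F) = cong (root t ∷_) (singletons F)

reading-flat : ∀ K zs →
  reading K (flat zs) ≡ concat (applyUpTo (λ i → map root (kids^ i (negTrees zs)) ++ map root (kids^ (suc i) (posTrees zs))) K)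
reading-flat K zs = concat-applyUpTo-cong (λ i → cong₂ _++_
  (trans (negativePart (sel⁻ i) (λ d l → neg-null d l i) zs) (roots-lemma i (sel⁻ i ∘ negRow) (neg-hit i) (neg-miss i) (negTrees zs)))
  (trans (positivePart (sel⁺ i) (λ { zero l → refl ; (suc d) l → refl }) zs)
         (roots-lemma (suc i) (sel⁺ i ∘ posRow) (pos-hit i) (pos-miss i) (posTrees zs)))) K
  where
  neg-null : ∀ d l i → sel⁻ i (posRow (suc d , l)) ≡ []
  neg-null d l i rewrite ==-false {+ suc d} { - (+ i)} (λ eq → ℤₚ.<⇒≢ (ℤₚ.≤-<-trans (neg+≤0 i) (ℤ.+<+ (s≤s z≤n))) (sym eq)) = refl
  neg-hit : ∀ i l → sel⁻ i (negRow (i , l)) ≡ l ∷ []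
  neg-hit i l rewrite ==-true { - (+ i)} refl = refl
  neg-miss : ∀ i d l → d ≢ i → sel⁻ i (negRow (d , l)) ≡ []
  neg-miss i d l ne rewrite ==-false { - (+ d)} { - (+ i)} (λ eq → ne (ℤₚ.+-injective (ℤₚ.neg-injective eq))) = refl
  pos-hit : ∀ i l → sel⁺ i (posRow (suc i , l)) ≡ l ∷ []
  pos-hit i l rewrite ==-true {+ suc i} refl = cong (_∷ []) (ℤₚ.neg-involutive l)
  pos-miss : ∀ i d l → d ≢ suc i → sel⁺ i (posRow (d , l)) ≡ []
  pos-miss i d l ne rewrite ==-false {+ d} {+ suc i} (λ eq → ne (ℤₚ.+-injective eq)) = refl

Bounded : ℕ → List ℤ → Set
Bounded K = All (λ m → ∣ m ∣ < K)

step⁺-bounded : ∀ {K m} → ∣ m ∣ < K → step⁺ K m ≡ []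
step⁺-bounded {K} {m} lt =
  step⁺-null K {m} (λ { refl → ℕₚ.<-irrefl refl lt }) (λ { refl → ℕₚ.<-asym lt (ℕₚ.n<1+n _) })

block-bounded : ∀ {K ms} → Bounded K ms → block K ms ≡ []
block-bounded {K} {ms} b = cong₂ _++_
  (concatMap-null (step⁺ K) (All-resp-↭ (↭-sym (↭-reverse ms)) (All.map (λ {m} → step⁺-bounded {K} {m}) b)))
  (concatMap-null (step⁻ K) (All.map (λ {m} lt → trans (sym (step⁺-neg K m)) (step⁺-bounded {K} { - m } (subst (_< K) (sym (ℤₚ.∣-i∣≡∣i∣ m)) lt))) b))

-- A vertex of depth `K` would write an N into block `K`, but that block is empty because all
-- entries are smaller in absolute value.
kids^-bounded : ∀ {K} zs → Bounded K (map proj₁ (flat zs)) → kids^ K (trees zs) ≡ []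
kids^-bounded {K} zs b = degrees-null (kids^ K (trees zs)) (trans (sym (block-flat K zs)) (block-bounded b))
  where
  degrees-null : ∀ F → degrees F ≡ [] → F ≡ []
  degrees-null [] _ = refl
  degrees-null (node _ _ ∷ _) ()

reversedZeta : ℕ → List ℤ → List Step
reversedZeta K ms = concat (applyUpTo (λ k → block k ms) K)

flat-Reads : ∀ {K} zs → Bounded K (map proj₁ (flat zs)) →
  Reads (reversedZeta K (map proj₁ (flat zs))) (map root (posTrees zs) ++ reading K (flat zs)) (trees zs) []
flat-Reads {K} zs b =
  subst₂ (λ ρ ls → Reads ρ ls (trees zs) [])
    (trans (levels-applyUpTo degrees K (trees zs)) (concat-applyUpTo-cong (λ k → sym (block-flat k zs)) K))
    labels (Reads-levels K (trees zs) empty)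
  where
  open ≡-Reasoning
  pos = λ k → map root (kids^ k (posTrees zs))
  neg = λ k → map root (kids^ k (negTrees zs))
  empty : kids^ K (trees zs) ≡ []
  empty = kids^-bounded zs b
  labels : levels K (map root) (trees zs) ≡ map root (posTrees zs) ++ reading K (flat zs)
  labels = begin
    levels K (map root) (trees zs)
      ≡⟨ levels-applyUpTo (map root) K (trees zs) ⟩
    concat (applyUpTo (λ k → map root (kids^ k (trees zs))) K)
      ≡⟨ concat-applyUpTo-cong (λ k → trans (cong (map root) (kids^-++ k (posTrees zs) (negTrees zs))) (Lₚ.map-++ root (kids^ k (posTrees zs)) _)) K ⟩
    concat (applyUpTo (λ k → pos k ++ neg k) K)
      -- Level `K` has no vertices, so the empty tail may be written as `pos K`, which is what
      -- `concat-shift` expects.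
      ≡⟨ Lₚ.++-identityʳ _ ⟨
    concat (applyUpTo (λ k → pos k ++ neg k) K) ++ []
      ≡⟨ cong (λ F → concat (applyUpTo (λ k → pos k ++ neg k) K) ++ map root F)
              (sym (Lₚ.++-conicalˡ (kids^ K (posTrees zs)) _ (trans (sym (kids^-++ K (posTrees zs) (negTrees zs))) empty))) ⟩
    concat (applyUpTo (λ k → pos k ++ neg k) K) ++ pos K
      ≡⟨ concat-shift pos neg K ⟩
    pos 0 ++ concat (applyUpTo (λ k → neg k ++ pos (suc k)) K)
      ≡⟨ cong (pos 0 ++_) (reading-flat K zs) ⟨
    pos 0 ++ reading K (flat zs) ∎

-- Normal forms against pairs of a word and a window

++-cancel-length : {A : Set} → ∀ (xs xs′ : List A) {ys ys′} → length xs ≡ length xs′ → xs ++ ys ≡ xs′ ++ ys′ → xs ≡ xs′ × ys ≡ ys′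
++-cancel-length [] [] _ eq = refl , eq
++-cancel-length (x ∷ xs) (x′ ∷ xs′) len eq with Lₚ.∷-injective eq
... | refl , eq′ with ++-cancel-length xs xs′ (ℕₚ.suc-injective len) eq′
... | refl , eq″ = refl , eq″

-- With `a` zeros, the first `a` entries of the window are their labels; negated and in reverse
-- order these are the labels of the positive roots, which the reading leaves out.
labelsOf : ℕ → List ℤ → List ℤ
labelsOf a w = reverse (map -_ (take a w)) ++ w

length-posTrees : ∀ zs → length (posTrees zs) ≡ length zs
length-posTrees [] = refl
length-posTrees ((P , v , Q) ∷ zs) =
  trans (Lₚ.length-++ (posTrees zs)) (trans (ℕₚ.+-comm _ 1) (cong suc (length-posTrees zs)))

length-negTrees : ∀ zs → length (negTrees zs) ≡ length zs
length-negTrees [] = refl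
length-negTrees (_ ∷ zs) = cong suc (length-negTrees zs)

roots-posTrees : ∀ zs → map root (posTrees zs) ≡ reverse (map -_ (map root (negTrees zs)))
roots-posTrees [] = refl
roots-posTrees ((P , v , Q) ∷ zs) = begin
  map root (posTrees zs ∷ʳ node (- v) P)                    ≡⟨ Lₚ.map-++ root (posTrees zs) _ ⟩
  map root (posTrees zs) ∷ʳ - v                             ≡⟨ cong (_∷ʳ - v) (roots-posTrees zs) ⟩
  reverse (map -_ (map root (negTrees zs))) ∷ʳ - v          ≡⟨ Lₚ.unfold-reverse (- v) (map -_ (map root (negTrees zs))) ⟨
  reverse (- v ∷ map -_ (map root (negTrees zs)))           ∎
  where open ≡-Reasoning

take-length-++ : {A : Set} → ∀ (xs : List A) {ys} → take (length xs) (xs ++ ys) ≡ xs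
take-length-++ [] = refl
take-length-++ (x ∷ xs) = cong (x ∷_) (take-length-++ xs)

flat-Reads-labelsOf : ∀ {K} zs → Bounded (suc K) (map proj₁ (flat zs)) →
  Reads (reversedZeta (suc K) (map proj₁ (flat zs))) (labelsOf (length zs) (reading (suc K) (flat zs))) (trees zs) []
flat-Reads-labelsOf {K} zs b =
  subst (λ ls → Reads (reversedZeta (suc K) (map proj₁ (flat zs))) ls (trees zs) []) (cong (_++ w) labels) (flat-Reads zs b)
  where
  w = reading (suc K) (flat zs)
  zero-labels : take (length zs) w ≡ map root (negTrees zs)
  zero-labels =
    trans (cong₂ take (sym (trans (Lₚ.length-map root (negTrees zs)) (length-negTrees zs)))
                      (trans (reading-flat (suc K) zs) (Lₚ.++-assoc (map root (negTrees zs)) _ _)))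
          (take-length-++ (map root (negTrees zs)))
  labels : map root (posTrees zs) ≡ reverse (map -_ (take (length zs) w))
  labels = trans (roots-posTrees zs) (cong (reverse ∘ map -_) (sym zero-labels))

trees-injective : ∀ zs zs′ → length zs ≡ length zs′ → trees zs ≡ trees zs′ → zs ≡ zs′
trees-injective zs zs′ len eq
  with ++-cancel-length (posTrees zs) (posTrees zs′) (trans (length-posTrees zs) (trans len (sym (length-posTrees zs′)))) eq
... | p , n = go zs zs′ p n
  where
  go : ∀ zs zs′ → posTrees zs ≡ posTrees zs′ → negTrees zs ≡ negTrees zs′ → zs ≡ zs′
  go [] [] _ _ = refl
  go ((P , v , Q) ∷ zs) ((P′ , v′ , Q′) ∷ zs′) p n with Lₚ.∷ʳ-injective (posTrees zs) (posTrees zs′) p | Lₚ.∷-injective n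
  ... | p′ , t | u , n′ with node-injective t | node-injective u
  ... | _ , refl | refl , refl = cong (_ ∷_) (go zs zs′ p′ n′)

NF : List Row → Set
NF L = Linked (Drop Any◁) L × StartNonNeg L × EndNonPos L

countN-flat : ∀ {K} zs → Bounded (suc K) (map proj₁ (flat zs)) →
  countN (reversedZeta (suc K) (map proj₁ (flat zs))) ≡ length zs ℕ.+ length (reading (suc K) (flat zs))
countN-flat {K} zs b =
  trans (Reads-countN (flat-Reads zs b)) (trans (Lₚ.length-++ (map root (posTrees zs)))
    (cong (ℕ._+ length (reading (suc K) (flat zs))) (trans (Lₚ.length-map root (posTrees zs)) (length-posTrees zs))))

-- The excess of N's over labels is the number of zeros. It yields the complete list of labels, and
-- the queue then rebuilds one and the same forest.
NF-injective : ∀ {K} L L′ → NF L → NF L′ → Bounded (suc K) (map proj₁ L) → Bounded (suc K) (map proj₁ L′) →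
  reversedZeta (suc K) (map proj₁ L) ≡ reversedZeta (suc K) (map proj₁ L′) →
  reading (suc K) L ≡ reading (suc K) L′ → L ≡ L′
NF-injective {K} L L′ (lk , st , e) (lk′ , st′ , e′) b b′ eqρ eqw
  with flat-surjective L lk st e | flat-surjective L′ lk′ st′ e′
... | zs , refl | zs′ , refl = cong flat (trees-injective zs zs′ len
        (proj₁ (Reads-functional (flat-Reads-labelsOf zs b)
          (subst₂ (λ ρ ls → Reads ρ ls (trees zs′) []) (sym eqρ) (cong₂ labelsOf (sym len) (sym eqw)) (flat-Reads-labelsOf zs′ b′)))))
  where
  len : length zs ≡ length zs′
  len = ℕₚ.+-cancelʳ-≡ (length (reading (suc K) (flat zs))) (length zs) (length zs′)
    (trans (sym (countN-flat zs b)) (trans (cong countN eqρ) (trans (countN-flat zs′ b′) (cong (λ w → length zs′ ℕ.+ length w) (sym eqw)))))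

makeZeros : ∀ R G → map root R ≡ map -_ (map root G) → ∃ λ zs → trees zs ≡ reverse R ++ G × length zs ≡ length R
makeZeros R G eq with go R G eq
  where
  go : ∀ R G → map root R ≡ map -_ (map root G) → ∃ λ zs → posTrees zs ≡ reverse R × negTrees zs ≡ G × length zs ≡ length R
  go [] [] _ = [] , refl , refl , refl
  go (node l P ∷ R) (node v Q ∷ G) eq with Lₚ.∷-injective eq
  ... | refl , eq′ with go R G eq′
  ... | zs , p , n , len = (P , v , Q) ∷ zs ,
    trans (cong (_∷ʳ node (- v) P) p) (sym (Lₚ.unfold-reverse (node (- v) P) R)) , cong (node v Q ∷_) n , cong suc len
... | zs , p , n , len = zs , cong₂ _++_ p n , len

map-++-split : ∀ (Q : List Tree) as {bs} → map root Q ≡ as ++ bs →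
  ∃₂ λ Q₁ Q₂ → Q ≡ Q₁ ++ Q₂ × map root Q₁ ≡ as × map root Q₂ ≡ bs
map-++-split Q [] eq = [] , Q , refl , refl , eq
map-++-split (t ∷ Q) (a ∷ as) eq with Lₚ.∷-injective eq
... | e , eq′ with map-++-split Q as eq′
... | Q₁ , Q₂ , refl , e₁ , e₂ = t ∷ Q₁ , Q₂ , refl , cong₂ _∷_ e e₁ , e₂

NF-flat : ∀ zs → NF (flat zs)
NF-flat zs = flat-Linked⁺ (λ _ → tt) zs (OK-Any (trees zs)) , segFlat-start (map toSeg zs) , segFlat-end (map toSeg zs)

Reads-closed : ∀ {ρ ls Q C} → Reads (N ∷ ρ) ls Q C → C ≡ []
Reads-closed (north _) = refl

-- The word has twice as many letters as there are labels, so the N's exceed `n` by the same `a` by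
-- which the E's fall short of it. The queue ends with `2 a` trees, whose roots carry the first
-- `2 a` labels: the first `a` entries of `w` negated and reversed, then these entries themselves.
-- Matching the two halves gives the zeros.
NF-surjective : ∀ ρ w → All Plain ρ → Ballot (N ∷ ρ) → countN (N ∷ ρ) ℕ.+ countE ρ ≡ length w ℕ.+ length w →
  ∃ λ L → NF L × (∀ {K} → Bounded (suc K) (map proj₁ L) →
    reversedZeta (suc K) (map proj₁ L) ≡ N ∷ ρ × reading (suc K) L ≡ w)
NF-surjective ρ w pl bal total = result
  where
  n = length w
  a = countN (N ∷ ρ) ℕ.∸ n
  e≤ : countE ρ ≤ n
  e≤ = ℕₚ.≮⇒≥ λ lt → ℕₚ.<-irrefl (sym total) (ℕₚ.+-mono-<-≤ (ℕₚ.<-≤-trans lt (proj₁ bal)) (ℕₚ.<⇒≤ lt))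
  n≤ : n ≤ countN (N ∷ ρ)
  n≤ = ℕₚ.≮⇒≥ λ lt → ℕₚ.<-irrefl total (ℕₚ.+-mono-<-≤ lt e≤)
  a+n : a ℕ.+ n ≡ countN (N ∷ ρ)
  a+n = ℕₚ.m∸n+n≡m n≤
  a+e : a ℕ.+ countE ρ ≡ n
  a+e = ℕₚ.+-cancelˡ-≡ n (a ℕ.+ countE ρ) n (trans (sym (ℕₚ.+-assoc n a _)) (trans (cong (ℕ._+ countE ρ) (trans (ℕₚ.+-comm n a) a+n)) total))
  a≤n : a ≤ n
  a≤n = ℕₚ.≤-trans (ℕₚ.m≤m+n a _) (ℕₚ.≤-reflexive a+e)
  length-take : length (take a w) ≡ a
  length-take = trans (Lₚ.length-take a w) (ℕₚ.m≤n⇒m⊓n≡m a≤n)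
  length-neg : length (reverse (map -_ (take a w))) ≡ a
  length-neg = trans (Lₚ.length-reverse (map -_ (take a w))) (trans (Lₚ.length-map -_ (take a w)) length-take)
  count : countN (N ∷ ρ) ≡ length (labelsOf a w)
  count = trans (sym a+n) (trans (cong (ℕ._+ n) (sym length-neg)) (sym (Lₚ.length-++ (reverse (map -_ (take a w))))))
  result : ∃ λ L → NF L × (∀ {K} → Bounded (suc K) (map proj₁ L) →
    reversedZeta (suc K) (map proj₁ L) ≡ N ∷ ρ × reading (suc K) L ≡ w)
  result with Reads-total (N ∷ ρ) (labelsOf a w) (inj₁ refl ∷ pl) bal count
  ... | Q , C , d with Reads-closed d
  ... | refl with Reads-fifo d
  ... | rest , eq , _ with ++-cancel-length (reverse (map -_ (take a w)) ++ take a w) (map root Q)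
        (trans (Lₚ.length-++ (reverse (map -_ (take a w)))) (trans (cong₂ ℕ._+_ length-neg length-take)
          (trans (ℕₚ.+-cancelʳ-≡ (countE ρ) (a ℕ.+ a) (length Q) (trans (ℕₚ.+-assoc a a _) (trans (cong (a ℕ.+_) a+e) (trans a+n (Reads-balance d)))))
            (sym (Lₚ.length-map root Q)))))
        (trans (Lₚ.++-assoc (reverse (map -_ (take a w))) (take a w) (drop a w)) (trans (cong (reverse (map -_ (take a w)) ++_) (Lₚ.take++drop≡id a w)) eq))
  ... | rootsQ , _ with map-++-split Q (reverse (map -_ (take a w))) (sym rootsQ)
  ... | Q₁ , Q₂ , refl , r₁ , r₂ with makeZeros (reverse Q₁) Q₂
        (trans (Lₚ.reverse-map root Q₁) (trans (cong reverse r₁) (trans (Lₚ.reverse-involutive _) (cong (map -_) (sym r₂)))))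
  ... | zs , eqT , len = flat zs , NF-flat zs , λ {K} b →
    let d′ = flat-Reads-labelsOf zs b
        eqs = Reads-cofunctional (subst (λ T → Reads _ _ T []) (trans eqT (cong (_++ Q₂) (Lₚ.reverse-involutive Q₁))) d′) d
        lenz = trans len (trans (Lₚ.length-reverse Q₁) (trans (sym (Lₚ.length-map root Q₁)) (trans (cong length r₁) length-neg)))
    in proj₁ eqs , drop-prefix (reading (suc K) (flat zs)) (length zs) lenz (proj₁ eqs) b (proj₂ eqs)
    where
    drop-prefix : ∀ u c → c ≡ a → ∀ {K} → reversedZeta (suc K) (map proj₁ (flat zs)) ≡ N ∷ ρ → Bounded (suc K) (map proj₁ (flat zs)) →
      labelsOf c u ≡ labelsOf a w → u ≡ w
    drop-prefix u .a refl _ _ eq′ = proj₂ (++-cancel-length (reverse (map -_ (take a u))) (reverse (map -_ (take a w))) same eq′)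
      where
      total-length : length (reverse (map -_ (take a u))) ℕ.+ length u ≡ a ℕ.+ n
      total-length = trans (sym (Lₚ.length-++ (reverse (map -_ (take a u))))) (trans (cong length eq′) (trans (sym count) (sym a+n)))
      pre : length (reverse (map -_ (take a u))) ≡ a ℕ.⊓ length u
      pre = trans (Lₚ.length-reverse (map -_ (take a u))) (trans (Lₚ.length-map -_ (take a u)) (Lₚ.length-take a u))
      -- If `u` had fewer than `a` entries, `take a u` would be too short as well and the two
      -- prefixes could not be compared; the total length excludes this.
      n≤u : n ≤ length u
      n≤u = ℕₚ.+-cancelˡ-≤ a n (length u) (ℕₚ.≤-trans (ℕₚ.≤-reflexive (sym total-length))
              (ℕₚ.+-monoˡ-≤ (length u) (ℕₚ.≤-trans (ℕₚ.≤-reflexive pre) (ℕₚ.m⊓n≤m a _))))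
      same : length (reverse (map -_ (take a u))) ≡ length (reverse (map -_ (take a w)))
      same = trans pre (trans (ℕₚ.m≤n⇒m⊓n≡m (ℕₚ.≤-trans a≤n n≤u)) (sym length-neg))

at-++-suc : ∀ xs {y ys} → at (xs ++ y ∷ ys) (suc (length xs)) ≡ y
at-++-suc [] = refl
at-++-suc (x ∷ xs) = at-++-suc xs

Agree-at : ∀ ls zs → Agree (at (reverse ls ++ zs)) ls
Agree-at [] zs = tt
Agree-at (l ∷ ls) zs =
  trans (cong (λ k → at (reverse (l ∷ ls) ++ zs) (suc k)) (sym (Lₚ.length-reverse ls)))
        (trans (cong (λ xs → at xs (suc (length (reverse ls)))) shift) (at-++-suc (reverse ls))) ,
  subst (λ xs → Agree (at xs) ls) (sym shift) (Agree-at ls (l ∷ zs))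
  where
  shift : reverse (l ∷ ls) ++ zs ≡ reverse ls ++ l ∷ zs
  shift = trans (cong (_++ zs) (Lₚ.unfold-reverse l ls)) (Lₚ.++-assoc (reverse ls) _ zs)

-- In path order the `j`-th N carries `w(n + 1 - j)` for `j` up to `n` and `- w(j - n)` afterwards.
-- These are the bounds in the definition of `Diag`, up to the sign at `w(1)`.
labelAt : ℕ → List ℤ → ℕ → ℤ
labelAt a w = at (reverse w ++ map -_ (take a w))

ValleyLess : ℕ → List ℤ → ℕ × ℕ → Set
ValleyLess a w (i , j) = labelAt a w j ℤ.< labelAt a w i

Agree-labelAt : ∀ a w → Agree (labelAt a w) (labelsOf a w)
Agree-labelAt a w = subst (λ xs → Agree (at xs) (labelsOf a w)) eq (Agree-at (labelsOf a w) [])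
  where
  eq : reverse (labelsOf a w) ++ [] ≡ reverse w ++ map -_ (take a w)
  eq = trans (Lₚ.++-identityʳ _) (trans (Lₚ.reverse-++ (reverse (map -_ (take a w))) w) (cong (reverse w ++_) (Lₚ.reverse-involutive _)))

NF-Val : ∀ {K} L → NF L → Bounded (suc K) (map proj₁ L) →
  let ρ = reversedZeta (suc K) (map proj₁ L); w = reading (suc K) L; V = Val (ValleyLess (countN ρ ℕ.∸ length w) w) ρ in
  (Linked (Drop ℤ._<_) L → V) × (V → Linked (Drop ℤ._<_) L)
NF-Val {K} L (lk , st , e) b with flat-surjective L lk st e
... | zs , refl =
  (λ tight → subst V (sym a≡) (OK⇒Val d (Agree-labelAt (length zs) w) (flat-Linked⁻ ℤₚ.neg-mono-< zs tight) tt)) ,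
  (λ v → flat-Linked⁺ ℤₚ.neg-mono-< zs (proj₁ (Val⇒OK d (Agree-labelAt (length zs) w) (subst V a≡ v))))
  where
  ρ = reversedZeta (suc K) (map proj₁ (flat zs))
  w = reading (suc K) (flat zs)
  V : ℕ → Set
  V a = Val (ValleyLess a w) ρ
  d = flat-Reads-labelsOf zs b
  a≡ : countN ρ ℕ.∸ length w ≡ length zs
  a≡ = trans (cong (ℕ._∸ length w) (countN-flat zs b)) (ℕₚ.m+n∸n≡m (length zs) (length w))

headEast : List Step → Bool
headEast [] = false
headEast (x ∷ _) = isEast x

nthN-skip : ∀ k xs → nthNFollowedByEast (suc k) (E ∷ xs) ≡ nthNFollowedByEast (suc k) xs
nthN-skip zero xs = refl
nthN-skip (suc k) xs = refl

nthN-++ : ∀ {xs ys} → All Plain xs → nthNFollowedByEast (suc (countN xs)) (xs ++ N ∷ ys) ≡ headEast ys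
nthN-++ {[]} {[]} [] = refl
nthN-++ {[]} {y ∷ ys} [] = refl
nthN-++ {N ∷ []} {ys} (_ ∷ pl) = nthN-++ {[]} {ys} pl
nthN-++ {N ∷ x ∷ xs} {ys} (_ ∷ pl) = nthN-++ {x ∷ xs} {ys} pl
nthN-++ {E ∷ xs} (_ ∷ pl) = trans (nthN-skip (countN xs) _) (nthN-++ pl)
nthN-++ {E⁺ ∷ xs} (inj₁ () ∷ pl)
nthN-++ {E⁺ ∷ xs} (inj₂ () ∷ pl)
nthN-++ {E⁻ ∷ xs} (inj₁ () ∷ pl)
nthN-++ {E⁻ ∷ xs} (inj₂ () ∷ pl)

headIsZero : List Row → Bool
headIsZero [] = true
headIsZero ((m , _) ∷ _) = m ==ℤ 0ℤ

countᵇ-++ : {A : Set} (p : A → Bool) → ∀ xs ys → countᵇ p (xs ++ ys) ≡ countᵇ p xs ℕ.+ countᵇ p ys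
countᵇ-++ p [] ys = refl
countᵇ-++ p (x ∷ xs) ys with p x
... | true = cong suc (countᵇ-++ p xs ys)
... | false = countᵇ-++ p xs ys

countᵇ-ʳ++ : {A : Set} (p : A → Bool) → ∀ xs ys → countᵇ p (xs ʳ++ ys) ≡ countᵇ p xs ℕ.+ countᵇ p ys
countᵇ-ʳ++ p [] ys = refl
countᵇ-ʳ++ p (x ∷ xs) ys with p x in eq
... | true = trans (countᵇ-ʳ++ p xs (x ∷ ys)) (trans (cong (countᵇ p xs ℕ.+_) step) (ℕₚ.+-suc (countᵇ p xs) _))
  where
  step : countᵇ p (x ∷ ys) ≡ suc (countᵇ p ys)
  step rewrite eq = refl
... | false = trans (countᵇ-ʳ++ p xs (x ∷ ys)) (cong (countᵇ p xs ℕ.+_) step)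
  where
  step : countᵇ p (x ∷ ys) ≡ countᵇ p ys
  step rewrite eq = refl

countᵇ-reverse : {A : Set} (p : A → Bool) → ∀ xs → countᵇ p (reverse xs) ≡ countᵇ p xs
countᵇ-reverse p xs = trans (countᵇ-ʳ++ p xs []) (ℕₚ.+-identityʳ _)

dropLast-∷ʳ : {A : Set} → ∀ (xs : List A) x → dropLast (xs ∷ʳ x) ≡ xs
dropLast-∷ʳ [] x = refl
dropLast-∷ʳ (y ∷ []) x = refl
dropLast-∷ʳ (y ∷ z ∷ xs) x = cong (y ∷_) (dropLast-∷ʳ (z ∷ xs) x)

dropLast-++ : {A : Set} → ∀ (xs : List A) {y ys} → dropLast (xs ++ y ∷ ys) ≡ xs ++ dropLast (y ∷ ys)
dropLast-++ [] = refl
dropLast-++ (x ∷ []) = refl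
dropLast-++ (x ∷ z ∷ xs) = cong (x ∷_) (dropLast-++ (z ∷ xs))

countN-degrees : ∀ F → countN (degrees F) ≡ length F
countN-degrees [] = refl
countN-degrees (node l C ∷ F) = cong suc (trans (countᵇ-++ isN (map (λ _ → E) C) (degrees F)) (cong₂ ℕ._+_ (noN C) (countN-degrees F)))
  where
  noN : ∀ (C : List Tree) → countN (map (λ _ → E) C) ≡ 0
  noN [] = refl
  noN (_ ∷ C) = noN C

All-reverse : {A : Set} {P : A → Set} {xs : List A} → All P xs → All P (reverse xs)
All-reverse {xs = xs} = All-resp-↭ (↭-sym (↭-reverse xs))

-- All that matters is whether some positive entry precedes the zero; the tail `(0ℤ , 0ℤ) ∷ []` is a
-- stand-in for the rest of the vector.
headEast-posTree : ∀ (P : List Tree) X → headEast (dropLast (reverse (N ∷ map (λ _ → E) P) ++ X)) ≡ not (headIsZero (map posRow (dfs 1 P) ʳ++ ((0ℤ , 0ℤ) ∷ [])))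
headEast-posTree [] [] = refl
headEast-posTree [] (x ∷ X) = refl
headEast-posTree (t ∷ P) X =
  trans (trans (cong (λ xs → headEast (dropLast (xs ++ X))) (Lₚ.unfold-reverse N (map {A = Tree} (λ _ → E) (t ∷ P)))) (startsEast _ (revEast t P)))
        (cong not (sym (nonzero (dfs 1 (t ∷ P)) (dfs≢[] t) (dfs-deep 1 (t ∷ P)))))
  where
  dfs≢[] : ∀ t → dfs 1 (t ∷ P) ≢ []
  dfs≢[] (node _ _) ()
  revEast : ∀ t P → ∃ λ ys → reverse (map {A = Tree} (λ _ → E) (t ∷ P)) ≡ E ∷ ys
  revEast t P with reverse (t ∷ P) in eq
  ... | [] = ⊥-elim (ℕₚ.0≢1+n (trans (cong length (sym eq)) (Lₚ.length-reverse (t ∷ P))))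
  ... | _ ∷ R = map (λ _ → E) R , trans (sym (Lₚ.reverse-map (λ _ → E) (t ∷ P))) (cong (map (λ _ → E)) eq)
  startsEast : ∀ xs → (∃ λ ys → xs ≡ E ∷ ys) → headEast (dropLast ((xs ∷ʳ N) ++ X)) ≡ true
  startsEast _ ([] , refl) = refl
  startsEast _ (y ∷ ys , refl) = refl
  nonzero : ∀ Ds {r} → Ds ≢ [] → All (λ x → 1 ≤ proj₁ x) Ds → headIsZero (map posRow Ds ʳ++ r) ≡ false
  nonzero [] ne _ = ⊥-elim (ne refl)
  nonzero ((suc d , l) ∷ []) ne _ = refl
  nonzero (x ∷ y ∷ Ds) ne (_ ∷ p) = nonzero (y ∷ Ds) (λ ()) p

headIsZero-ʳ++ : ∀ Ds {v r} → headIsZero (map posRow Ds ʳ++ ((0ℤ , 0ℤ) ∷ [])) ≡ headIsZero (map posRow Ds ʳ++ ((0ℤ , v) ∷ r))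
headIsZero-ʳ++ [] = refl
headIsZero-ʳ++ (x ∷ Ds) = go x Ds
  where
  go : ∀ x Ds {r r′} → headIsZero (map posRow Ds ʳ++ (posRow x ∷ r)) ≡ headIsZero (map posRow Ds ʳ++ (posRow x ∷ r′))
  go x [] = refl
  go x (y ∷ Ds) = go y Ds

-- The `n`-th N of the path creates the negative root of the first zero. After it come the E's for
-- the children of the positive root of the same zero, and such children exist exactly if the vector
-- does not begin with this zero.
NF-nthN : ∀ {K} L → L ≢ [] → NF L → Bounded (suc K) (map proj₁ L) →
  nthNFollowedByEast (length (reading (suc K) L)) (dropLast (reverse (reversedZeta (suc K) (map proj₁ L))))
    ≡ not (headIsZero L)
NF-nthN {K} L ne (lk , st , e) b with flat-surjective L lk st e
... | [] , refl = ⊥-elim (ne refl)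
... | (P , v , Q) ∷ zs , refl = begin
  nthNFollowedByEast n (dropLast (reverse ρ))
    ≡⟨ cong (nthNFollowedByEast n ∘ dropLast) reverseρ ⟩
  nthNFollowedByEast n (dropLast (reverse Y ++ N ∷ T))
    ≡⟨ cong (nthNFollowedByEast n) (dropLast-++ (reverse Y)) ⟩
  nthNFollowedByEast n (reverse Y ++ dropLast (N ∷ T))
    ≡⟨ cong (λ ys → nthNFollowedByEast n (reverse Y ++ ys)) (dropLast-T T T≢[]) ⟩
  nthNFollowedByEast n (reverse Y ++ N ∷ dropLast T)
    ≡⟨ cong (λ k → nthNFollowedByEast k (reverse Y ++ N ∷ dropLast T)) (trans count (cong suc (sym (countᵇ-reverse isN Y)))) ⟩
  nthNFollowedByEast (suc (countN (reverse Y))) (reverse Y ++ N ∷ dropLast T)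
    ≡⟨ nthN-++ {reverse Y} (All-reverse plainY) ⟩
  headEast (dropLast T)
    ≡⟨ headEast-posTree P (reverse X) ⟩
  not (headIsZero (map posRow (dfs 1 P) ʳ++ ((0ℤ , 0ℤ) ∷ [])))
    ≡⟨ cong not (headIsZero-ʳ++ (dfs 1 P)) ⟩
  not (headIsZero (flat zs₀)) ∎
  where
  open ≡-Reasoning
  zs₀ = (P , v , Q) ∷ zs
  ρ = reversedZeta (suc K) (map proj₁ (flat zs₀))
  n = length (reading (suc K) (flat zs₀))
  X = degrees (posTrees zs)
  EP = map (λ _ → E) P
  T = reverse (N ∷ EP) ++ reverse X
  rest = concat (applyUpTo (λ k → block (suc k) (map proj₁ (flat zs₀))) K)
  Y = (map (λ _ → E) Q ++ degrees (negTrees zs)) ++ rest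
  splitρ : ρ ≡ (X ++ (N ∷ EP)) ++ N ∷ Y
  splitρ = begin
    block 0 (map proj₁ (flat zs₀)) ++ rest
      ≡⟨ cong (_++ rest) (trans (block-flat 0 zs₀) (degrees-++ (posTrees zs₀) (negTrees zs₀))) ⟩
    (degrees (posTrees zs ∷ʳ node (- v) P) ++ degrees (negTrees zs₀)) ++ rest
      ≡⟨ cong (λ xs → (xs ++ degrees (negTrees zs₀)) ++ rest) (trans (degrees-++ (posTrees zs) _) (cong (λ xs → X ++ N ∷ xs) (Lₚ.++-identityʳ EP))) ⟩
    ((X ++ (N ∷ EP)) ++ degrees (negTrees zs₀)) ++ rest
      ≡⟨ Lₚ.++-assoc (X ++ (N ∷ EP)) _ rest ⟩
    (X ++ (N ∷ EP)) ++ N ∷ Y ∎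
  reverseρ : reverse ρ ≡ reverse Y ++ N ∷ T
  reverseρ = begin
    reverse ρ                                              ≡⟨ cong reverse splitρ ⟩
    reverse ((X ++ (N ∷ EP)) ++ N ∷ Y)                     ≡⟨ Lₚ.reverse-++ (X ++ (N ∷ EP)) (N ∷ Y) ⟩
    reverse (N ∷ Y) ++ reverse (X ++ (N ∷ EP))             ≡⟨ cong₂ _++_ (Lₚ.unfold-reverse N Y) (Lₚ.reverse-++ X (N ∷ EP)) ⟩
    (reverse Y ∷ʳ N) ++ T                                  ≡⟨ Lₚ.++-assoc (reverse Y) _ T ⟩
    reverse Y ++ N ∷ T                                     ∎
  T≢[] : T ≢ []
  T≢[] eq = ℕₚ.1+n≢0 (trans (sym (Lₚ.length-reverse (N ∷ EP))) (cong length (Lₚ.++-conicalˡ (reverse (N ∷ EP)) _ eq)))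
  dropLast-T : ∀ T → T ≢ [] → dropLast (N ∷ T) ≡ N ∷ dropLast T
  dropLast-T [] ne = ⊥-elim (ne refl)
  dropLast-T (_ ∷ _) _ = refl
  plainY : All Plain Y
  plainY with Allₚ.++⁻ʳ (X ++ (N ∷ EP)) (subst (All Plain) splitρ (Reads-plain (flat-Reads zs₀ b)))
  ... | _ ∷ p = p
  count : n ≡ suc (countN Y)
  count = ℕₚ.+-cancelˡ-≡ (length zs₀) n (suc (countN Y)) (begin
    length zs₀ ℕ.+ n                     ≡⟨ countN-flat zs₀ b ⟨
    countN ρ                             ≡⟨ cong countN splitρ ⟩
    countN ((X ++ (N ∷ EP)) ++ N ∷ Y)    ≡⟨ countᵇ-++ isN (X ++ (N ∷ EP)) (N ∷ Y) ⟩
    countN (X ++ (N ∷ EP)) ℕ.+ suc (countN Y)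
      ≡⟨ cong (λ xs → countN xs ℕ.+ suc (countN Y)) (sym (trans (degrees-++ (posTrees zs) _) (cong (λ xs → X ++ N ∷ xs) (Lₚ.++-identityʳ EP)))) ⟩
    countN (degrees (posTrees zs₀)) ℕ.+ suc (countN Y)
      ≡⟨ cong (ℕ._+ suc (countN Y)) (trans (countN-degrees (posTrees zs₀)) (length-posTrees zs₀)) ⟩
    length zs₀ ℕ.+ suc (countN Y) ∎)

-- Valleys, ballot conditions and signs of ballot paths

unsign : Step → Step
unsign N = N
unsign E = E
unsign E⁺ = E
unsign E⁻ = E

unsign-plain : ∀ xs → All Plain (map unsign xs)
unsign-plain [] = []
unsign-plain (N ∷ xs) = inj₁ refl ∷ unsign-plain xs
unsign-plain (E ∷ xs) = inj₂ refl ∷ unsign-plain xs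
unsign-plain (E⁺ ∷ xs) = inj₂ refl ∷ unsign-plain xs
unsign-plain (E⁻ ∷ xs) = inj₂ refl ∷ unsign-plain xs

plain-unsign : ∀ {xs} → All Plain xs → map unsign xs ≡ xs
plain-unsign [] = refl
plain-unsign (inj₁ refl ∷ pl) = cong (N ∷_) (plain-unsign pl)
plain-unsign (inj₂ refl ∷ pl) = cong (E ∷_) (plain-unsign pl)

countN-unsign : ∀ xs → countN (map unsign xs) ≡ countN xs
countN-unsign [] = refl
countN-unsign (N ∷ xs) = cong suc (countN-unsign xs)
countN-unsign (E ∷ xs) = countN-unsign xs
countN-unsign (E⁺ ∷ xs) = countN-unsign xs
countN-unsign (E⁻ ∷ xs) = countN-unsign xs

countE-unsign : ∀ xs → countE (map unsign xs) ≡ countE xs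
countE-unsign [] = refl
countE-unsign (N ∷ xs) = countE-unsign xs
countE-unsign (E ∷ xs) = cong suc (countE-unsign xs)
countE-unsign (E⁺ ∷ xs) = cong suc (countE-unsign xs)
countE-unsign (E⁻ ∷ xs) = cong suc (countE-unsign xs)

countN+countE : ∀ xs → countN xs ℕ.+ countE xs ≡ length xs
countN+countE [] = refl
countN+countE (N ∷ xs) = cong suc (countN+countE xs)
countN+countE (E ∷ xs) = trans (ℕₚ.+-suc _ _) (cong suc (countN+countE xs))
countN+countE (E⁺ ∷ xs) = trans (ℕₚ.+-suc _ _) (cong suc (countN+countE xs))
countN+countE (E⁻ ∷ xs) = trans (ℕₚ.+-suc _ _) (cong suc (countN+countE xs))

-- The metavariable is solved by the local function of valleys, which cannot be named outside Defs.
mutual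
  valleysFrom : ℕ → ℕ → List Step → List (ℕ × ℕ)
  valleysFrom = _

  valleysFrom-solve : ∀ p → valleys (N ∷ E ∷ p) ≡ valleysFrom 0 1 (E ∷ p)
  valleysFrom-solve p with E ∷ p | suc zero | zero
  ... | q | m′ | e = refl

valleysFrom-unsign : ∀ e m xs → valleysFrom e m (map unsign xs) ≡ valleysFrom e m xs
valleysFrom-unsign e m [] = refl
valleysFrom-unsign e m (N ∷ xs) = valleysFrom-unsign e (suc m) xs
valleysFrom-unsign e m (E ∷ []) = refl
valleysFrom-unsign e m (E ∷ N ∷ xs) = cong (_ ∷_) (valleysFrom-unsign (suc e) m (N ∷ xs))
valleysFrom-unsign e m (E ∷ E ∷ xs) = valleysFrom-unsign (suc e) m (E ∷ xs)
valleysFrom-unsign e m (E ∷ E⁺ ∷ xs) = valleysFrom-unsign (suc e) m (E⁺ ∷ xs)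
valleysFrom-unsign e m (E ∷ E⁻ ∷ xs) = valleysFrom-unsign (suc e) m (E⁻ ∷ xs)
valleysFrom-unsign e m (E⁺ ∷ []) = refl
valleysFrom-unsign e m (E⁺ ∷ N ∷ xs) = cong (_ ∷_) (valleysFrom-unsign (suc e) m (N ∷ xs))
valleysFrom-unsign e m (E⁺ ∷ E ∷ xs) = valleysFrom-unsign (suc e) m (E ∷ xs)
valleysFrom-unsign e m (E⁺ ∷ E⁺ ∷ xs) = valleysFrom-unsign (suc e) m (E⁺ ∷ xs)
valleysFrom-unsign e m (E⁺ ∷ E⁻ ∷ xs) = valleysFrom-unsign (suc e) m (E⁻ ∷ xs)
valleysFrom-unsign e m (E⁻ ∷ []) = refl
valleysFrom-unsign e m (E⁻ ∷ N ∷ xs) = cong (_ ∷_) (valleysFrom-unsign (suc e) m (N ∷ xs))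
valleysFrom-unsign e m (E⁻ ∷ E ∷ xs) = valleysFrom-unsign (suc e) m (E ∷ xs)
valleysFrom-unsign e m (E⁻ ∷ E⁺ ∷ xs) = valleysFrom-unsign (suc e) m (E⁺ ∷ xs)
valleysFrom-unsign e m (E⁻ ∷ E⁻ ∷ xs) = valleysFrom-unsign (suc e) m (E⁻ ∷ xs)

module _ {P : ℕ × ℕ → Set} where

  -- The valleys already seen: a pending East step has been counted when a North step comes next.
  Seen : List Step → List Step → Set
  Seen ρ (E ∷ xs) = Val P ρ
  Seen ρ _ = Val P (N ∷ ρ)

  Seen-N : ∀ ρ xs → Seen (N ∷ ρ) xs ≡ Val P (N ∷ ρ)
  Seen-N ρ [] = refl
  Seen-N ρ (N ∷ xs) = refl
  Seen-N ρ (E ∷ xs) = refl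
  Seen-N ρ (E⁺ ∷ xs) = refl
  Seen-N ρ (E⁻ ∷ xs) = refl

  valleysFrom⇒Val : ∀ ρ {xs} → All Plain xs → All P (valleysFrom (countE ρ) (countN ρ) xs) → Seen ρ xs → Val P (N ∷ (xs ʳ++ ρ))
  valleysFrom⇒Val ρ [] _ s = s
  valleysFrom⇒Val ρ {N ∷ xs} (inj₁ refl ∷ pl) a s = valleysFrom⇒Val (N ∷ ρ) pl a (subst id (sym (Seen-N ρ xs)) s)
  valleysFrom⇒Val ρ (inj₂ refl ∷ []) (p ∷ []) s = p , s
  valleysFrom⇒Val ρ (inj₂ refl ∷ pl@(inj₁ refl ∷ _)) (p ∷ a) s = valleysFrom⇒Val (E ∷ ρ) pl a (p , s)
  valleysFrom⇒Val ρ (inj₂ refl ∷ pl@(inj₂ refl ∷ _)) a s = valleysFrom⇒Val (E ∷ ρ) pl a s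

  Val⇒valleysFrom : ∀ ρ {xs} → All Plain xs → Val P (N ∷ (xs ʳ++ ρ)) → All P (valleysFrom (countE ρ) (countN ρ) xs) × Seen ρ xs
  Val⇒valleysFrom ρ [] s = [] , s
  Val⇒valleysFrom ρ {N ∷ xs} (inj₁ refl ∷ pl) v with Val⇒valleysFrom (N ∷ ρ) pl v
  ... | a , s = a , subst id (Seen-N ρ xs) s
  Val⇒valleysFrom ρ (inj₂ refl ∷ []) (p , s) = p ∷ [] , s
  Val⇒valleysFrom ρ (inj₂ refl ∷ pl@(inj₁ refl ∷ _)) v with Val⇒valleysFrom (E ∷ ρ) pl v
  ... | a , p , s = p ∷ a , s
  Val⇒valleysFrom ρ (inj₂ refl ∷ pl@(inj₂ refl ∷ _)) v = Val⇒valleysFrom (E ∷ ρ) pl v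

  Val-start : ∀ xs → Seen [] (map unsign xs)
  Val-start [] = tt
  Val-start (N ∷ xs) = tt
  Val-start (E ∷ xs) = tt
  Val-start (E⁺ ∷ xs) = tt
  Val-start (E⁻ ∷ xs) = tt

  -- The N in front is one more North step at the end of the path. It turns the convention for a
  -- final East step into an ordinary valley.
  valleys⇒Val : ∀ b → All P (valleys b) → Val P (N ∷ reverse (map unsign b))
  valleys⇒Val b a = valleysFrom⇒Val [] (unsign-plain b) (subst (All P) (sym (valleysFrom-unsign 0 0 b)) a) (Val-start b)

  Val⇒valleys : ∀ b → Val P (N ∷ reverse (map unsign b)) → All P (valleys b)
  Val⇒valleys b v = subst (All P) (valleysFrom-unsign 0 0 b) (proj₁ (Val⇒valleysFrom [] (unsign-plain b) v))

Val-map : ∀ {P P′ : ℕ × ℕ → Set} ρ → (∀ i j → i < countE ρ → j < countN ρ → P (suc i , suc j) → P′ (suc i , suc j)) → Val P ρ → Val P′ ρ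
Val-map [] f v = tt
Val-map (N ∷ []) f v = tt
Val-map (N ∷ N ∷ ρ) f v = Val-map (N ∷ ρ) (λ i j lt lt′ → f i j lt (ℕₚ.m<n⇒m<1+n lt′)) v
Val-map (N ∷ E ∷ ρ) f (p , v) =
  f _ _ (ℕₚ.n<1+n _) (ℕₚ.n<1+n _) p , Val-map ρ (λ i j lt lt′ → f i j (ℕₚ.m<n⇒m<1+n lt) (ℕₚ.m<n⇒m<1+n lt′)) v
Val-map (N ∷ E⁺ ∷ ρ) f v = Val-map (E⁺ ∷ ρ) (λ i j lt lt′ → f i j lt (ℕₚ.m<n⇒m<1+n lt′)) v
Val-map (N ∷ E⁻ ∷ ρ) f v = Val-map (E⁻ ∷ ρ) (λ i j lt lt′ → f i j lt (ℕₚ.m<n⇒m<1+n lt′)) v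
Val-map (E ∷ ρ) f v = Val-map ρ (λ i j lt lt′ → f i j (ℕₚ.m<n⇒m<1+n lt) lt′) v
Val-map (E⁺ ∷ ρ) f v = Val-map ρ (λ i j lt lt′ → f i j (ℕₚ.m<n⇒m<1+n lt) lt′) v
Val-map (E⁻ ∷ ρ) f v = Val-map ρ (λ i j lt lt′ → f i j (ℕₚ.m<n⇒m<1+n lt) lt′) v

nthN-skip-east : ∀ k {x} xs → isEast x ≡ true → nthNFollowedByEast (suc k) (x ∷ xs) ≡ nthNFollowedByEast (suc k) xs
nthN-skip-east zero {E} xs _ = refl
nthN-skip-east zero {E⁺} xs _ = refl
nthN-skip-east zero {E⁻} xs _ = refl
nthN-skip-east (suc k) {E} xs _ = refl
nthN-skip-east (suc k) {E⁺} xs _ = refl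
nthN-skip-east (suc k) {E⁻} xs _ = refl

nthN-unsign : ∀ k xs → nthNFollowedByEast k (map unsign xs) ≡ nthNFollowedByEast k xs
nthN-unsign k [] = refl
nthN-unsign zero (x ∷ xs) = refl
nthN-unsign (suc zero) (N ∷ []) = refl
nthN-unsign (suc zero) (N ∷ N ∷ xs) = refl
nthN-unsign (suc zero) (N ∷ E ∷ xs) = refl
nthN-unsign (suc zero) (N ∷ E⁺ ∷ xs) = refl
nthN-unsign (suc zero) (N ∷ E⁻ ∷ xs) = refl
nthN-unsign (suc (suc k)) (N ∷ xs) = nthN-unsign (suc k) xs
nthN-unsign (suc k) (E ∷ xs) = trans (nthN-skip-east k (map unsign xs) refl) (trans (nthN-unsign (suc k) xs) (sym (nthN-skip-east k xs refl)))
nthN-unsign (suc k) (E⁺ ∷ xs) = trans (nthN-skip-east k (map unsign xs) refl) (trans (nthN-unsign (suc k) xs) (sym (nthN-skip-east k xs refl)))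
nthN-unsign (suc k) (E⁻ ∷ xs) = trans (nthN-skip-east k (map unsign xs) refl) (trans (nthN-unsign (suc k) xs) (sym (nthN-skip-east k xs refl)))

-- Between two consecutive North steps there are only East steps. A valley just before the second,
-- or at the end of the path when there is no second, therefore puts an East step directly after the
-- first.
valleysFrom-nthN : ∀ e m k {xs} → All Plain xs →
  All (λ (i , j) → j ≡ suc (suc k ℕ.+ m) → nthNFollowedByEast (suc k) xs ≡ true) (valleysFrom e m xs)
valleysFrom-nthN e m k [] = []
valleysFrom-nthN e m zero {N ∷ []} (inj₁ refl ∷ pl) = []
valleysFrom-nthN e m zero {N ∷ N ∷ xs} (inj₁ refl ∷ _ ∷ pl) =
  All.map (λ lt eq → ⊥-elim (ℕₚ.<⇒≢ lt (sym eq))) (above e (suc (suc m)) xs pl)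
  where
  above : ∀ e m xs → All Plain xs → All (λ (i , j) → m < j) (valleysFrom e m xs)
  above e m [] [] = []
  above e m (N ∷ xs) (_ ∷ pl) = All.map (ℕₚ.<-trans (ℕₚ.n<1+n m)) (above e (suc m) xs pl)
  above e m (E ∷ []) _ = ℕₚ.n<1+n m ∷ []
  above e m (E ∷ N ∷ xs) (_ ∷ pl) = ℕₚ.n<1+n m ∷ above (suc e) m (N ∷ xs) pl
  above e m (E ∷ E ∷ xs) (_ ∷ pl) = above (suc e) m (E ∷ xs) pl
  above e m (E ∷ E⁺ ∷ xs) (_ ∷ inj₁ () ∷ _)
  above e m (E ∷ E⁺ ∷ xs) (_ ∷ inj₂ () ∷ _)
  above e m (E ∷ E⁻ ∷ xs) (_ ∷ inj₁ () ∷ _)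
  above e m (E ∷ E⁻ ∷ xs) (_ ∷ inj₂ () ∷ _)
  above e m (E⁺ ∷ xs) (inj₁ () ∷ _)
  above e m (E⁺ ∷ xs) (inj₂ () ∷ _)
  above e m (E⁻ ∷ xs) (inj₁ () ∷ _)
  above e m (E⁻ ∷ xs) (inj₂ () ∷ _)
valleysFrom-nthN e m zero {N ∷ E ∷ xs} (inj₁ refl ∷ pl) = All.universal (λ _ _ → refl) _
valleysFrom-nthN e m zero {N ∷ E⁺ ∷ xs} (inj₁ refl ∷ pl) = All.universal (λ _ _ → refl) _
valleysFrom-nthN e m zero {N ∷ E⁻ ∷ xs} (inj₁ refl ∷ pl) = All.universal (λ _ _ → refl) _
valleysFrom-nthN e m (suc k) {N ∷ xs} (inj₁ refl ∷ pl) =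
  All.map (λ h eq → h (trans eq (cong (λ u → suc (suc u)) (sym (ℕₚ.+-suc k m))))) (valleysFrom-nthN e (suc m) k pl)
valleysFrom-nthN e m k {E ∷ []} (inj₂ refl ∷ pl) = (λ eq → ⊥-elim (ℕₚ.m≢1+n+m m (ℕₚ.suc-injective eq))) ∷ []
valleysFrom-nthN e m k {E ∷ xs@(N ∷ _)} (inj₂ refl ∷ pl) =
  (λ eq → ⊥-elim (ℕₚ.m≢1+n+m m (ℕₚ.suc-injective eq))) ∷
  All.map (λ h eq → trans (nthN-skip-east k xs refl) (h eq)) (valleysFrom-nthN (suc e) m k pl)
valleysFrom-nthN e m k {E ∷ xs@(E ∷ _)} (inj₂ refl ∷ pl) =
  All.map (λ h eq → trans (nthN-skip-east k xs refl) (h eq)) (valleysFrom-nthN (suc e) m k pl)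
valleysFrom-nthN e m k {E ∷ E⁺ ∷ xs} (inj₂ refl ∷ inj₁ () ∷ _)
valleysFrom-nthN e m k {E ∷ E⁺ ∷ xs} (inj₂ refl ∷ inj₂ () ∷ _)
valleysFrom-nthN e m k {E ∷ E⁻ ∷ xs} (inj₂ refl ∷ inj₁ () ∷ _)
valleysFrom-nthN e m k {E ∷ E⁻ ∷ xs} (inj₂ refl ∷ inj₂ () ∷ _)

valleys-nthN : ∀ n b → nthNFollowedByEast (suc n) b ≡ false → All (λ (i , j) → j ≢ suc (suc n)) (valleys b)
valleys-nthN n b nf = All.map
  (λ h eq → case-true (trans (sym (trans (nthN-unsign (suc n) b) nf)) (h (trans eq (cong (suc ∘ suc) (sym (ℕₚ.+-identityʳ n)))))))
  (subst (All _) (valleysFrom-unsign 0 0 b) (valleysFrom-nthN 0 0 n (unsign-plain b)))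
  where
  case-true : false ≡ true → ⊥
  case-true ()

Prefixes : ℕ → ℕ → List Step → Set
Prefixes e m b = ∀ k → countE (take k b) ℕ.+ e ≤ countN (take k b) ℕ.+ m

prefixes⇒Ballot : ∀ ρ {xs} → All Plain xs → Prefixes (countE ρ) (countN ρ) xs → Ballot ρ → Ballot (xs ʳ++ ρ)
prefixes⇒Ballot ρ [] _ bal = bal
prefixes⇒Ballot ρ {N ∷ xs} (inj₁ refl ∷ pl) h bal = prefixes⇒Ballot (N ∷ ρ) pl
  (λ k → ℕₚ.≤-trans (h (suc k)) (ℕₚ.≤-reflexive (sym (ℕₚ.+-suc (countN (take k xs)) _)))) (h 1 , bal)
prefixes⇒Ballot ρ {E ∷ xs} (inj₂ refl ∷ pl) h bal = prefixes⇒Ballot (E ∷ ρ) pl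
  (λ k → ℕₚ.≤-trans (ℕₚ.≤-reflexive (ℕₚ.+-suc (countE (take k xs)) _)) (h (suc k))) (h 1 , bal)

Ballot-ʳ++ : ∀ xs {ρ} → Ballot (xs ʳ++ ρ) → Ballot ρ
Ballot-ʳ++ [] bal = bal
Ballot-ʳ++ (x ∷ xs) bal = proj₂ (Ballot-ʳ++ xs bal)

Ballot-top : ∀ ρ → Ballot ρ → countE ρ ≤ countN ρ
Ballot-top [] _ = z≤n
Ballot-top (_ ∷ _) (le , _) = le

Ballot⇒prefixes : ∀ ρ {xs} → All Plain xs → Ballot (xs ʳ++ ρ) → Prefixes (countE ρ) (countN ρ) xs
Ballot⇒prefixes ρ {xs} pl bal zero = Ballot-top ρ (Ballot-ʳ++ xs bal)
Ballot⇒prefixes ρ [] bal (suc k) = Ballot-top ρ bal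
Ballot⇒prefixes ρ {N ∷ xs} (inj₁ refl ∷ pl) bal (suc k) =
  ℕₚ.≤-trans (Ballot⇒prefixes (N ∷ ρ) pl bal k) (ℕₚ.≤-reflexive (ℕₚ.+-suc (countN (take k xs)) _))
Ballot⇒prefixes ρ {E ∷ xs} (inj₂ refl ∷ pl) bal (suc k) =
  ℕₚ.≤-trans (ℕₚ.≤-reflexive (sym (ℕₚ.+-suc (countE (take k xs)) _))) (Ballot⇒prefixes (E ∷ ρ) pl bal k)

ballot⇒Ballot : ∀ b → (∀ k → countE (take k b) ≤ countN (take k b)) → Ballot (reverse (map unsign b))
ballot⇒Ballot b h = prefixes⇒Ballot [] (unsign-plain b) (λ k → subst₂ _≤_
  (sym (trans (ℕₚ.+-identityʳ _) (trans (cong countE (Lₚ.take-map k b)) (countE-unsign (take k b)))))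
  (sym (trans (ℕₚ.+-identityʳ _) (trans (cong countN (Lₚ.take-map k b)) (countN-unsign (take k b))))) (h k)) tt

Ballot⇒ballot : ∀ b → Ballot (reverse (map unsign b)) → ∀ k → countE (take k b) ≤ countN (take k b)
Ballot⇒ballot b bal k = subst₂ _≤_
  (trans (ℕₚ.+-identityʳ _) (trans (cong countE (Lₚ.take-map k b)) (countE-unsign (take k b))))
  (trans (ℕₚ.+-identityʳ _) (trans (cong countN (Lₚ.take-map k b)) (countN-unsign (take k b))))
  (Ballot⇒prefixes [] (unsign-plain b) bal k)

data Sign : Step → Set where
  plus : Sign E⁺
  minus : Sign E⁻

signOf : Step → ℤ
signOf E⁻ = -1ℤ
signOf _ = 1ℤ

signAfter-skip : ∀ k s xs → signAfterNthN (suc k) s (E ∷ xs) ≡ E ∷ signAfterNthN (suc k) s xs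
signAfter-skip zero s xs = refl
signAfter-skip (suc k) s xs = refl

unsign-signAfter : ∀ k {s} → Sign s → ∀ {xs} → All Plain xs → map unsign (signAfterNthN k s xs) ≡ xs
unsign-signAfter zero sg pl = plain-unsign pl
unsign-signAfter (suc k) sg [] = refl
unsign-signAfter (suc zero) sg (inj₁ refl ∷ []) = refl
unsign-signAfter (suc zero) sg (inj₁ refl ∷ inj₁ refl ∷ pl) = cong (λ xs → N ∷ N ∷ xs) (plain-unsign pl)
unsign-signAfter (suc zero) plus (inj₁ refl ∷ inj₂ refl ∷ pl) = cong (λ xs → N ∷ E ∷ xs) (plain-unsign pl)
unsign-signAfter (suc zero) minus (inj₁ refl ∷ inj₂ refl ∷ pl) = cong (λ xs → N ∷ E ∷ xs) (plain-unsign pl)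
unsign-signAfter (suc (suc k)) sg (inj₁ refl ∷ pl) = cong (N ∷_) (unsign-signAfter (suc k) sg pl)
unsign-signAfter (suc k) {s} sg {E ∷ xs} (inj₂ refl ∷ pl) =
  trans (cong (map unsign) (signAfter-skip k s xs)) (cong (E ∷_) (unsign-signAfter (suc k) sg pl))

plain-unsigned : ∀ {xs} → All Plain xs → countᵇ isE⁻ xs ≡ 0
plain-unsigned [] = refl
plain-unsigned (inj₁ refl ∷ pl) = plain-unsigned pl
plain-unsigned (inj₂ refl ∷ pl) = plain-unsigned pl

ε-plain : ∀ {xs} → All Plain xs → ε xs ≡ 1ℤ
ε-plain pl rewrite plain-unsigned pl = refl

ε-signAfter : ∀ k {s} → Sign s → ∀ {xs} → All Plain xs →
  ε (signAfterNthN (suc k) s xs) ≡ (if nthNFollowedByEast (suc k) xs then signOf s else 1ℤ)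
ε-signAfter k sg [] = refl
ε-signAfter zero sg (inj₁ refl ∷ []) = refl
ε-signAfter zero sg (inj₁ refl ∷ inj₁ refl ∷ pl) = ε-plain pl
ε-signAfter zero plus (inj₁ refl ∷ inj₂ refl ∷ pl) = ε-plain pl
ε-signAfter zero minus (inj₁ refl ∷ inj₂ refl ∷ pl) = refl
ε-signAfter (suc k) sg (inj₁ refl ∷ pl) = ε-signAfter k sg pl
ε-signAfter k {s} sg {E ∷ xs} (inj₂ refl ∷ pl) =
  trans (cong ε (signAfter-skip k s xs)) (trans (ε-signAfter k sg pl) (cong (λ c → if c then signOf s else 1ℤ) (sym (nthN-skip-east k xs refl))))

SignShape-skip : ∀ k xs → SignShape (suc k) xs → SignShape (suc k) (E ∷ xs)
SignShape-skip zero xs h = h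
SignShape-skip (suc k) xs h = h

SignShape-signAfter : ∀ k {s} → Sign s → ∀ {xs} → All Plain xs → SignShape (suc k) (signAfterNthN (suc k) s xs)
SignShape-signAfter k sg [] = tt
SignShape-signAfter zero sg (inj₁ refl ∷ []) = tt
SignShape-signAfter zero sg (inj₁ refl ∷ inj₁ refl ∷ pl) = inj₁ refl , pl
SignShape-signAfter zero plus (inj₁ refl ∷ inj₂ refl ∷ pl) = inj₂ (inj₁ refl) , pl
SignShape-signAfter zero minus (inj₁ refl ∷ inj₂ refl ∷ pl) = inj₂ (inj₂ refl) , pl
SignShape-signAfter (suc k) sg (inj₁ refl ∷ pl) = SignShape-signAfter k sg pl
SignShape-signAfter k {s} sg {E ∷ xs} (inj₂ refl ∷ pl) =
  subst (SignShape (suc k)) (sym (signAfter-skip k s xs)) (SignShape-skip k _ (SignShape-signAfter k sg pl))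

SignShape-unskip : ∀ k xs → SignShape (suc k) (E ∷ xs) → SignShape (suc k) xs
SignShape-unskip zero xs h = h
SignShape-unskip (suc k) xs h = h

SignShape-split : ∀ k b → SignShape (suc k) b → ∃ λ s → Sign s × b ≡ signAfterNthN (suc k) s (map unsign b)
-- Where no step carries a sign, `E⁺` is an arbitrary choice, since inserting a sign then changes
-- nothing.
SignShape-split k [] h = E⁺ , plus , refl
SignShape-split zero (N ∷ []) h = E⁺ , plus , refl
SignShape-split zero (N ∷ _ ∷ xs) (inj₁ refl , pl) = E⁺ , plus , cong (λ xs → N ∷ N ∷ xs) (sym (plain-unsign pl))
SignShape-split zero (N ∷ _ ∷ xs) (inj₂ (inj₁ refl) , pl) = E⁺ , plus , cong (λ xs → N ∷ E⁺ ∷ xs) (sym (plain-unsign pl))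
SignShape-split zero (N ∷ _ ∷ xs) (inj₂ (inj₂ refl) , pl) = E⁻ , minus , cong (λ xs → N ∷ E⁻ ∷ xs) (sym (plain-unsign pl))
SignShape-split (suc k) (N ∷ xs) h with SignShape-split k xs h
... | s , sg , eq = s , sg , cong (N ∷_) eq
SignShape-split k (E ∷ xs) h with SignShape-split k xs (SignShape-unskip k xs h)
... | s , sg , eq = s , sg , trans (cong (E ∷_) eq) (sym (signAfter-skip k s _))
SignShape-split zero (E⁺ ∷ xs) ()
SignShape-split (suc k) (E⁺ ∷ xs) ()
SignShape-split zero (E⁻ ∷ xs) ()
SignShape-split (suc k) (E⁻ ∷ xs) ()

-- Symmetries of the word and of the reading

==-cong : ∀ {x y x′ y′} → (x ≡ y → x′ ≡ y′) → (x′ ≡ y′ → x ≡ y) → (x ==ℤ y) ≡ (x′ ==ℤ y′)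
==-cong {x} {y} {x′} {y′} f g with x′ ℤ.≟ y′
... | yes eq = ==-true (g eq)
... | no ne = ==-false (ne ∘ f)

reading-∷ : ∀ K x M → reading K (x ∷ M) ≡
  concat (applyUpTo (λ i → (sel⁻ i x ++ concatMap (sel⁻ i) M) ++ (concatMap (sel⁺ i) (reverse M) ++ sel⁺ i x)) K)
reading-∷ K x M = concat-applyUpTo-cong (λ i → cong ((sel⁻ i x ++ concatMap (sel⁻ i) M) ++_)
  (trans (cong (concatMap (sel⁺ i)) (Lₚ.unfold-reverse x M)) (concatMap-∷ʳ (sel⁺ i) (reverse M) x))) K

reading-∷ʳ : ∀ K M x → reading K (M ∷ʳ x) ≡
  concat (applyUpTo (λ i → concatMap (sel⁻ i) M ++ (sel⁻ i x ++ sel⁺ i x) ++ concatMap (sel⁺ i) (reverse M)) K)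
reading-∷ʳ K M x = concat-applyUpTo-cong (λ i →
  trans (cong₂ _++_ (concatMap-∷ʳ (sel⁻ i) M x) (cong (concatMap (sel⁺ i)) (Lₚ.reverse-++ M (x ∷ []))))
    (trans (Lₚ.++-assoc (concatMap (sel⁻ i) M) (sel⁻ i x) _)
      (cong (concatMap (sel⁻ i) M ++_) (sym (Lₚ.++-assoc (sel⁻ i x) (sel⁺ i x) _))))) K

reflect : ℤ → ℤ
reflect m = 1ℤ ℤ.- m

reflect-involutive : ∀ m → reflect (reflect m) ≡ m
reflect-involutive = solve 1 (λ m → con 1ℤ :- (con 1ℤ :- m) := m) refl
  where open +-*-Solver

reflect-neg : ∀ i → reflect (- + i) ≡ + suc i
reflect-neg i = cong (λ z → 1ℤ ℤ.+ z) (ℤₚ.neg-involutive (+ i))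

reflect-suc : ∀ i → reflect (+ suc i) ≡ - + i
reflect-suc i = trans (cong reflect (sym (reflect-neg i))) (reflect-involutive (- + i))

-- At each level the last row ends the scan of the negative entries and opens that of the positive
-- ones, so its two possible places are adjacent. The reflection exchanges the areas `- i` and
-- `i + 1`, and the negated label cancels the negation of positive rows.
reading-reflect : ∀ K M m v → reading K (M ∷ʳ (m , v)) ≡ reading K (M ∷ʳ (reflect m , - v))
reading-reflect K M m v = trans (reading-∷ʳ K M (m , v)) (trans
  (concat-applyUpTo-cong (λ i → cong (λ ys → concatMap (sel⁻ i) M ++ ys ++ concatMap (sel⁺ i) (reverse M)) (swap i)) K)
  (sym (reading-∷ʳ K M (reflect m , - v))))
  where
  swap : ∀ i → sel⁻ i (m , v) ++ sel⁺ i (m , v) ≡ sel⁻ i (reflect m , - v) ++ sel⁺ i (reflect m , - v)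
  swap i rewrite ==-cong {reflect m} { - + i} {m} {+ suc i}
                   (λ eq → trans (sym (reflect-involutive m)) (trans (cong reflect eq) (reflect-neg i)))
                   (λ eq → trans (cong reflect eq) (reflect-suc i))
               | ==-cong {reflect m} {+ suc i} {m} { - + i}
                   (λ eq → trans (sym (reflect-involutive m)) (trans (cong reflect eq) (reflect-suc i)))
                   (λ eq → trans (cong reflect eq) (reflect-neg i))
               | ℤₚ.neg-involutive v
    with m ℤ.≟ - + i | m ℤ.≟ + suc i
  ... | no _ | no _ = refl
  ... | no _ | yes _ = refl
  ... | yes _ | no _ = refl
  ... | yes refl | yes eq = ⊥-elim (ℤₚ.<⇒≢ (ℤₚ.≤-<-trans (neg+≤0 i) (ℤ.+<+ (s≤s z≤n))) eq)

step-comm : ∀ k m → step⁺ k m ++ step⁻ k m ≡ step⁻ k m ++ step⁺ k m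
step-comm k (+ zero) rewrite step⁻-neg k (+ 0) = refl
step-comm k (+ suc m) = trans (cong (step⁺ k (+ suc m) ++_) null) (trans (Lₚ.++-identityʳ _) (cong (_++ step⁺ k (+ suc m)) (sym null)))
  where
  null : step⁻ k (+ suc m) ≡ []
  null = trans (sym (step⁺-neg k (+ suc m))) (step⁺-null k { -[1+ m ]} (λ ()) (λ ()))
step-comm k -[1+ m ] = trans (cong (_++ step⁻ k -[1+ m ]) null) (trans (sym (Lₚ.++-identityʳ _)) (cong (step⁻ k -[1+ m ] ++_) (sym null)))
  where
  null : step⁺ k -[1+ m ] ≡ []
  null = step⁺-null k { -[1+ m ]} (λ ()) (λ ())

block-∷ : ∀ k m ms → block k (m ∷ ms) ≡ concatMap (step⁺ k) (reverse ms) ++ (step⁺ k m ++ step⁻ k m) ++ concatMap (step⁻ k) ms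
block-∷ k m ms = trans (cong (_++ step⁻ k m ++ concatMap (step⁻ k) ms)
    (trans (cong (concatMap (step⁺ k)) (Lₚ.unfold-reverse m ms)) (concatMap-∷ʳ (step⁺ k) (reverse ms) m)))
  (trans (Lₚ.++-assoc (concatMap (step⁺ k) (reverse ms)) (step⁺ k m) _)
    (cong (concatMap (step⁺ k) (reverse ms) ++_) (sym (Lₚ.++-assoc (step⁺ k m) (step⁻ k m) _))))

-- In every block the first entry comes last among the positive letters and first among the negative
-- ones. Negation swaps these two adjacent contributions; one of them is empty, or they are equal
-- when the entry is zero.
zeta-neg : ∀ K m ms → reversedZeta K (- m ∷ ms) ≡ reversedZeta K (m ∷ ms)
zeta-neg K m ms = concat-applyUpTo-cong (λ k → trans (block-∷ k (- m) ms) (trans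
  (cong (λ ys → concatMap (step⁺ k) (reverse ms) ++ ys ++ concatMap (step⁻ k) ms)
    (trans (cong₂ _++_ (step⁺-neg k m) (step⁻-neg k m)) (sym (step-comm k m))))
  (sym (block-∷ k m ms)))) K

block-∷ʳ : ∀ k ms m → block k (ms ∷ʳ m) ≡ step⁺ k m ++ block k ms ++ step⁻ k m
block-∷ʳ k ms m = trans (cong₂ _++_ (cong (concatMap (step⁺ k)) (Lₚ.reverse-++ ms (m ∷ []))) (concatMap-∷ʳ (step⁻ k) ms m))
  (trans (Lₚ.++-assoc (step⁺ k m) _ _) (cong (step⁺ k m ++_) (sym (Lₚ.++-assoc (concatMap (step⁺ k) (reverse ms)) _ _))))

-- The letters contributed by the last entry move past a block boundary, which does not change
-- the concatenation; only for j = 0 do the two words differ, in the letter that dropLast deletes.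
zeta-reflect : ∀ K ms j → suc j < suc K →
  dropLast (reverse (reversedZeta (suc K) (ms ∷ʳ + suc j))) ≡ dropLast (reverse (reversedZeta (suc K) (ms ∷ʳ - + j)))
zeta-reflect K ms j lt = trans (cong (dropLast ∘ reverse) left) (trans (first j) (cong (dropLast ∘ reverse) (sym right)))
  where
  open ≡-Reasoning
  p = λ k → step⁺ k (+ suc j)
  C = λ k → block k ms
  T = concat (applyUpTo (λ k → C k ++ p (suc k)) (suc K))
  left : reversedZeta (suc K) (ms ∷ʳ + suc j) ≡ p 0 ++ T
  left = begin
    reversedZeta (suc K) (ms ∷ʳ + suc j)
      ≡⟨ concat-applyUpTo-cong (λ k → trans (block-∷ʳ k ms (+ suc j)) (cong (p k ++_) (trans (cong (C k ++_)
           (trans (sym (step⁺-neg k (+ suc j))) (step⁺-null k { -[1+ j ]} (λ ()) (λ ())))) (Lₚ.++-identityʳ _)))) (suc K) ⟩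
    concat (applyUpTo (λ k → p k ++ C k) (suc K))        ≡⟨ Lₚ.++-identityʳ _ ⟨
    concat (applyUpTo (λ k → p k ++ C k) (suc K)) ++ []  ≡⟨ cong (concat (applyUpTo (λ k → p k ++ C k) (suc K)) ++_) (sym (step⁺-bounded {suc K} {+ suc j} lt)) ⟩
    concat (applyUpTo (λ k → p k ++ C k) (suc K)) ++ p (suc K) ≡⟨ concat-shift p C (suc K) ⟩
    p 0 ++ T ∎
  q : ∀ k → step⁻ k (- + j) ≡ p (suc k)
  q k = trans (step⁻-neg k (+ j)) (cong₂ (λ b c → if b then N ∷ [] else if c then E ∷ [] else [])
    (==-cong {+ j} {+ k} {+ suc j} {+ suc k} (cong ℤ.suc) (λ eq → cong +_ (ℕₚ.suc-injective (ℤₚ.+-injective eq))))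
    (==-cong {+ j} {+ suc k} {+ suc j} {+ suc (suc k)} (cong ℤ.suc) (λ eq → cong +_ (ℕₚ.suc-injective (ℤₚ.+-injective eq)))))
  p′ : ∀ k → step⁺ (suc k) (- + j) ≡ []
  p′ k = step⁺-null (suc k) { - + j}
    (λ eq → ℤₚ.<⇒≢ (ℤₚ.≤-<-trans (neg+≤0 j) (ℤ.+<+ (s≤s z≤n))) eq) (λ eq → ℤₚ.<⇒≢ (ℤₚ.≤-<-trans (neg+≤0 j) (ℤ.+<+ (s≤s z≤n))) eq)
  right : reversedZeta (suc K) (ms ∷ʳ - + j) ≡ step⁺ 0 (- + j) ++ T
  right = begin
    reversedZeta (suc K) (ms ∷ʳ - + j)
      ≡⟨ concat-applyUpTo-cong (λ k → trans (block-∷ʳ k ms (- + j)) (cong (λ ys → step⁺ k (- + j) ++ C k ++ ys) (q k))) (suc K) ⟩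
    concat (applyUpTo (λ k → step⁺ k (- + j) ++ C k ++ p (suc k)) (suc K))
      ≡⟨ cong₂ _++_ refl (concat-applyUpTo-cong (λ k → cong (_++ C (suc k) ++ p (suc (suc k))) (p′ k)) K) ⟩
    (step⁺ 0 (- + j) ++ C 0 ++ p 1) ++ concat (applyUpTo (λ k → C (suc k) ++ p (suc (suc k))) K)
      ≡⟨ Lₚ.++-assoc (step⁺ 0 (- + j)) _ _ ⟩
    step⁺ 0 (- + j) ++ T ∎
  first : ∀ j → dropLast (reverse (step⁺ 0 (+ suc j) ++ T)) ≡ dropLast (reverse (step⁺ 0 (- + j) ++ T))
  first zero = trans (cong dropLast (Lₚ.unfold-reverse E T)) (trans (dropLast-∷ʳ (reverse T) E)
    (sym (trans (cong dropLast (Lₚ.unfold-reverse N T)) (dropLast-∷ʳ (reverse T) N))))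
  first (suc j) = cong (λ ys → dropLast (reverse (ys ++ T))) (trans (step⁺-null 0 {+ suc (suc j)} (λ ()) (λ ())) (sym (step⁺-null 0 { -[1+ j ]} (λ ()) (λ ()))))

-- A zero in the first row is the first thing read and its label appears nowhere else; changing its
-- sign thus amounts to changing the sign of the first entry of the reading.
reading-zero : ∀ K {m} M → m ≡ 0ℤ → ∃ λ T → ∀ v → reading (suc K) ((m , v) ∷ M) ≡ v ∷ T
reading-zero K M refl = T , λ v → trans (reading-∷ (suc K) (0ℤ , v) M)
  (cong (v ∷_) (cong₂ _++_ (cong (concatMap (sel⁻ 0) M ++_) (Lₚ.++-identityʳ _))
    (concat-applyUpTo-cong (λ i → cong (concatMap (sel⁻ (suc i)) M ++_) (Lₚ.++-identityʳ _)) K)))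
  where
  T = (concatMap (sel⁻ 0) M ++ concatMap (sel⁺ 0) (reverse M)) ++
      concat (applyUpTo (λ i → concatMap (sel⁻ (suc i)) M ++ concatMap (sel⁺ (suc i)) (reverse M)) K)

sel⁻-bounded : ∀ {K m v} → ∣ m ∣ < K → sel⁻ K (m , v) ≡ []
sel⁻-bounded {K} {m} lt rewrite ==-false {m} { - + K} (λ { refl → ℕₚ.<-irrefl (ℤₚ.∣-i∣≡∣i∣ (+ K)) lt }) = refl

-- A first row of area `i + 1` is read at the end of level `i`, one of area `- (i + 1)` at the start
-- of level `i + 1`, and these places coincide in the concatenation. Area zero has no such partner,
-- so there the sign of the label remains visible.
reading-neg : ∀ K m v M → m ≢ 0ℤ → ∣ m ∣ < K → reading K ((- m , - v) ∷ M) ≡ reading K ((m , v) ∷ M)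
reading-neg K m v M ne lt = trans (shifted (- m) (- v) (subst (_< K) (sym (ℤₚ.∣-i∣≡∣i∣ m)) lt)) (trans
  (cong₂ _++_ (trans (null (- m) (- v) (λ eq → ne (ℤₚ.neg-injective eq))) (sym (null m v ne)))
    (concat-applyUpTo-cong (λ i → cong (λ ys → concatMap (sel⁻ i) M ++ concatMap (sel⁺ i) (reverse M) ++ ys) (swap i)) K))
  (sym (shifted m v lt)))
  where
  open ≡-Reasoning
  null : ∀ m v → m ≢ 0ℤ → sel⁻ 0 (m , v) ≡ []
  null m v ne rewrite ==-false ne = refl
  shifted : ∀ m v → ∣ m ∣ < K → reading K ((m , v) ∷ M) ≡
    sel⁻ 0 (m , v) ++ concat (applyUpTo (λ i → concatMap (sel⁻ i) M ++ concatMap (sel⁺ i) (reverse M) ++ sel⁺ i (m , v) ++ sel⁻ (suc i) (m , v)) K)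
  shifted m v lt = begin
    reading K (x ∷ M)
      ≡⟨ reading-∷ K x M ⟩
    concat (applyUpTo (λ i → (sel⁻ i x ++ A i) ++ (B i ++ sel⁺ i x)) K)
      ≡⟨ concat-applyUpTo-cong (λ i → Lₚ.++-assoc (sel⁻ i x) (A i) _) K ⟩
    concat (applyUpTo (λ i → sel⁻ i x ++ (A i ++ B i ++ sel⁺ i x)) K)
      ≡⟨ Lₚ.++-identityʳ _ ⟨
    concat (applyUpTo (λ i → sel⁻ i x ++ (A i ++ B i ++ sel⁺ i x)) K) ++ []
      ≡⟨ cong (concat (applyUpTo (λ i → sel⁻ i x ++ (A i ++ B i ++ sel⁺ i x)) K) ++_) (sym (sel⁻-bounded {K} {m} {v} lt)) ⟩
    concat (applyUpTo (λ i → sel⁻ i x ++ (A i ++ B i ++ sel⁺ i x)) K) ++ sel⁻ K x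
      ≡⟨ concat-shift (λ i → sel⁻ i x) (λ i → A i ++ B i ++ sel⁺ i x) K ⟩
    sel⁻ 0 x ++ concat (applyUpTo (λ i → (A i ++ B i ++ sel⁺ i x) ++ sel⁻ (suc i) x) K)
      ≡⟨ cong (sel⁻ 0 x ++_) (concat-applyUpTo-cong (λ i → trans (Lₚ.++-assoc (A i) _ _) (cong (A i ++_) (Lₚ.++-assoc (B i) _ _))) K) ⟩
    sel⁻ 0 x ++ concat (applyUpTo (λ i → A i ++ B i ++ sel⁺ i x ++ sel⁻ (suc i) x) K) ∎
    where
    x = m , v
    A = λ i → concatMap (sel⁻ i) M
    B = λ i → concatMap (sel⁺ i) (reverse M)
  swap : ∀ i → sel⁺ i (- m , - v) ++ sel⁻ (suc i) (- m , - v) ≡ sel⁺ i (m , v) ++ sel⁻ (suc i) (m , v)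
  swap i rewrite ==-cong { - m} {+ suc i} {m} { - + suc i}
                   (λ eq → trans (sym (ℤₚ.neg-involutive m)) (cong -_ eq)) (λ eq → cong -_ eq)
               | ==-neg m (+ suc i) | ℤₚ.neg-involutive v
    with m ℤ.≟ - + suc i | m ℤ.≟ + suc i
  ... | no _ | no _ = refl
  ... | no _ | yes _ = refl
  ... | yes _ | no _ = refl
  ... | yes refl | yes ()

readLabel : Row → ℤ
readLabel (m , v) = if isPos m then - v else v

concat-single : {A : Set} (f : ℕ → List A) → ∀ {y} i K → i < K → f i ≡ y ∷ [] → (∀ j → j ≢ i → f j ≡ []) → concat (applyUpTo f K) ≡ y ∷ []
concat-single f zero (suc K) lt hit miss = cong₂ _++_ hit (allNull (f ∘ suc) K (λ j → miss (suc j) (λ ())))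
  where
  allNull : {A : Set} (f : ℕ → List A) → ∀ K → (∀ j → f j ≡ []) → concat (applyUpTo f K) ≡ []
  allNull f zero h = refl
  allNull f (suc K) h = cong₂ _++_ (h 0) (allNull (f ∘ suc) K (h ∘ suc))
concat-single f (suc i) (suc K) (s≤s lt) hit miss =
  cong₂ _++_ (miss 0 (λ ())) (concat-single (f ∘ suc) i K lt hit (λ j ne → miss (suc j) (ne ∘ ℕₚ.suc-injective)))

sel-single : ∀ K m v → ∣ m ∣ < K → concat (applyUpTo (λ i → sel⁻ i (m , v) ++ sel⁺ i (m , v)) K) ≡ readLabel (m , v) ∷ []
sel-single K (+ zero) v lt = concat-single _ 0 K lt refl (λ { zero ne → ⊥-elim (ne refl) ; (suc j) _ → refl })
sel-single K (+ suc m) v lt = concat-single _ m K (ℕₚ.<⇒≤ lt) (hit m) miss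
  where
  neg-miss : ∀ i → sel⁻ i (+ suc m , v) ≡ []
  neg-miss i rewrite ==-false {+ suc m} { - (+ i)} (λ eq → ℤₚ.<⇒≢ (ℤₚ.≤-<-trans (neg+≤0 i) (ℤ.+<+ (s≤s z≤n))) (sym eq)) = refl
  hit : ∀ i → sel⁻ i (+ suc m , v) ++ sel⁺ i (+ suc i , v) ≡ - v ∷ []
  hit i rewrite neg-miss i | ==-true {+ suc i} refl = refl
  miss : ∀ j → j ≢ m → sel⁻ j (+ suc m , v) ++ sel⁺ j (+ suc m , v) ≡ []
  miss j ne rewrite neg-miss j | ==-false {+ suc m} {+ suc j} (λ eq → ne (ℕₚ.suc-injective (sym (ℤₚ.+-injective eq)))) = refl
sel-single K -[1+ m ] v lt = concat-single _ (suc m) K lt hit miss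
  where
  hit : sel⁻ (suc m) (-[1+ m ] , v) ++ sel⁺ (suc m) (-[1+ m ] , v) ≡ v ∷ []
  hit rewrite ==-true { -[1+ m ]} refl = refl
  miss : ∀ j → j ≢ suc m → sel⁻ j (-[1+ m ] , v) ++ sel⁺ j (-[1+ m ] , v) ≡ []
  miss j ne rewrite ==-false { -[1+ m ]} { - + j} (λ eq → ne (sym (ℤₚ.+-injective (ℤₚ.neg-injective { + suc m} {+ j} eq)))) = refl

-- The first row can contribute at either end of a level; this separates its contributions `a` and
-- `d` from those of the other rows.
concat-interleave : {A : Set} (a b c d : ℕ → List A) → ∀ K →
  concat (applyUpTo (λ i → (a i ++ b i) ++ (c i ++ d i)) K) ↭
  concat (applyUpTo (λ i → a i ++ d i) K) ++ concat (applyUpTo (λ i → b i ++ c i) K)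
concat-interleave a b c d zero = ↭-refl
concat-interleave a b c d (suc K) = begin
  ((a 0 ++ b 0) ++ (c 0 ++ d 0)) ++ rest
    ↭⟨ ++⁺ (begin
         (a 0 ++ b 0) ++ (c 0 ++ d 0)   ≡⟨ Lₚ.++-assoc (a 0) (b 0) _ ⟩
         a 0 ++ b 0 ++ c 0 ++ d 0       ≡⟨ cong (a 0 ++_) (Lₚ.++-assoc (b 0) (c 0) (d 0)) ⟨
         a 0 ++ (b 0 ++ c 0) ++ d 0     ↭⟨ ++⁺ˡ (a 0) (++-comm (b 0 ++ c 0) (d 0)) ⟩
         a 0 ++ d 0 ++ (b 0 ++ c 0)     ≡⟨ Lₚ.++-assoc (a 0) (d 0) _ ⟨
         (a 0 ++ d 0) ++ (b 0 ++ c 0)   ∎) (concat-interleave (a ∘ suc) (b ∘ suc) (c ∘ suc) (d ∘ suc) K) ⟩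
  ((a 0 ++ d 0) ++ (b 0 ++ c 0)) ++ (AD ++ BC)
    ≡⟨ Lₚ.++-assoc (a 0 ++ d 0) (b 0 ++ c 0) _ ⟩
  (a 0 ++ d 0) ++ (b 0 ++ c 0) ++ AD ++ BC
    ≡⟨ cong ((a 0 ++ d 0) ++_) (Lₚ.++-assoc (b 0 ++ c 0) AD BC) ⟨
  (a 0 ++ d 0) ++ ((b 0 ++ c 0) ++ AD) ++ BC
    ↭⟨ ++⁺ˡ (a 0 ++ d 0) (++⁺ (++-comm (b 0 ++ c 0) AD) (↭-refl {x = BC})) ⟩
  (a 0 ++ d 0) ++ (AD ++ (b 0 ++ c 0)) ++ BC
    ≡⟨ cong ((a 0 ++ d 0) ++_) (Lₚ.++-assoc AD (b 0 ++ c 0) BC) ⟩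
  (a 0 ++ d 0) ++ AD ++ (b 0 ++ c 0) ++ BC
    ≡⟨ Lₚ.++-assoc (a 0 ++ d 0) AD _ ⟨
  ((a 0 ++ d 0) ++ AD) ++ (b 0 ++ c 0) ++ BC ∎
  where
  open Perm.PermutationReasoning
  rest = concat (applyUpTo (λ i → (a (suc i) ++ b (suc i)) ++ (c (suc i) ++ d (suc i))) K)
  AD = concat (applyUpTo (λ i → a (suc i) ++ d (suc i)) K)
  BC = concat (applyUpTo (λ i → b (suc i) ++ c (suc i)) K)

reading-↭ : ∀ K L → Bounded K (map proj₁ L) → reading K L ↭ map readLabel L
reading-↭ K [] [] = ↭-reflexive (empty K)
  where
  empty : ∀ K → reading K [] ≡ []
  empty zero = refl
  empty (suc K) = empty K
reading-↭ K (x ∷ M) (px ∷ b) = begin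
  reading K (x ∷ M)
    ≡⟨ reading-∷ K x M ⟩
  concat (applyUpTo (λ i → (sel⁻ i x ++ concatMap (sel⁻ i) M) ++ (concatMap (sel⁺ i) (reverse M) ++ sel⁺ i x)) K)
    ↭⟨ concat-interleave (λ i → sel⁻ i x) (λ i → concatMap (sel⁻ i) M) (λ i → concatMap (sel⁺ i) (reverse M)) (λ i → sel⁺ i x) K ⟩
  concat (applyUpTo (λ i → sel⁻ i x ++ sel⁺ i x) K) ++ reading K M
    ≡⟨ cong (_++ reading K M) (sel-single K (proj₁ x) (proj₂ x) px) ⟩
  readLabel x ∷ reading K M
    <⟨ reading-↭ K M b ⟩
  map readLabel (x ∷ M) ∎
  where open Perm.PermutationReasoning

-- The word stops at level `2 n - 1` and the reading at the sum of the absolute areas. Levels beyond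
-- all entries are empty, so one common bound can replace both.
reading-stable : ∀ {K} L → Bounded K (map proj₁ L) → ∀ j → reading (K ℕ.+ j) L ≡ reading K L
reading-stable {K} L b j = trans (cong (λ k → reading k L) (ℕₚ.+-comm K j)) (go j)
  where
  bound : ∀ j → Bounded (j ℕ.+ K) (map proj₁ L)
  bound j = All.map (λ lt → ℕₚ.<-≤-trans lt (ℕₚ.m≤n+m K j)) b
  go : ∀ j → reading (j ℕ.+ K) L ≡ reading K L
  go zero = refl
  go (suc j) = begin
    concat (applyUpTo f (suc (j ℕ.+ K)))               ≡⟨ cong concat (Lₚ.applyUpTo-∷ʳ f (j ℕ.+ K)) ⟨
    concat (applyUpTo f (j ℕ.+ K) ∷ʳ f (j ℕ.+ K))      ≡⟨ concat-∷ʳ (applyUpTo f (j ℕ.+ K)) _ ⟩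
    reading (j ℕ.+ K) L ++ f (j ℕ.+ K)                 ≡⟨ cong₂ _++_ (go j) (cong₂ _++_
         (concatMap-null (sel⁻ (j ℕ.+ K)) (All.map (λ {x} lt → sel⁻-bounded {j ℕ.+ K} {proj₁ x} {proj₂ x} lt) (Allₚ.map⁻ (bound j))))
         (concatMap-null (sel⁺ (j ℕ.+ K)) (All-reverse (All.map (λ {x} lt → sel⁺-bounded x lt) (Allₚ.map⁻ (bound j)))))) ⟩
    reading K L ++ []                                  ≡⟨ Lₚ.++-identityʳ _ ⟩
    reading K L ∎
    where
    open ≡-Reasoning
    f = λ i → concatMap (sel⁻ i) L ++ concatMap (sel⁺ i) (reverse L)
    sel⁺-bounded : ∀ {K} x → ∣ proj₁ x ∣ < K → sel⁺ K x ≡ []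
    sel⁺-bounded {K} (m , v) lt rewrite ==-false {m} {+ suc K} (λ { refl → ℕₚ.<-asym lt (ℕₚ.n<1+n _) }) = refl

-- Sign products, and the local functions behind rises and East counts

signBit : Bool → ℤ
signBit b = if b then 1ℤ else -1ℤ

signProduct-↭ : ∀ {xs ys} → xs ↭ ys → signProduct xs ≡ signProduct ys
signProduct-↭ Perm.refl = refl
signProduct-↭ (Perm.prep x p) = cong (sgn x ℤ.*_) (signProduct-↭ p)
signProduct-↭ (Perm.swap {xs} {ys} x y p) =
  trans (cong (λ z → sgn x ℤ.* (sgn y ℤ.* z)) (signProduct-↭ p))
    (solve 3 (λ a b c → a :* (b :* c) := b :* (a :* c)) refl (sgn x) (sgn y) (signProduct ys))
  where open +-*-Solver
signProduct-↭ (Perm.trans p q) = trans (signProduct-↭ p) (signProduct-↭ q)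

isEven-suc : ∀ k → isEven (suc k) ≡ not (isEven k)
isEven-suc zero = refl
isEven-suc (suc zero) = refl
isEven-suc (suc (suc k)) = isEven-suc k

signBit-not : ∀ b → signBit (not b) ≡ - signBit b
signBit-not true = refl
signBit-not false = refl

sgn-neg : ∀ v → sgn (- v) ≡ - sgn v
sgn-neg (+ zero) = refl
sgn-neg (+ suc v) = refl
sgn-neg -[1+ v ] = refl

signProduct-nonzero : ∀ {w} → All (λ x → x ≢ 0ℤ) w → signProduct w ≡ signBit (isEven (countᵇ isNeg w))
signProduct-nonzero [] = refl
signProduct-nonzero {+ zero ∷ w} (nz ∷ _) = ⊥-elim (nz refl)
signProduct-nonzero {+ suc x ∷ w} (_ ∷ h) = trans (ℤₚ.*-identityˡ (signProduct w)) (signProduct-nonzero h)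
signProduct-nonzero { -[1+ x ] ∷ w} (_ ∷ h) =
  trans (ℤₚ.-1*i≡-i (signProduct w)) (trans (cong -_ (signProduct-nonzero h))
    (trans (sym (signBit-not (isEven (countᵇ isNeg w)))) (cong signBit (sym (isEven-suc (countᵇ isNeg w))))))

signProduct-readLabel : ∀ L → signProduct (map readLabel L) ≡ signBit (isEven (countᵇ isPos (map proj₁ L))) ℤ.* signProduct (map proj₂ L)
signProduct-readLabel [] = refl
signProduct-readLabel ((m , v) ∷ L) with isPos m
... | false = trans (cong (sgn v ℤ.*_) (signProduct-readLabel L))
  (solve 3 (λ a b c → a :* (b :* c) := b :* (a :* c)) refl (sgn v) (signBit (isEven (countᵇ isPos (map proj₁ L)))) (signProduct (map proj₂ L)))
  where open +-*-Solver
... | true = trans (cong₂ ℤ._*_ (sgn-neg v) (signProduct-readLabel L))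
  (trans (solve 3 (λ a b c → (:- a) :* (b :* c) := (:- b) :* (a :* c)) refl (sgn v) (signBit (isEven (countᵇ isPos (map proj₁ L)))) (signProduct (map proj₂ L)))
    (cong (ℤ._* (sgn v ℤ.* signProduct (map proj₂ L))) (trans (sym (signBit-not (isEven (countᵇ isPos (map proj₁ L)))))
      (cong signBit (sym (isEven-suc (countᵇ isPos (map proj₁ L))))))))
  where open +-*-Solver

abs-readLabel : ∀ L → map ∣_∣ (map readLabel L) ≡ map ∣_∣ (map proj₂ L)
abs-readLabel [] = refl
abs-readLabel ((m , v) ∷ L) with isPos m
... | false = cong (∣ v ∣ ∷_) (abs-readLabel L)
... | true = cong₂ _∷_ (ℤₚ.∣-i∣≡∣i∣ v) (abs-readLabel L)

mutual
  -- Here the metavariable stands for the local function of `eastsBefore`; generalising its start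
  -- value `zero` lets the equation below determine it.
  eastsFrom : ℕ → List Step → List ℕ
  eastsFrom = _

  eastsFrom-solve : ∀ p → eastsBefore p ≡ eastsFrom 0 p
  eastsFrom-solve p with zero
  ... | e = refl

mutual
  risesFrom : ℕ → List Step → List ℕ
  risesFrom = _

  risesFrom-solve : ∀ p → rises p ≡ risesFrom 0 p
  risesFrom-solve p with zero
  ... | m = refl

eastsFrom-unsign : ∀ e p → eastsFrom e (map unsign p) ≡ eastsFrom e p
eastsFrom-unsign e [] = refl
eastsFrom-unsign e (N ∷ p) = cong (e ∷_) (eastsFrom-unsign e p)
eastsFrom-unsign e (E ∷ p) = eastsFrom-unsign (suc e) p
eastsFrom-unsign e (E⁺ ∷ p) = eastsFrom-unsign (suc e) p
eastsFrom-unsign e (E⁻ ∷ p) = eastsFrom-unsign (suc e) p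

risesFrom-unsign : ∀ m p → risesFrom m (map unsign p) ≡ risesFrom m p
risesFrom-unsign m [] = refl
risesFrom-unsign m (N ∷ []) = refl
risesFrom-unsign m (N ∷ N ∷ p) = cong (suc m ∷_) (risesFrom-unsign (suc m) (N ∷ p))
risesFrom-unsign m (N ∷ E ∷ p) = risesFrom-unsign (suc m) (E ∷ p)
risesFrom-unsign m (N ∷ E⁺ ∷ p) = risesFrom-unsign (suc m) (E⁺ ∷ p)
risesFrom-unsign m (N ∷ E⁻ ∷ p) = risesFrom-unsign (suc m) (E⁻ ∷ p)
risesFrom-unsign m (E ∷ p) = risesFrom-unsign m p
risesFrom-unsign m (E⁺ ∷ p) = risesFrom-unsign m p
risesFrom-unsign m (E⁻ ∷ p) = risesFrom-unsign m p

-- Lattice paths as weakly increasing sequences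

Ascending : ℕ → ℕ → List ℕ → Set
Ascending M e [] = e ≤ M
Ascending M e (x ∷ xs) = e ≤ x × Ascending M x xs

Ascending-weaken : ∀ {M e e′} xs → e ≤ e′ → Ascending M e′ xs → Ascending M e xs
Ascending-weaken [] le h = ℕₚ.≤-trans le h
Ascending-weaken (x ∷ xs) le (h , hs) = ℕₚ.≤-trans le h , hs

Ascending-top : ∀ {M e} xs → Ascending M e xs → e ≤ M
Ascending-top [] h = h
Ascending-top (x ∷ xs) (le , h) = ℕₚ.≤-trans le (Ascending-top xs h)

Ascending-≤ : ∀ {M e} xs → Ascending M e xs → All (_≤ M) xs
Ascending-≤ [] h = []
Ascending-≤ (x ∷ xs) (le , h) = Ascending-top xs h ∷ Ascending-≤ xs h

eastsFrom-ascending : ∀ {M} e {p} → All Plain p → countE p ℕ.+ e ≡ M → Ascending M e (eastsFrom e p)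
eastsFrom-ascending e [] refl = ℕₚ.≤-refl
eastsFrom-ascending e (inj₁ refl ∷ pl) eq = ℕₚ.≤-refl , eastsFrom-ascending e pl eq
eastsFrom-ascending e {E ∷ p} (inj₂ refl ∷ pl) eq =
  Ascending-weaken (eastsFrom (suc e) p) (ℕₚ.n≤1+n e) (eastsFrom-ascending (suc e) pl (trans (ℕₚ.+-suc (countE p) e) eq))

length-eastsFrom : ∀ e {p} → All Plain p → length (eastsFrom e p) ≡ countN p
length-eastsFrom e [] = refl
length-eastsFrom e (inj₁ refl ∷ pl) = cong suc (length-eastsFrom e pl)
length-eastsFrom e (inj₂ refl ∷ pl) = length-eastsFrom (suc e) pl

pathOf : ℕ → ℕ → List ℕ → List Step
pathOf M e [] = replicate (M ℕ.∸ e) E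
pathOf M e (x ∷ xs) = replicate (x ℕ.∸ e) E ++ N ∷ pathOf M x xs

pathOf-E : ∀ {M e} xs → Ascending M (suc e) xs → pathOf M e xs ≡ E ∷ pathOf M (suc e) xs
pathOf-E {suc M} {e} [] (s≤s le) rewrite ℕₚ.+-∸-assoc 1 le = refl
pathOf-E {M} {e} (suc x ∷ xs) (s≤s le , _) rewrite ℕₚ.+-∸-assoc 1 le = refl

pathOf-eastsFrom : ∀ {M} e {p} → All Plain p → countE p ℕ.+ e ≡ M → pathOf M e (eastsFrom e p) ≡ p
pathOf-eastsFrom e [] refl = cong (λ k → replicate k E) (ℕₚ.n∸n≡0 e)
pathOf-eastsFrom {M} e {N ∷ p} (inj₁ refl ∷ pl) eq rewrite ℕₚ.n∸n≡0 e = cong (N ∷_) (pathOf-eastsFrom e pl eq)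
pathOf-eastsFrom {M} e {E ∷ p} (inj₂ refl ∷ pl) eq =
  trans (pathOf-E (eastsFrom (suc e) p) (eastsFrom-ascending (suc e) pl eq′)) (cong (E ∷_) (pathOf-eastsFrom (suc e) pl eq′))
  where
  eq′ : countE p ℕ.+ suc e ≡ M
  eq′ = trans (ℕₚ.+-suc (countE p) e) eq

eastsFrom-E : ∀ k e p → eastsFrom e (replicate k E ++ p) ≡ eastsFrom (k ℕ.+ e) p
eastsFrom-E zero e p = refl
eastsFrom-E (suc k) e p = trans (eastsFrom-E k (suc e) p) (cong (λ x → eastsFrom x p) (ℕₚ.+-suc k e))

eastsFrom-pathOf : ∀ {M} e xs → Ascending M e xs → eastsFrom e (pathOf M e xs) ≡ xs
eastsFrom-pathOf {M} e [] h = trans (cong (eastsFrom e) (sym (Lₚ.++-identityʳ (replicate (M ℕ.∸ e) E)))) (eastsFrom-E (M ℕ.∸ e) e [])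
eastsFrom-pathOf {M} e (x ∷ xs) (le , h) =
  trans (eastsFrom-E (x ℕ.∸ e) e (N ∷ pathOf M x xs))
    (trans (cong (λ k → k ∷ eastsFrom k (pathOf M x xs)) (ℕₚ.m∸n+n≡m le)) (cong (x ∷_) (eastsFrom-pathOf x xs h)))

pathOf-plain : ∀ M e xs → All Plain (pathOf M e xs)
pathOf-plain M e [] = Allₚ.replicate⁺ (M ℕ.∸ e) (inj₂ refl)
pathOf-plain M e (x ∷ xs) = Allₚ.++⁺ (Allₚ.replicate⁺ (x ℕ.∸ e) (inj₂ refl)) (inj₁ refl ∷ pathOf-plain M x xs)

countE-replicate : ∀ k → countE (replicate k E) ≡ k
countE-replicate zero = refl
countE-replicate (suc k) = cong suc (countE-replicate k)

countE-pathOf : ∀ {M} e xs → Ascending M e xs → countE (pathOf M e xs) ≡ M ℕ.∸ e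
countE-pathOf {M} e [] h = countE-replicate (M ℕ.∸ e)
countE-pathOf {M} e (x ∷ xs) (le , h) = begin
  countE (replicate (x ℕ.∸ e) E ++ N ∷ pathOf M x xs)
    ≡⟨ countᵇ-++ isEast (replicate (x ℕ.∸ e) E) _ ⟩
  countE (replicate (x ℕ.∸ e) E) ℕ.+ countE (pathOf M x xs)
    ≡⟨ cong₂ ℕ._+_ (countE-replicate (x ℕ.∸ e)) (countE-pathOf x xs h) ⟩
  (x ℕ.∸ e) ℕ.+ (M ℕ.∸ x)
    ≡⟨ ℕₚ.+-comm (x ℕ.∸ e) _ ⟩
  (M ℕ.∸ x) ℕ.+ (x ℕ.∸ e)
    ≡⟨ ℕₚ.+-∸-assoc (M ℕ.∸ x) le ⟨
  ((M ℕ.∸ x) ℕ.+ x) ℕ.∸ e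
    ≡⟨ cong (ℕ._∸ e) (ℕₚ.m∸n+n≡m (Ascending-top xs h)) ⟩
  M ℕ.∸ e ∎
  where open ≡-Reasoning

Rise : ℕ × ℤ → ℕ × ℤ → Set
Rise (x , u) (y , w) = x ≡ y → u ℤ.< w

zipped : List ℕ → List ℤ → List (ℕ × ℤ)
zipped (x ∷ xs) (u ∷ us) = (x , u) ∷ zipped xs us
zipped _ _ = []

Rise-vacuous : ∀ {M e u} xs us → Ascending M (suc e) xs → Linked Rise (zipped xs us) → Linked Rise ((e , u) ∷ zipped xs us)
Rise-vacuous [] us asc lk = tt
Rise-vacuous (x ∷ xs) [] asc lk = tt
Rise-vacuous (x ∷ xs) (u ∷ us) (le , _) lk = (λ { refl → ⊥-elim (ℕₚ.1+n≰n le) }) , lk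

Linked-tail : ∀ {e u} xs us → Linked Rise ((e , u) ∷ zipped xs us) → Linked Rise (zipped xs us)
Linked-tail [] us lk = tt
Linked-tail (x ∷ xs) [] lk = tt
Linked-tail (x ∷ xs) (u ∷ us) (_ , lk) = lk

module _ {v : List ℤ} where
  private
    Q : ℕ → Set
    Q i = at v i ℤ.< at v (suc i)

    at-second : ∀ pre {u w vs} → at (pre ++ u ∷ w ∷ vs) (suc (suc (length pre))) ≡ w
    at-second [] = refl
    at-second (x ∷ pre) = at-second pre

    shift : ∀ pre {u us} → v ≡ pre ++ u ∷ us → v ≡ (pre ∷ʳ u) ++ us
    shift pre eq = trans eq (sym (Lₚ.++-assoc pre _ _))

    length-shift : ∀ pre {u : ℤ} → length (pre ∷ʳ u) ≡ suc (length pre)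
    length-shift pre = trans (Lₚ.length-++ pre) (ℕₚ.+-comm (length pre) 1)

  risesFrom⇒Rise : ∀ e {p} pre vs → All Plain p → v ≡ pre ++ vs → length vs ≡ length (eastsFrom e p) →
    All Q (risesFrom (length pre) p) → Linked Rise (zipped (eastsFrom e p) vs)
  risesFrom⇒Rise e pre vs [] eq len a = tt
  risesFrom⇒Rise e {_ ∷ []} pre (u ∷ []) (inj₁ refl ∷ []) eq len a = tt
  risesFrom⇒Rise e {_ ∷ _ ∷ p} pre (u ∷ w ∷ vs) (inj₁ refl ∷ pl@(inj₁ refl ∷ _)) eq len (q ∷ a) =
    (λ _ → subst₂ ℤ._<_ (trans (cong (λ v → at v (suc (length pre))) eq) (at-++-suc pre))
                        (trans (cong (λ v → at v (suc (suc (length pre)))) eq) (at-second pre)) q) ,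
    risesFrom⇒Rise e (pre ∷ʳ u) (w ∷ vs) pl (shift pre eq) (ℕₚ.suc-injective len)
      (subst (λ m → All Q (risesFrom m (N ∷ p))) (sym (length-shift pre)) a)
  risesFrom⇒Rise e {_ ∷ _ ∷ p} pre (u ∷ vs) (inj₁ refl ∷ pl@(inj₂ refl ∷ pl′)) eq len a =
    Rise-vacuous (eastsFrom (suc e) p) vs (eastsFrom-ascending (suc e) pl′ refl)
      (risesFrom⇒Rise e (pre ∷ʳ u) vs pl (shift pre eq) (ℕₚ.suc-injective len)
        (subst (λ m → All Q (risesFrom m (E ∷ p))) (sym (length-shift pre)) a))
  risesFrom⇒Rise e {_ ∷ []} pre (u ∷ w ∷ vs) (inj₁ refl ∷ []) eq ()
  risesFrom⇒Rise e {_ ∷ _} pre [] (inj₁ refl ∷ _) eq ()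
  risesFrom⇒Rise e {_ ∷ _ ∷ p} pre (u ∷ []) (inj₁ refl ∷ inj₁ refl ∷ _) eq ()
  risesFrom⇒Rise e pre vs (inj₂ refl ∷ pl) eq len a = risesFrom⇒Rise (suc e) pre vs pl eq len a

  Rise⇒risesFrom : ∀ e {p} pre vs → All Plain p → v ≡ pre ++ vs → length vs ≡ length (eastsFrom e p) →
    Linked Rise (zipped (eastsFrom e p) vs) → All Q (risesFrom (length pre) p)
  Rise⇒risesFrom e pre vs [] eq len lk = []
  Rise⇒risesFrom e {_ ∷ []} pre (u ∷ []) (inj₁ refl ∷ []) eq len lk = []
  Rise⇒risesFrom e {_ ∷ _ ∷ p} pre (u ∷ w ∷ vs) (inj₁ refl ∷ pl@(inj₁ refl ∷ _)) eq len (r , lk) =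
    subst₂ ℤ._<_ (sym (trans (cong (λ v → at v (suc (length pre))) eq) (at-++-suc pre)))
                 (sym (trans (cong (λ v → at v (suc (suc (length pre)))) eq) (at-second pre))) (r refl) ∷
    subst (λ m → All Q (risesFrom m (N ∷ p))) (length-shift pre)
      (Rise⇒risesFrom e (pre ∷ʳ u) (w ∷ vs) pl (shift pre eq) (ℕₚ.suc-injective len) lk)
  Rise⇒risesFrom e {_ ∷ _ ∷ p} pre (u ∷ vs) (inj₁ refl ∷ pl@(inj₂ refl ∷ _)) eq len lk =
    subst (λ m → All Q (risesFrom m (E ∷ p))) (length-shift pre)
      (Rise⇒risesFrom e (pre ∷ʳ u) vs pl (shift pre eq) (ℕₚ.suc-injective len) (Linked-tail (eastsFrom (suc e) p) vs lk))
  Rise⇒risesFrom e {_ ∷ []} pre (u ∷ w ∷ vs) (inj₁ refl ∷ []) eq ()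
  Rise⇒risesFrom e {_ ∷ _} pre [] (inj₁ refl ∷ _) eq ()
  Rise⇒risesFrom e {_ ∷ _ ∷ p} pre (u ∷ []) (inj₁ refl ∷ inj₁ refl ∷ _) eq ()
  Rise⇒risesFrom e pre vs (inj₂ refl ∷ pl) eq len lk = Rise⇒risesFrom (suc e) pre vs pl eq len lk

setFirst : Step → List Step → List Step
setFirst s (E ∷ p) = s ∷ p
setFirst s p = p

FirstSigned-split : ∀ p → FirstSigned p → ∃ λ s → Sign s × p ≡ setFirst s (map unsign p)
FirstSigned-split [] _ = E⁺ , plus , refl
FirstSigned-split (N ∷ p) pl = E⁺ , plus , cong (N ∷_) (sym (plain-unsign pl))
FirstSigned-split (E⁺ ∷ p) pl = E⁺ , plus , cong (E⁺ ∷_) (sym (plain-unsign pl))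
FirstSigned-split (E⁻ ∷ p) pl = E⁻ , minus , cong (E⁻ ∷_) (sym (plain-unsign pl))

FirstSigned-setFirst : ∀ {s p} → Sign s → All Plain p → FirstSigned (setFirst s p)
FirstSigned-setFirst sg [] = tt
FirstSigned-setFirst sg (inj₁ refl ∷ pl) = pl
FirstSigned-setFirst plus (inj₂ refl ∷ pl) = pl
FirstSigned-setFirst minus (inj₂ refl ∷ pl) = pl

unsign-setFirst : ∀ {s p} → Sign s → All Plain p → map unsign (setFirst s p) ≡ p
unsign-setFirst sg [] = refl
unsign-setFirst sg (inj₁ refl ∷ pl) = cong (N ∷_) (plain-unsign pl)
unsign-setFirst plus (inj₂ refl ∷ pl) = cong (E ∷_) (plain-unsign pl)
unsign-setFirst minus (inj₂ refl ∷ pl) = cong (E ∷_) (plain-unsign pl)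

ε-setFirst : ∀ {s p} → Sign s → All Plain p → ε (setFirst s p) ≡ (if headEast p then signOf s else 1ℤ)
ε-setFirst sg [] = refl
ε-setFirst sg (inj₁ refl ∷ pl) = ε-plain pl
ε-setFirst plus (inj₂ refl ∷ pl) = ε-plain pl
ε-setFirst minus (inj₂ refl ∷ pl) = refl

headEast-easts : ∀ {p x xs} → All Plain p → eastsFrom 0 p ≡ x ∷ xs → headEast p ≡ not (+ x ==ℤ 0ℤ)
headEast-easts (inj₁ refl ∷ pl) refl = refl
headEast-easts {E ∷ p} {x} {xs} (inj₂ refl ∷ pl) eq = sym (cong not (==-false {+ x} {0ℤ} λ { refl → absurd (subst (Ascending _ 1) eq (eastsFrom-ascending 1 pl refl)) }))
  where
  absurd : ∀ {M} → Ascending M 1 (0 ∷ xs) → ⊥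
  absurd (() , _)

startsNN-easts : ∀ {p x y xs} → All Plain p → eastsFrom 0 p ≡ x ∷ y ∷ xs → startsNN p ≡ true → x ≡ 0 × y ≡ 0
startsNN-easts {N ∷ N ∷ _} pl refl _ = refl , refl

easts-startsNN : ∀ {p xs} → All Plain p → eastsFrom 0 p ≡ 0 ∷ 0 ∷ xs → startsNN p ≡ true
easts-startsNN {N ∷ N ∷ p} pl eq = refl
easts-startsNN {N ∷ E ∷ p} (_ ∷ _ ∷ pl) eq = ⊥-elim (absurd (subst (Ascending _ 1) (Lₚ.∷-injectiveʳ eq) (eastsFrom-ascending 1 pl refl)))
  where
  absurd : ∀ {M xs} → Ascending M 1 (0 ∷ xs) → ⊥
  absurd (() , _)
easts-startsNN {N ∷ []} pl ()
easts-startsNN {E ∷ p} (_ ∷ pl) eq = ⊥-elim (absurd (subst (Ascending _ 1) eq (eastsFrom-ascending 1 pl refl)))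
  where
  absurd : ∀ {M xs} → Ascending M 1 (0 ∷ xs) → ⊥
  absurd (() , _)
easts-startsNN {N ∷ E⁺ ∷ p} (_ ∷ inj₁ () ∷ _)
easts-startsNN {N ∷ E⁺ ∷ p} (_ ∷ inj₂ () ∷ _)
easts-startsNN {N ∷ E⁻ ∷ p} (_ ∷ inj₁ () ∷ _)
easts-startsNN {N ∷ E⁻ ∷ p} (_ ∷ inj₂ () ∷ _)
easts-startsNN {E⁺ ∷ p} (inj₁ () ∷ _)
easts-startsNN {E⁺ ∷ p} (inj₂ () ∷ _)
easts-startsNN {E⁻ ∷ p} (inj₁ () ∷ _)
easts-startsNN {E⁻ ∷ p} (inj₂ () ∷ _)

startsNN-unsign : ∀ p → startsNN (map unsign p) ≡ startsNN p
startsNN-unsign [] = refl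
startsNN-unsign (N ∷ []) = refl
startsNN-unsign (N ∷ N ∷ p) = refl
startsNN-unsign (N ∷ E ∷ p) = refl
startsNN-unsign (N ∷ E⁺ ∷ p) = refl
startsNN-unsign (N ∷ E⁻ ∷ p) = refl
startsNN-unsign (E ∷ p) = refl
startsNN-unsign (E⁺ ∷ p) = refl
startsNN-unsign (E⁻ ∷ p) = refl

-- The area vector of a lattice path

rowsFrom : ℕ → List ℕ → List ℤ → List Row
rowsFrom k (x ∷ xs) (u ∷ us) = (+ x ℤ.- + k , u) ∷ rowsFrom (suc k) xs us
rowsFrom k _ _ = []

xnor : Bool → Bool → Bool
xnor b c = if b then c else not c

negateUnless reflectUnless : Bool → Row → Row
negateUnless b (m , v) = if b then (m , v) else (- m , - v)
reflectUnless b (m , v) = if b then (m , v) else (reflect m , - v)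

mutual
  adjustRow : ℕ → List Step → List ℤ → ℕ × ℤ → ℤ
  adjustRow = _

  flipHead : Bool → List ℤ → List ℤ
  flipHead b [] = []
  flipHead b (x ∷ xs) = (if b then x else - x) ∷ xs

  dD-adjustRow : ∀ n p v → dD n p v ≡ flipHead (isEven (countᵇ isPos (muVec n p))) (map (adjustRow n p v) (readingRaw n p v))
  dD-adjustRow n p v with readingRaw n p v
  ... | [] = refl
  ... | x ∷ l = refl

adjustRow-neg : ∀ n p v j x → adjustRow n p v (j , - x) ≡ - adjustRow n p v (j , x)
adjustRow-neg n p v j x with j ℕ.≡ᵇ n | j ℕ.≡ᵇ 1
... | true | _ = sym (ℤₚ.neg-distribʳ-* (negOnePow (1ℤ ℤ.+ mu n p (n ℕ.∸ 1) ℤ.+ mu n p n)) x)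
... | false | true = sym (ℤₚ.neg-distribʳ-* (ε p ℤ.* negOnePow (1ℤ ℤ.+ nu n (n ℕ.∸ 1) ℤ.+ nu n n)) x)
... | false | false = refl

-- The signs that `dD` gives to the entries of rows 1 and `n` are attached to the labels before
-- reading. This is harmless because they commute with the negation of labels in positive rows.
rowOf : ℕ → List Step → List ℤ → ℕ → Row
rowOf n p v j = mu n p j , adjustRow n p v (j , at v j)

actualRows : ℕ → List Step → List ℤ → List Row
actualRows n p v = map (rowOf n p v) (range1 n)

actualRows-mu : ∀ n p v → map proj₁ (actualRows n p v) ≡ muVec n p
actualRows-mu n p v = sym (Lₚ.map-∘ (range1 n))

select : (ℕ → ℤ) → (ℕ → ℤ) → ℤ → List ℕ → List (ℕ × ℤ)
select m f z js = concat (map (λ j → if m j ==ℤ z then (j , f j) ∷ [] else []) js)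

select-map : ∀ (m f : ℕ → ℤ) (g : ℕ × ℤ → ℤ) (h : Row → List ℤ) (R : ℕ → Row) z →
  (∀ j → h (R j) ≡ (if m j ==ℤ z then g (j , f j) ∷ [] else [])) → ∀ js →
  map g (select m f z js) ≡ concatMap h (map R js)
select-map m f g h R z eq [] = refl
select-map m f g h R z eq (j ∷ js) =
  trans (Lₚ.map-++ g (if m j ==ℤ z then (j , f j) ∷ [] else []) (select m f z js))
    (cong₂ _++_ (trans (one (m j ==ℤ z)) (sym (eq j))) (select-map m f g h R z eq js))
  where
  one : ∀ b → map g (if b then (j , f j) ∷ [] else []) ≡ (if b then g (j , f j) ∷ [] else [])
  one true = refl
  one false = refl

readingRaw-rows : ∀ n p v → map (adjustRow n p v) (readingRaw n p v) ≡ reading (suc (sumℕ (map ∣_∣ (muVec n p)))) (actualRows n p v)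
readingRaw-rows n p v =
  trans (sym (Lₚ.concat-map (map _ (upTo K))))
    (trans (cong concat (trans (sym (Lₚ.map-∘ (upTo K))) (Lₚ.map-cong level (upTo K)))) (cong concat (Lₚ.map-upTo _ K)))
  where
  K = suc (sumℕ (map ∣_∣ (muVec n p)))
  L = actualRows n p v
  g = adjustRow n p v
  level : ∀ i → map g (select (mu n p) (at v) (- + i) (range1 n) ++ select (mu n p) (λ j → - at v j) (+ suc i) (reverse (range1 n)))
    ≡ concatMap (sel⁻ i) L ++ concatMap (sel⁺ i) (reverse L)
  level i = trans (Lₚ.map-++ g (select (mu n p) (at v) (- + i) (range1 n)) _) (cong₂ _++_
    (select-map (mu n p) (at v) g (sel⁻ i) (rowOf n p v) (- + i) (λ j → refl) (range1 n))
    (trans (select-map (mu n p) (λ j → - at v j) g (sel⁺ i) (rowOf n p v) (+ suc i)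
              (λ j → cong (λ y → if mu n p j ==ℤ + suc i then y ∷ [] else []) (sym (adjustRow-neg n p v j (at v j)))) (reverse (range1 n)))
           (cong (concatMap (sel⁺ i)) (Lₚ.reverse-map (rowOf n p v) (range1 n)))))

isEven-double : ∀ k → isEven (k ℕ.+ k) ≡ true
isEven-double zero = refl
isEven-double (suc k) rewrite ℕₚ.+-suc k k = isEven-double k

negOnePow-double : ∀ z → negOnePow (z ℤ.+ z) ≡ 1ℤ
negOnePow-double (+ k) rewrite isEven-double k = refl
negOnePow-double -[1+ k ] rewrite isEven-double k = refl

negOnePow-1+double : ∀ z → negOnePow (1ℤ ℤ.+ (z ℤ.+ z)) ≡ -1ℤ
negOnePow-1+double (+ k) rewrite isEven-suc (k ℕ.+ k) | isEven-double k = refl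
negOnePow-1+double -[1+ k ] rewrite isEven-suc (k ℕ.+ k) | isEven-double k = refl

≡ᵇ-refl : ∀ k → (k ℕ.≡ᵇ k) ≡ true
≡ᵇ-refl zero = refl
≡ᵇ-refl (suc k) = ≡ᵇ-refl k

≡ᵇ-< : ∀ {j k} → j < k → (j ℕ.≡ᵇ k) ≡ false
≡ᵇ-< {zero} (s≤s _) = refl
≡ᵇ-< {suc j} (s≤s lt) = ≡ᵇ-< lt

atD-++ : ∀ {A : Set} {z : A} xs {y ys} → atD z (xs ++ y ∷ ys) (suc (length xs)) ≡ y
atD-++ [] = refl
atD-++ (x ∷ xs) = atD-++ xs

applyUpTo-rows : ∀ k x xs {ys u} us {ws} → length xs ≡ length us →
  applyUpTo (λ j → + atD 0 (x ∷ xs ++ ys) (suc (suc j)) ℤ.- + (k ℕ.+ j) , at (u ∷ us ++ ws) (suc (suc j))) (length xs) ≡ rowsFrom k xs us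
applyUpTo-rows k x [] [] len = refl
applyUpTo-rows k x (y ∷ xs) {ys} (u ∷ us) {ws} len = cong₂ _∷_ (cong (λ i → + y ℤ.- + i , u) (ℕₚ.+-identityʳ k))
  (trans (applyUpTo-congᵖ (λ j → cong (λ i → + atD 0 (y ∷ xs ++ ys) (suc (suc j)) ℤ.- + i , at (u ∷ us ++ ws) (suc (suc j))) (ℕₚ.+-suc k j)) (length xs))
    (applyUpTo-rows (suc k) y xs {ys} {u} us {ws} (ℕₚ.suc-injective len)))
  where
  applyUpTo-congᵖ : {A : Set} {f g : ℕ → A} → (∀ j → f j ≡ g j) → ∀ m → applyUpTo f m ≡ applyUpTo g m
  applyUpTo-congᵖ h zero = refl
  applyUpTo-congᵖ h (suc m) = cong₂ _∷_ (h 0) (applyUpTo-congᵖ (h ∘ suc) m)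

applyUpTo-cong-< : {A : Set} {f g : ℕ → A} → ∀ m → (∀ j → j < m → f j ≡ g j) → applyUpTo f m ≡ applyUpTo g m
applyUpTo-cong-< zero h = refl
applyUpTo-cong-< (suc m) h = cong₂ _∷_ (h 0 (s≤s z≤n)) (applyUpTo-cong-< m (λ j lt → h (suc j) (s≤s lt)))

-- 2 π_n − π_{n−1} − (n−1) for n = r + 3, π_{n−1} = c and π_n = d.
lastArea : ℕ → ℕ → ℕ → ℤ
lastArea r c d = (+ (2 ℕ.* d) ℤ.- + c) ℤ.- + (suc (suc r))

signParity : ℕ → List Step → Bool
signParity n p = isEven (sumℕ (map (piAt p) (range1 (n ℕ.∸ 2))))

plusBit : List Step → Bool
plusBit p = countᵇ isE⁻ p ℕ.≡ᵇ 0

-- Row 1 and the last two rows are treated separately in the formulas for λ, μ and the signs. With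
-- `n = r + 3` they are distinct, and both the East counts and the labels are split accordingly.
module ActualRows (p : List Step) (a₁ : ℕ) (as : List ℕ) (c d : ℕ) (v₁ : ℤ) (vs : List ℤ) (u w : ℤ)
  (eqa : eastsBefore p ≡ a₁ ∷ as ++ c ∷ d ∷ []) (len : length as ≡ length vs) where

  r n : ℕ
  r = length as
  n = suc (suc (suc r))
  v : List ℤ
  v = v₁ ∷ vs ++ u ∷ w ∷ []
  x03 s₀ ε₀ : Bool
  x03 = case03 n
  s₀ = signParity n p
  ε₀ = plusBit p

  private
    snoc-easts : a₁ ∷ as ++ c ∷ d ∷ [] ≡ a₁ ∷ (as ∷ʳ c) ++ d ∷ []
    snoc-easts = cong (a₁ ∷_) (sym (Lₚ.++-assoc as (c ∷ []) (d ∷ [])))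
    snoc-v : v ≡ v₁ ∷ (vs ∷ʳ u) ++ w ∷ []
    snoc-v = cong (v₁ ∷_) (sym (Lₚ.++-assoc vs (u ∷ []) (w ∷ [])))
    len-as : length (as ∷ʳ c) ≡ suc r
    len-as = trans (Lₚ.length-++ as) (ℕₚ.+-comm r 1)
    len-vs : length (vs ∷ʳ u) ≡ suc r
    len-vs = trans (Lₚ.length-++ vs) (trans (ℕₚ.+-comm (length vs) 1) (cong suc (sym len)))

    pi-first : piAt p 1 ≡ a₁
    pi-first = cong (λ l → atD 0 l 1) eqa
    pi-mid : piAt p (suc (suc r)) ≡ c
    pi-mid = trans (cong (λ l → atD 0 l (suc (suc r))) eqa) (atD-++ (a₁ ∷ as))
    pi-last : piAt p n ≡ d
    pi-last = trans (cong (λ l → atD 0 l n) (trans eqa snoc-easts))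
      (trans (cong (λ k → atD 0 (a₁ ∷ (as ∷ʳ c) ++ d ∷ []) (suc (suc k))) (sym len-as)) (atD-++ (a₁ ∷ (as ∷ʳ c))))
    at-last : at v n ≡ w
    at-last = trans (cong₂ (λ l k → at l (suc (suc k))) snoc-v (sym len-vs)) (atD-++ (v₁ ∷ (vs ∷ʳ u)))

    D C R : ℤ
    D = + (2 ℕ.* d)
    C = + c
    R = + (suc (suc r))

    odd-2n : + (2 ℕ.* n ℕ.∸ 1) ≡ (1ℤ ℤ.+ R) ℤ.+ R
    odd-2n = trans (cong (λ k → + (suc (suc r) ℕ.+ k)) (ℕₚ.+-identityʳ n)) (cong +_ (ℕₚ.+-comm (suc (suc r)) n))

    lamN-eq : lamN n p ≡ (if s₀ then D ℤ.- C else ((1ℤ ℤ.+ R) ℤ.+ R) ℤ.- D ℤ.+ C)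
    lamN-eq rewrite pi-last | pi-mid | odd-2n = refl

    lam-last : lam n p n ≡ (if s₀ then D ℤ.- C else ((1ℤ ℤ.+ R) ℤ.+ R) ℤ.- D ℤ.+ C)
    lam-last rewrite ≡ᵇ-refl r = lamN-eq

    lam-mid : ∀ {j} → j < suc r → lam n p (suc (suc j)) ≡ + piAt p (suc (suc j))
    lam-mid lt rewrite ≡ᵇ-< lt = refl

  mu-mid : ∀ {j} → j < suc r → mu n p (suc (suc j)) ≡ + piAt p (suc (suc j)) ℤ.- + suc j
  mu-mid {j} lt with case03 n
  ... | true = cong (ℤ._- + suc j) (lam-mid lt)
  ... | false rewrite ≡ᵇ-< lt = refl

  private
    reflectIf : Bool → ℤ → ℤ
    reflectIf t m = if t then m else reflect m

    -- Passing from λ to 2n - 1 - λ, and from λ - (n - 1) to n - λ, both act on the area as m ↦ 1 -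
    -- m. The parity case and the case modulo 4 therefore cancel when they occur together.
    mu-last : mu n p n ≡ reflectIf (xnor x03 s₀) (lastArea r c d)
    mu-last with case03 n
    ... | true rewrite lam-last with s₀
    ...   | true = refl
    ...   | false = solve 3 (λ D C R → (((con 1ℤ :+ R) :+ R) :- D :+ C) :- R := con 1ℤ :- ((D :- C) :- R)) refl D C R
      where open +-*-Solver
    mu-last | false rewrite ≡ᵇ-refl r | lamN-eq with s₀
    ...   | true = solve 3 (λ D C R → (con 1ℤ :+ R) :- (D :- C) := con 1ℤ :- ((D :- C) :- R)) refl D C R
      where open +-*-Solver
    ...   | false = solve 3 (λ D C R → (con 1ℤ :+ R) :- (((con 1ℤ :+ R) :+ R) :- D :+ C) := (D :- C) :- R) refl D C R
      where open +-*-Solver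

    mu-before : mu n p (suc (suc r)) ≡ C ℤ.- + suc r
    mu-before = trans (mu-mid (ℕₚ.n<1+n r)) (cong (λ k → + k ℤ.- + suc r) pi-mid)

    d+d : D ≡ + d ℤ.+ + d
    d+d = cong (λ k → + (d ℕ.+ k)) (ℕₚ.+-identityʳ d)

    -- Without reflection μ_{n-1} + μ_n = 2 π_n - (2n - 3) is odd, and m ↦ 1 - m changes the parity.
    -- So the label of the last row is negated exactly when its area is reflected, as the symmetry
    -- requires.
    last-multiplier : negOnePow (1ℤ ℤ.+ mu n p (suc (suc r)) ℤ.+ mu n p n) ≡ signBit (xnor x03 s₀)
    last-multiplier rewrite mu-before | mu-last with xnor x03 s₀
    ... | true = trans (cong negOnePow (trans (cong (λ D → 1ℤ ℤ.+ (C ℤ.- + suc r) ℤ.+ ((D ℤ.- C) ℤ.- R)) d+d)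
        (solve 3 (λ d C r → con 1ℤ :+ (C :- r) :+ (((d :+ d) :- C) :- (con 1ℤ :+ r)) := (d :- r) :+ (d :- r)) refl (+ d) C (+ suc r))))
        (negOnePow-double (+ d ℤ.- + suc r))
      where open +-*-Solver
    ... | false = trans (cong negOnePow (trans (cong (λ D → 1ℤ ℤ.+ (C ℤ.- + suc r) ℤ.+ reflect ((D ℤ.- C) ℤ.- R)) d+d)
        (solve 3 (λ d C r → con 1ℤ :+ (C :- r) :+ (con 1ℤ :- (((d :+ d) :- C) :- (con 1ℤ :+ r))) := con 1ℤ :+ (((C :- d) :+ con 1ℤ) :+ ((C :- d) :+ con 1ℤ))) refl (+ d) C (+ suc r))))
        (negOnePow-1+double ((C ℤ.- + d) ℤ.+ 1ℤ))
      where open +-*-Solver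

    -- The exponent is 2n - 2 or 2n - 1, so this is the sign with which λ_1 enters μ_1: area and
    -- label of the first row change sign together.
    nu-multiplier : negOnePow (1ℤ ℤ.+ nu n (suc (suc r)) ℤ.+ nu n n) ≡ signBit x03
    nu-multiplier rewrite ≡ᵇ-< (ℕₚ.n<1+n r) | ≡ᵇ-refl r with case03 n
    ... | true rewrite isEven-double (suc (suc r)) = refl
    ... | false rewrite ℕₚ.+-suc r (suc (suc r)) | isEven-suc (r ℕ.+ suc (suc r)) | ℕₚ.+-suc r (suc r) | ℕₚ.+-suc r r | isEven-double r = refl

    signBit-* : ∀ b x → signBit b ℤ.* x ≡ (if b then x else - x)
    signBit-* true x = ℤₚ.*-identityˡ x
    signBit-* false x = ℤₚ.-1*i≡-i x

    first-row : rowOf n p v 1 ≡ negateUnless (xnor ε₀ x03) (+ a₁ , v₁)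
    first-row rewrite nu-multiplier | pi-first with case03 n | countᵇ isE⁻ p ℕ.≡ᵇ 0
    ... | true | true = cong₂ _,_ (ℤₚ.*-identityˡ (+ a₁)) (ℤₚ.*-identityˡ v₁)
    ... | true | false = cong₂ _,_ (ℤₚ.-1*i≡-i (+ a₁)) (ℤₚ.-1*i≡-i v₁)
    ... | false | true = cong₂ _,_ (cong -_ (ℤₚ.*-identityˡ (+ a₁))) (ℤₚ.-1*i≡-i v₁)
    ... | false | false = cong₂ _,_ (trans (cong -_ (ℤₚ.-1*i≡-i (+ a₁))) (ℤₚ.neg-involutive (+ a₁))) (ℤₚ.*-identityˡ v₁)

    last-row : rowOf n p v n ≡ reflectUnless (xnor x03 s₀) (lastArea r c d , w)
    last-row = trans (cong₂ _,_ mu-last label) (pair (xnor x03 s₀))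
      where
      label : adjustRow n p v (n , at v n) ≡ (if xnor x03 s₀ then w else - w)
      label = trans (cong (λ b → if b then negOnePow (1ℤ ℤ.+ mu n p (suc (suc r)) ℤ.+ mu n p n) ℤ.* at v n else at v n) (≡ᵇ-refl r))
        (trans (cong₂ ℤ._*_ last-multiplier at-last) (signBit-* (xnor x03 s₀) w))
      pair : ∀ b → (reflectIf b (lastArea r c d) , (if b then w else - w)) ≡ reflectUnless b (lastArea r c d , w)
      pair true = refl
      pair false = refl

    mid-row : ∀ j → j < suc r → rowOf n p v (suc (suc j)) ≡
      (+ atD 0 (a₁ ∷ (as ∷ʳ c) ++ d ∷ []) (suc (suc j)) ℤ.- + suc j , at (v₁ ∷ (vs ∷ʳ u) ++ w ∷ []) (suc (suc j)))
    mid-row j lt = cong₂ _,_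
      (trans (mu-mid lt) (cong (λ l → + atD 0 l (suc (suc j)) ℤ.- + suc j) (trans eqa snoc-easts)))
      (trans (label (≡ᵇ-< lt)) (cong (λ l → at l (suc (suc j))) snoc-v))
      where
      label : (j ℕ.≡ᵇ suc r) ≡ false → adjustRow n p v (suc (suc j) , at v (suc (suc j))) ≡ at v (suc (suc j))
      label eq rewrite eq = refl

  actualRows-eq : actualRows n p v ≡
    negateUnless (xnor ε₀ x03) (+ a₁ , v₁) ∷ rowsFrom 1 (as ∷ʳ c) (vs ∷ʳ u) ∷ʳ reflectUnless (xnor x03 s₀) (lastArea r c d , w)
  actualRows-eq = begin
    map (rowOf n p v) (map suc (upTo n))
      ≡⟨ Lₚ.map-∘ (upTo n) ⟨
    map (rowOf n p v ∘ suc) (upTo n)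
      ≡⟨ Lₚ.map-upTo (rowOf n p v ∘ suc) n ⟩
    rowOf n p v 1 ∷ applyUpTo (λ j → rowOf n p v (suc (suc j))) (suc (suc r))
      ≡⟨ cong₂ _∷_ first-row (sym (Lₚ.applyUpTo-∷ʳ (λ j → rowOf n p v (suc (suc j))) (suc r))) ⟩
    negateUnless (xnor ε₀ x03) (+ a₁ , v₁) ∷ (applyUpTo (λ j → rowOf n p v (suc (suc j))) (suc r) ∷ʳ rowOf n p v n)
      ≡⟨ cong (negateUnless (xnor ε₀ x03) (+ a₁ , v₁) ∷_) (cong₂ _∷ʳ_ mids last-row) ⟩
    negateUnless (xnor ε₀ x03) (+ a₁ , v₁) ∷ rowsFrom 1 (as ∷ʳ c) (vs ∷ʳ u) ∷ʳ reflectUnless (xnor x03 s₀) (lastArea r c d , w) ∎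
    where
    open ≡-Reasoning
    mids : applyUpTo (λ j → rowOf n p v (suc (suc j))) (suc r) ≡ rowsFrom 1 (as ∷ʳ c) (vs ∷ʳ u)
    mids = trans (applyUpTo-cong-< (suc r) mid-row) (trans (cong (applyUpTo _) (sym len-as))
      (applyUpTo-rows 1 a₁ (as ∷ʳ c) {d ∷ []} {v₁} (vs ∷ʳ u) {w ∷ []} (trans len-as (sym len-vs))))

  -- The sum of the last two λ's is 2 π_n, or 2n - 1 - 2 π_n + 2 π_{n-1} after the parity
  -- correction, so its parity only records which formula is in force.
  vertSign : negOnePow (lam n p (n ℕ.∸ 1) ℤ.+ lam n p n) ≡ signBit s₀
  vertSign rewrite lam-mid (ℕₚ.n<1+n r) | lam-last | pi-mid with s₀
  ... | true = trans (cong negOnePow (trans (cong (λ D → C ℤ.+ (D ℤ.- C)) d+d) (solve 2 (λ d C → C :+ ((d :+ d) :- C) := d :+ d) refl (+ d) C))) (negOnePow-double (+ d))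
    where open +-*-Solver
  ... | false = trans (cong negOnePow (trans (cong (λ D → C ℤ.+ (((1ℤ ℤ.+ R) ℤ.+ R) ℤ.- D ℤ.+ C)) d+d)
      (solve 3 (λ d C R → C :+ (((con 1ℤ :+ R) :+ R) :- (d :+ d) :+ C) := con 1ℤ :+ (((R :- d) :+ C) :+ ((R :- d) :+ C))) refl (+ d) C R)))
      (negOnePow-1+double ((R ℤ.- + d) ℤ.+ C))
    where open +-*-Solver

-- The entry λ_n = 2 d − c and its mirror image 2 M + 1 − λ_n; the one not exceeding M is e.
data Fold (M c : ℕ) : ℕ → ℤ → ℕ → ℤ → Set where
  low  : ∀ {w} k j → M ≡ c ℕ.+ (k ℕ.+ k) ℕ.+ j → Fold M c (c ℕ.+ k) w (c ℕ.+ (k ℕ.+ k)) w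
  high : ∀ {w} k j → M ≡ c ℕ.+ suc (k ℕ.+ k) ℕ.+ j → Fold M c (c ℕ.+ suc k ℕ.+ j) w (c ℕ.+ suc (k ℕ.+ k)) (- w)

fold : ∀ {M c d} w → c ≤ d → d ≤ M → ∃₂ λ e w′ → Fold M c d w e w′
fold {M} {c} {d} w c≤d d≤M = go (d ℕ.∸ c) (M ℕ.∸ d) (sym (ℕₚ.m+[n∸m]≡n c≤d)) (sym (ℕₚ.m+[n∸m]≡n d≤M))
  where
  open ℕSolver.+-*-Solver
  go : ∀ k t {d} → d ≡ c ℕ.+ k → M ≡ d ℕ.+ t → ∃₂ λ e w′ → Fold M c d w e w′
  -- The entry 2 d - c equals c + 2 k and `M` equals c + k + t, so it stays within `M` exactly if k
  -- ≤ t.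
  go k t refl refl with k ℕ.≤? t
  ... | yes k≤t = _ , _ , low k (t ℕ.∸ k) (trans (cong (λ t → c ℕ.+ k ℕ.+ t) (sym (ℕₚ.m+[n∸m]≡n k≤t)))
    (solve 3 (λ c k j → c :+ k :+ (k :+ j) := c :+ (k :+ k) :+ j) refl c k (t ℕ.∸ k)))
  ... | no k≰t with ℕₚ.m≤n⇒∃[o]m+o≡n (ℕₚ.≰⇒> k≰t)
  ... | j , refl = _ , _ , subst (λ d → Fold (c ℕ.+ suc (t ℕ.+ j) ℕ.+ t) c d w (c ℕ.+ suc (t ℕ.+ t)) (- w))
    (solve 3 (λ c t j → c :+ (con 1 :+ t) :+ j := c :+ (con 1 :+ (t :+ j))) refl c t j)
    (high t j (solve 3 (λ c t j → c :+ (con 1 :+ (t :+ j)) :+ t := c :+ (con 1 :+ (t :+ t)) :+ j) refl c t j))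

parity : ∀ s → ∃ λ k → (s ≡ k ℕ.+ k) ⊎ (s ≡ suc (k ℕ.+ k))
parity zero = 0 , inj₁ refl
parity (suc s) with parity s
... | k , inj₁ refl = k , inj₂ refl
... | k , inj₂ refl = suc k , inj₁ (cong suc (sym (ℕₚ.+-suc k k)))

-- The difference e - c is 2 k for an entry left alone and 2 k + 1 for a mirrored one, so its parity
-- selects the case.
unfold : ∀ {M c e} w′ → c ≤ e → e ≤ M → ∃₂ λ d w → Fold M c d w e w′
unfold {M} {c} {e} w′ c≤e e≤M with ℕₚ.m≤n⇒∃[o]m+o≡n c≤e | ℕₚ.m≤n⇒∃[o]m+o≡n e≤M
... | s , refl | j , refl with parity s
... | k , inj₁ refl = _ , _ , low k j refl
... | k , inj₂ refl = _ , _ , subst (λ x → Fold (c ℕ.+ suc (k ℕ.+ k) ℕ.+ j) c (c ℕ.+ suc k ℕ.+ j) (- w′) (c ℕ.+ suc (k ℕ.+ k)) x) (ℤₚ.neg-involutive w′) (high k j refl)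

double≢odd : ∀ k l → k ℕ.+ k ≢ suc (l ℕ.+ l)
double≢odd k l eq with trans (sym (isEven-double k)) (trans (cong isEven eq) (trans (isEven-suc (l ℕ.+ l)) (cong not (isEven-double l))))
... | ()

double-injective : ∀ k l → k ℕ.+ k ≡ l ℕ.+ l → k ≡ l
double-injective zero zero eq = refl
double-injective (suc k) (suc l) eq =
  cong suc (double-injective k l (ℕₚ.suc-injective (trans (sym (ℕₚ.+-suc k k)) (trans (ℕₚ.suc-injective eq) (ℕₚ.+-suc l l)))))

Fold-injective : ∀ {M c d d′ w w′ e e′ x x′} → Fold M c d w e x → Fold M c d′ w′ e′ x′ → e ≡ e′ → x ≡ x′ → d ≡ d′ × w ≡ w′
Fold-injective {c = c} (low k j _) (low l _ _) eq eq′ with double-injective k l (ℕₚ.+-cancelˡ-≡ c _ _ eq)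
... | refl = refl , eq′
Fold-injective {c = c} (low k j _) (high l _ _) eq eq′ = ⊥-elim (double≢odd k l (ℕₚ.+-cancelˡ-≡ c _ _ eq))
Fold-injective {c = c} (high k j _) (low l _ _) eq eq′ = ⊥-elim (double≢odd l k (sym (ℕₚ.+-cancelˡ-≡ c _ _ eq)))
Fold-injective {c = c} (high k j M≡) (high l j′ M≡′) eq eq′ with double-injective k l (ℕₚ.suc-injective (ℕₚ.+-cancelˡ-≡ c _ _ eq))
... | refl with ℕₚ.+-cancelˡ-≡ (c ℕ.+ suc (k ℕ.+ k)) j j′ (trans (sym M≡) M≡′)
... | refl = refl , ℤₚ.neg-injective eq′

Fold-≤ : ∀ {M c d w e x} → Fold M c d w e x → c ≤ d × d ≤ M × c ≤ e × e ≤ M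
Fold-≤ {c = c} (low k j refl) = ℕₚ.m≤m+n c k , ℕₚ.≤-trans (ℕₚ.+-monoʳ-≤ c (ℕₚ.m≤m+n k k)) (ℕₚ.m≤m+n _ j) , ℕₚ.m≤m+n c _ , ℕₚ.m≤m+n _ j
Fold-≤ {c = c} (high k j refl) = ℕₚ.≤-trans (ℕₚ.m≤m+n c _) (ℕₚ.m≤m+n _ j) ,
  ℕₚ.+-monoˡ-≤ j (ℕₚ.+-monoʳ-≤ c (s≤s (ℕₚ.m≤m+n k k))) , ℕₚ.m≤m+n c _ , ℕₚ.m≤m+n _ j

-- If k = 0 in the low case nothing has been changed. Otherwise both `d` and `e` exceed `c`, so
-- there is no rise at the last row before or after folding.
Fold-tight : ∀ {M c d w e x} → Fold M c d w e x → ∀ u → ((c ≡ d → u ℤ.< w) → c ≡ e → u ℤ.< x) × ((c ≡ e → u ℤ.< x) → c ≡ d → u ℤ.< w)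
Fold-tight {c = c} (low zero j _) u = id , id
Fold-tight {c = c} (low (suc k) j _) u = (λ _ eq → ⊥-elim (ℕₚ.m≢1+m+n c (trans eq (ℕₚ.+-suc c _)))) , (λ _ eq → ⊥-elim (ℕₚ.m≢1+m+n c (trans eq (ℕₚ.+-suc c _))))
Fold-tight {c = c} (high k j _) u = (λ _ eq → ⊥-elim (ℕₚ.m≢1+m+n c (trans eq (ℕₚ.+-suc c _)))) ,
  (λ _ eq → ⊥-elim (ℕₚ.m≢1+m+n c (trans eq (trans (ℕₚ.+-assoc c (suc k) j) (ℕₚ.+-suc c _)))))

Fold-gap : ∀ {M c d w e x} → Fold M c d w e x → ℕ
Fold-gap (low k j _) = j
Fold-gap (high k j _) = j

minus-sum : ∀ a j → + a ℤ.- + (a ℕ.+ j) ≡ - + j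
minus-sum a j = solve 2 (λ a j → a :- (a :+ j) := :- j) refl (+ a) (+ j)
  where open +-*-Solver

Fold-last : ∀ {r c d w e x} (f : Fold (suc (suc r)) c d w e x) t →
  reflectUnless t (lastArea r c d , w) ≡ (- + Fold-gap f , x) ⊎ reflectUnless t (lastArea r c d , w) ≡ (+ suc (Fold-gap f) , - x)
Fold-last {r} {c} {w = w} (low k j M≡) t = go t
  where
  area : lastArea r c (c ℕ.+ k) ≡ - + j
  area = trans (cong (λ M → (+ (2 ℕ.* (c ℕ.+ k)) ℤ.- + c) ℤ.- + M) M≡)
    (trans (cong (λ D → (+ (c ℕ.+ k ℕ.+ D) ℤ.- + c) ℤ.- + (c ℕ.+ (k ℕ.+ k) ℕ.+ j)) (ℕₚ.+-identityʳ (c ℕ.+ k)))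
      (solve 3 (λ c k j → ((c :+ k :+ (c :+ k)) :- c) :- (c :+ (k :+ k) :+ j) := :- j) refl (+ c) (+ k) (+ j)))
    where open +-*-Solver
  go : ∀ t → reflectUnless t (lastArea r c (c ℕ.+ k) , w) ≡ (- + j , w) ⊎ reflectUnless t (lastArea r c (c ℕ.+ k) , w) ≡ (+ suc j , - w)
  go true = inj₁ (cong (_, w) area)
  go false = inj₂ (cong (_, - w) (trans (cong reflect area) (reflect-neg j)))
Fold-last {r} {c} {w = w} (high k j M≡) t = go t
  where
  d = c ℕ.+ suc k ℕ.+ j
  area : lastArea r c d ≡ + suc j
  area = trans (cong (λ M → (+ (2 ℕ.* d) ℤ.- + c) ℤ.- + M) M≡)
    (trans (cong (λ D → (+ (d ℕ.+ D) ℤ.- + c) ℤ.- + (c ℕ.+ suc (k ℕ.+ k) ℕ.+ j)) (ℕₚ.+-identityʳ d))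
      (solve 3 (λ c k j → ((c :+ (con 1ℤ :+ k) :+ j :+ (c :+ (con 1ℤ :+ k) :+ j)) :- c) :- (c :+ (con 1ℤ :+ (k :+ k)) :+ j) := con 1ℤ :+ j) refl (+ c) (+ k) (+ j)))
    where open +-*-Solver
  go : ∀ t → reflectUnless t (lastArea r c d , w) ≡ (- + j , - w) ⊎ reflectUnless t (lastArea r c d , w) ≡ (+ suc j , - - w)
  go true = inj₂ (cong₂ _,_ area (sym (ℤₚ.neg-involutive w)))
  go false = inj₁ (cong (_, - w) (trans (cong reflect area) (reflect-suc j)))

Fold-area : ∀ {M c d w e x} (f : Fold M c d w e x) → + e ℤ.- + M ≡ - + Fold-gap f
Fold-area {c = c} (low k j refl) = minus-sum (c ℕ.+ (k ℕ.+ k)) j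
Fold-area {c = c} (high k j refl) = minus-sum (c ℕ.+ suc (k ℕ.+ k)) j

-- Weakly increasing sequences as area vectors in normal form

private
  shift-suc : ∀ y k → ℤ.suc (+ y ℤ.- + suc k) ≡ + y ℤ.- + k
  shift-suc y k = solve 2 (λ y k → con 1ℤ :+ (y :- (con 1ℤ :+ k)) := y :- k) refl (+ y) (+ k)
    where open +-*-Solver

  +-minus-cancel : ∀ {x y} k → + x ℤ.- + k ≡ + y ℤ.- + k → x ≡ y
  +-minus-cancel {x} {y} k eq = ℤₚ.+-injective (trans (restore x) (trans (cong (ℤ._+ + k) eq) (sym (restore y))))
    where
    restore : ∀ x → + x ≡ + x ℤ.- + k ℤ.+ + k
    restore x = solve 2 (λ x k → x := (x :- k) :+ k) refl (+ x) (+ k)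
      where open +-*-Solver

module _ {_◁_ : ℤ → ℤ → Set} where

  rows-Linked⁺ : ∀ {M e} k xs us → Ascending M e xs → Linked (λ (x , u) (y , w) → x ≡ y → u ◁ w) (zipped xs us) → Linked (Drop _◁_) (rowsFrom k xs us)
  rows-Linked⁺ k [] us asc lk = tt
  rows-Linked⁺ k (x ∷ xs) [] asc lk = tt
  rows-Linked⁺ k (x ∷ []) (u ∷ us) asc lk = tt
  rows-Linked⁺ k (x ∷ y ∷ xs) (u ∷ []) asc lk = tt
  rows-Linked⁺ k (x ∷ xs@(y ∷ _)) (u ∷ us@(w ∷ _)) (_ , asc@(x≤y , _)) (t , lk) =
    (ℤₚ.≤-trans (ℤₚ.+-monoˡ-≤ (- + k) (+≤+ x≤y)) (ℤₚ.≤-reflexive (sym (shift-suc y k))) ,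
     λ eq → t (+-minus-cancel k (trans eq (shift-suc y k)))) ,
    rows-Linked⁺ (suc k) xs us asc lk

  rows-Linked⁻ : ∀ k xs us → Linked (Drop _◁_) (rowsFrom k xs us) → Linked (λ (x , u) (y , w) → x ≡ y → u ◁ w) (zipped xs us)
  rows-Linked⁻ k [] us lk = tt
  rows-Linked⁻ k (x ∷ xs) [] lk = tt
  rows-Linked⁻ k (x ∷ []) (u ∷ us) lk = tt
  rows-Linked⁻ k (x ∷ y ∷ xs) (u ∷ []) lk = tt
  rows-Linked⁻ k (x ∷ xs@(y ∷ _)) (u ∷ us@(w ∷ _)) ((_ , t) , lk) =
    (λ { refl → t (sym (shift-suc y k)) }) , rows-Linked⁻ (suc k) xs us lk

Linked-Any : ∀ xs us → Linked (λ (x , u) (y , w) → x ≡ y → Any◁ u w) (zipped xs us)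
Linked-Any [] us = tt
Linked-Any (x ∷ xs) [] = tt
Linked-Any (x ∷ []) (u ∷ us) = tt
Linked-Any (x ∷ y ∷ xs) (u ∷ []) = tt
Linked-Any (x ∷ xs@(y ∷ _)) (u ∷ us@(w ∷ _)) = (λ _ → tt) , Linked-Any xs us

rows-end : ∀ {M e} k xs us → length xs ≡ length us → Ascending M e xs → k ℕ.+ length xs ≡ suc M → EndNonPos (rowsFrom k xs us)
rows-end k [] us len asc eq = tt
rows-end {M} k (x ∷ []) (u ∷ us) len (_ , x≤M) eq =
  ℤₚ.i≤j⇒i-j≤0 (+≤+ (ℕₚ.≤-trans x≤M (ℕₚ.≤-reflexive (sym (ℕₚ.suc-injective (trans (ℕₚ.+-comm 1 k) eq))))))
rows-end k (x ∷ xs@(_ ∷ _)) (u ∷ us@(_ ∷ _)) len (_ , asc) eq =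
  rows-end (suc k) xs us (ℕₚ.suc-injective len) asc (trans (sym (ℕₚ.+-suc k _)) eq)

rows-NF : ∀ {M} xs us → length xs ≡ length us → Ascending M 0 xs → length xs ≡ suc M → NF (rowsFrom 0 xs us)
rows-NF xs us len asc eq = rows-Linked⁺ 0 xs us asc (Linked-Any xs us) , rows-start xs us , rows-end 0 xs us len asc eq
  where
  rows-start : ∀ xs us → StartNonNeg (rowsFrom 0 xs us)
  rows-start [] us = tt
  rows-start (x ∷ xs) [] = tt
  rows-start (x ∷ xs) (u ∷ us) = +≤+ z≤n

rows-injective : ∀ k xs us xs′ us′ → length xs ≡ length us → length xs′ ≡ length us′ → rowsFrom k xs us ≡ rowsFrom k xs′ us′ → xs ≡ xs′ × us ≡ us′
rows-injective k [] [] [] [] _ _ _ = refl , refl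
rows-injective k [] [] (_ ∷ _) (_ ∷ _) _ _ ()
rows-injective k [] [] [] (_ ∷ _) _ () _
rows-injective k [] [] (_ ∷ _) [] _ () _
rows-injective k (_ ∷ _) (_ ∷ _) [] (_ ∷ _) _ () _
rows-injective k (_ ∷ _) (_ ∷ _) (_ ∷ _) [] _ () _
rows-injective k (_ ∷ _) (_ ∷ _) [] [] _ _ ()
rows-injective k (x ∷ xs) (u ∷ us) (x′ ∷ xs′) (u′ ∷ us′) len len′ eq with Lₚ.∷-injective eq
... | e , eq′ with rows-injective (suc k) xs us xs′ us′ (ℕₚ.suc-injective len) (ℕₚ.suc-injective len′) eq′
... | refl , refl = cong₂ _∷_ (+-minus-cancel k (cong proj₁ e)) refl , cong₂ _∷_ (cong proj₂ e) refl

-- The abscissa of a row is its area plus its index `k`. It weakly increases because the area drops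
-- by at most one per row; the start condition makes it natural, and `EndNonPos` bounds the last one
-- by `M`.
rows-surjective : ∀ {M} k e m v L → + e ℤ.- + k ℤ.≤ m → Linked (Drop Any◁) ((m , v) ∷ L) → EndNonPos ((m , v) ∷ L) → k ℕ.+ suc (length L) ≡ suc M →
  ∃₂ λ xs us → (m , v) ∷ L ≡ rowsFrom k xs us × Ascending M e xs × length xs ≡ length us
rows-surjective-from : ∀ {M} k e m v L x → m ≡ + x ℤ.- + k → e ≤ x → Linked (Drop Any◁) ((m , v) ∷ L) → EndNonPos ((m , v) ∷ L) → k ℕ.+ suc (length L) ≡ suc M →
  ∃₂ λ xs us → (m , v) ∷ L ≡ rowsFrom k xs us × Ascending M e xs × length xs ≡ length us

rows-surjective {M} k e m v L le lk end eq with natural e≤m+k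
  where
  open +-*-Solver
  e≤m+k : + e ℤ.≤ m ℤ.+ + k
  e≤m+k = ℤₚ.≤-trans (ℤₚ.≤-reflexive (solve 2 (λ e k → e := (e :- k) :+ k) refl (+ e) (+ k))) (ℤₚ.+-monoˡ-≤ (+ k) le)
  natural : ∀ {z} → + e ℤ.≤ z → ∃ λ x → z ≡ + x × e ≤ x
  natural (+≤+ le) = _ , refl , le
... | x , x≡ , e≤x = rows-surjective-from k e m v L x m≡ e≤x lk end eq
  where
  m≡ : m ≡ + x ℤ.- + k
  m≡ = trans (solve 2 (λ m k → m := (m :+ k) :- k) refl m (+ k)) (cong (ℤ._- + k) x≡)
    where open +-*-Solver

rows-surjective-from {M} k e m v [] x m≡ e≤x lk end eq = x ∷ [] , v ∷ [] , cong (λ m → (m , v) ∷ []) m≡ , (e≤x , x≤M) , refl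
  where
  x≤M : x ≤ M
  x≤M = ℕₚ.≤-trans (ℤₚ.drop‿+≤+ (ℤₚ.i-j≤0⇒i≤j (subst (ℤ._≤ 0ℤ) m≡ end))) (ℕₚ.≤-reflexive (ℕₚ.suc-injective (trans (ℕₚ.+-comm 1 k) eq)))
rows-surjective-from {M} k e m v ((m′ , v′) ∷ L) x m≡ e≤x ((le′ , _) , lk) end eq
  with rows-surjective {M} (suc k) x m′ v′ L next lk end (trans (sym (ℕₚ.+-suc k _)) eq)
  where
  next : + x ℤ.- + suc k ℤ.≤ m′
  next = subst₂ ℤ._≤_ (trans (cong ℤ.pred m≡) (solve 2 (λ x k → con -1ℤ :+ (x :- k) := x :- (con 1ℤ :+ k)) refl (+ x) (+ k))) (ℤₚ.pred-suc m′) (ℤₚ.pred-mono le′)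
    where open +-*-Solver
... | xs , us , eq′ , asc , len = x ∷ xs , v ∷ us , cong₂ _∷_ (cong (_, v) m≡) eq′ , (e≤x , asc) , cong suc len

rows-bounded : ∀ {M K} k xs us → All (_≤ M) xs → k ℕ.+ length xs ≤ suc M → M < K → Bounded K (map proj₁ (rowsFrom k xs us))
rows-bounded k [] us _ _ _ = []
rows-bounded k (x ∷ xs) [] _ _ _ = []
rows-bounded {M} {K} k (x ∷ xs) (u ∷ us) (x≤M ∷ h) le lt =
  ℕₚ.≤-<-trans (ℕₚ.≤-trans (ℕₚ.≤-reflexive (trans (cong ∣_∣ (ℤₚ.m-n≡m⊖n x k)) (ℤₚ.∣m⊖n∣≡∣n⊖m∣ x k))) (⊖-≤ k x (ℕₚ.≤-trans (ℕₚ.m≤m+n k _) (ℕ.s≤s⁻¹ (subst (_≤ suc M) (ℕₚ.+-suc k (length xs)) le))) x≤M)) lt ∷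
  rows-bounded (suc k) xs us h (subst (_≤ suc M) (ℕₚ.+-suc k _) le) lt
  where
  ⊖-≤ : ∀ a b {M} → a ≤ M → b ≤ M → ∣ a ℤ.⊖ b ∣ ≤ M
  ⊖-≤ a b a≤ b≤ with ℕₚ.≤-total b a
  ... | inj₁ b≤a = ℕₚ.≤-trans (ℕₚ.≤-reflexive (cong ∣_∣ (ℤₚ.⊖-≥ b≤a))) (ℕₚ.≤-trans (ℕₚ.m∸n≤m a b) a≤)
  ... | inj₂ a≤b = ℕₚ.≤-trans (ℕₚ.≤-reflexive (trans (cong ∣_∣ (ℤₚ.⊖-≤ a≤b)) (ℤₚ.∣-i∣≡∣i∣ (+ (b ℕ.∸ a))))) (ℕₚ.≤-trans (ℕₚ.m∸n≤m b a) b≤)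

Rise-replace-last : ∀ xs vs {c d e u w x} → length xs ≡ length vs → ((c ≡ d → u ℤ.< w) → c ≡ e → u ℤ.< x) →
  Linked Rise (zipped (xs ++ c ∷ d ∷ []) (vs ++ u ∷ w ∷ [])) → Linked Rise (zipped (xs ++ c ∷ e ∷ []) (vs ++ u ∷ x ∷ []))
Rise-replace-last [] [] len f (t , _) = f t , tt
Rise-replace-last (y ∷ []) (z ∷ []) len f (r , t , _) = r , f t , tt
Rise-replace-last (y ∷ xs@(_ ∷ _)) (z ∷ vs@(_ ∷ _)) len f (r , lk) = r , Rise-replace-last xs vs (ℕₚ.suc-injective len) f lk

rowsFrom-∷ʳ : ∀ k xs us {e x} → length xs ≡ length us → rowsFrom k (xs ∷ʳ e) (us ∷ʳ x) ≡ rowsFrom k xs us ∷ʳ (+ e ℤ.- + (k ℕ.+ length xs) , x)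
rowsFrom-∷ʳ k [] [] {e} {x} len = cong (λ i → (+ e ℤ.- + i , x) ∷ []) (sym (ℕₚ.+-identityʳ k))
rowsFrom-∷ʳ k (y ∷ xs) (u ∷ us) {e} {x} len = cong (_ ∷_) (trans (rowsFrom-∷ʳ (suc k) xs us (ℕₚ.suc-injective len))
  (cong (λ i → rowsFrom (suc k) xs us ∷ʳ (+ e ℤ.- + i , x)) (sym (ℕₚ.+-suc k (length xs)))))

proj₁-rows : ∀ k xs us us′ → length xs ≡ length us → length xs ≡ length us′ → map proj₁ (rowsFrom k xs us) ≡ map proj₁ (rowsFrom k xs us′)
proj₁-rows k [] us us′ _ _ = refl
proj₁-rows k (x ∷ xs) (u ∷ us) (u′ ∷ us′) l l′ = cong (_ ∷_) (proj₁-rows (suc k) xs us us′ (ℕₚ.suc-injective l) (ℕₚ.suc-injective l′))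

proj₂-rows : ∀ k xs us → length xs ≡ length us → map proj₂ (rowsFrom k xs us) ≡ us
proj₂-rows k [] [] _ = refl
proj₂-rows k (x ∷ xs) (u ∷ us) len = cong (u ∷_) (proj₂-rows (suc k) xs us (ℕₚ.suc-injective len))

length-rows : ∀ k xs us → length xs ≡ length us → length (rowsFrom k xs us) ≡ length us
length-rows k [] [] _ = refl
length-rows k (x ∷ xs) (u ∷ us) len = cong suc (length-rows (suc k) xs us (ℕₚ.suc-injective len))

-- Valley labels

scaleHead : ℤ → List ℤ → List ℤ
scaleHead s [] = []
scaleHead s (x ∷ xs) = s ℤ.* x ∷ xs

length-scaleHead : ∀ s w → length (scaleHead s w) ≡ length w
length-scaleHead s [] = refl
length-scaleHead s (x ∷ w) = refl

at-reverse : ∀ xs ys {j} → j < length xs → at (reverse xs ++ ys) (suc j) ≡ at xs (length xs ℕ.∸ j)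
at-reverse (x ∷ xs) ys {j} lt = trans (cong (λ l → at l (suc j)) shift) (go (ℕₚ.m≤n⇒m<n∨m≡n (ℕ.s≤s⁻¹ lt)))
  where
  shift : reverse (x ∷ xs) ++ ys ≡ reverse xs ++ x ∷ ys
  shift = trans (cong (_++ ys) (Lₚ.unfold-reverse x xs)) (Lₚ.++-assoc (reverse xs) _ ys)
  go : j < length xs ⊎ j ≡ length xs → at (reverse xs ++ x ∷ ys) (suc j) ≡ at (x ∷ xs) (suc (length xs) ℕ.∸ j)
  go (inj₁ lt′) with length xs ℕ.∸ j in eq | ℕₚ.m<n⇒0<n∸m lt′
  ... | suc k | _ = trans (at-reverse xs (x ∷ ys) lt′)
    (trans (cong (at xs) eq) (cong (at (x ∷ xs)) (sym (trans (ℕₚ.+-∸-assoc 1 (ℕₚ.<⇒≤ lt′)) (cong suc eq)))))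
  go (inj₂ refl) = trans (cong (λ k → at (reverse xs ++ x ∷ ys) (suc k)) (sym (Lₚ.length-reverse xs)))
    (trans (at-++-suc (reverse xs)) (cong (at (x ∷ xs)) (sym (ℕₚ.m+n∸n≡m 1 (length xs)))))

at-beyond : ∀ xs ys k → at (xs ++ ys) (suc (length xs ℕ.+ k)) ≡ at ys (suc k)
at-beyond [] ys k = refl
at-beyond (x ∷ xs) ys k = at-beyond xs ys k

at-take : ∀ a w {k} → k < a → at (map -_ (take a w)) (suc k) ≡ - at w (suc k)
at-take (suc a) [] lt = refl
at-take (suc a) (x ∷ w) {zero} lt = refl
at-take (suc a) (x ∷ w) {suc k} (s≤s lt) = at-take a w lt

-- valleyBound n b is boundBy n (ε b).
boundBy : ℕ → ℤ → List ℤ → ℕ → ℤ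
boundBy n s w j =
  if j ℕ.<ᵇ n then wAt w (+ (n ℕ.+ 1 ℕ.∸ j))
  else if j ℕ.≡ᵇ n then s ℤ.* at w 1
  else if j ℕ.≡ᵇ suc n then - (s ℤ.* at w 1)
  else wAt w (+ n ℤ.- + j)

<ᵇ-true : ∀ {j k} → j < k → (j ℕ.<ᵇ k) ≡ true
<ᵇ-true {j} {k} lt with j ℕ.<ᵇ k | ℕₚ.<⇒<ᵇ lt
... | true | _ = refl

<ᵇ-false : ∀ {j k} → k ≤ j → (j ℕ.<ᵇ k) ≡ false
<ᵇ-false {j} {k} le with j ℕ.<ᵇ k in eq
... | false = refl
... | true = ⊥-elim (ℕₚ.<⇒≱ (ℕₚ.<ᵇ⇒< j k (subst Bool.T (sym eq) tt)) le)

≡ᵇ-> : ∀ {j k} → k < j → (j ℕ.≡ᵇ k) ≡ false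
≡ᵇ-> {suc j} {zero} lt = refl
≡ᵇ-> {suc j} {suc k} (s≤s lt) = ≡ᵇ-> lt

module Bounds (x : ℤ) (w₀ : List ℤ) (a : ℕ) where
  private
    w = x ∷ w₀
    n = suc (length w₀)

  -- The index stays below `n`, so the label found is never `w(1)` and does not notice the factor
  -- `s`.
  child-label : ∀ s {i} → suc i < n → at w (n ℕ.+ 1 ℕ.∸ suc i) ≡ labelAt a (scaleHead s w) (suc i)
  child-label s {i} lt with length w₀ ℕ.∸ i in eq | ℕₚ.m<n⇒0<n∸m (ℕ.s≤s⁻¹ lt)
  ... | suc k | _ =
    trans (cong (at w) (trans (cong (ℕ._∸ suc i) (ℕₚ.+-comm n 1)) n∸i))
      (sym (trans (at-reverse (scaleHead s w) _ (ℕₚ.<⇒≤ lt)) (cong (at (scaleHead s w)) n∸i)))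
    where
    n∸i : n ℕ.∸ i ≡ suc (suc k)
    n∸i = trans (ℕₚ.+-∸-assoc 1 (ℕₚ.<⇒≤ (ℕ.s≤s⁻¹ lt))) (cong suc eq)

  -- Once `w(1)` is multiplied by `s`, the four cases of the bound merge: up to `n` they run through
  -- the reversed window, beyond `n` through the negated labels of the zeros.
  bound-label : ∀ s {j} → j < a ℕ.+ n → a ≤ n → boundBy n s w (suc j) ≡ labelAt a (scaleHead s w) (suc j)
  bound-label s {j} lt a≤n with ℕₚ.<-cmp (suc j) n
  ... | tri< lt′ _ _ rewrite <ᵇ-true lt′ = child-label s lt′
  ... | tri≈ _ refl _ rewrite <ᵇ-false (ℕₚ.≤-refl {n}) | ≡ᵇ-refl (length w₀) =
    sym (trans (at-reverse (scaleHead s w) _ ℕₚ.≤-refl) (cong (at (scaleHead s w)) (ℕₚ.m+n∸n≡m 1 (length w₀))))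
  ... | tri> _ _ gt with ℕₚ.m≤n⇒∃[o]m+o≡n (ℕ.s≤s⁻¹ gt)
  ... | k , refl rewrite <ᵇ-false (ℕₚ.<⇒≤ gt) | ≡ᵇ-> (ℕ.s≤s⁻¹ gt) = trans (go k k<a) (sym (trans (at-beyond′ k) (at-take a (scaleHead s w) k<a)))
    where
    k<a : k < a
    k<a = ℕₚ.+-cancelˡ-< n k a (subst (n ℕ.+ k <_) (ℕₚ.+-comm a n) lt)
    at-beyond′ : ∀ k → labelAt a (scaleHead s w) (suc (n ℕ.+ k)) ≡ at (map -_ (take a (scaleHead s w))) (suc k)
    at-beyond′ k = trans (cong (λ m → labelAt a (scaleHead s w) (suc (m ℕ.+ k))) (sym (Lₚ.length-reverse (scaleHead s w))))
      (at-beyond (reverse (scaleHead s w)) _ k)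
    go : ∀ k → k < a → (if length w₀ ℕ.+ k ℕ.≡ᵇ length w₀ then - (s ℤ.* x) else wAt w (+ n ℤ.- + suc (n ℕ.+ k))) ≡ - at (scaleHead s w) (suc k)
    go zero lt rewrite ℕₚ.+-identityʳ (length w₀) | ≡ᵇ-refl (length w₀) = refl
    go (suc k) lt rewrite ≡ᵇ-> (ℕₚ.m<m+n (length w₀) {suc k} (s≤s z≤n)) =
      trans (cong (wAt w) (trans (cong (λ m → + n ℤ.- + m) (sym (ℕₚ.+-suc n (suc k)))) (minus-sum n (suc (suc k))))) refl

ValleyBy : ℕ → ℤ → List ℤ → ℕ × ℕ → Set
ValleyBy n s w (i , j) = boundBy n s w j ℤ.< at w (n ℕ.+ 1 ℕ.∸ i)

module Translate (b : List Step) (w : List ℤ) (nonempty : w ≢ []) where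

  ρ : List Step
  ρ = N ∷ reverse (map unsign b)

  module _ (bal : Ballot ρ) (total : countN ρ ℕ.+ countE ρ ≡ length w ℕ.+ length w) where
    private
      n = length w
      a = countN ρ ℕ.∸ n
      e<N : countE ρ < countN ρ
      e<N = s≤s (Ballot-top (reverse (map unsign b)) (proj₂ bal))
      e<n : countE ρ < n
      e<n = ℕₚ.≰⇒> λ n≤e → ℕₚ.<-irrefl (sym total) (ℕₚ.+-mono-<-≤ (ℕₚ.≤-<-trans n≤e e<N) n≤e)
      n≤N : n ≤ countN ρ
      n≤N = ℕₚ.≮⇒≥ λ lt → ℕₚ.<-irrefl total (ℕₚ.+-mono-< lt e<n)
      a+n : a ℕ.+ n ≡ countN ρ
      a+n = ℕₚ.m∸n+n≡m n≤N
      a≤n : a ≤ n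
      a≤n = ℕₚ.+-cancelʳ-≤ n a n (ℕₚ.≤-trans (ℕₚ.≤-reflexive a+n) (ℕₚ.≤-trans (ℕₚ.m≤m+n _ (countE ρ)) (ℕₚ.≤-reflexive total)))

      same : ∀ s i j → i < countE ρ → j < countN ρ →
        boundBy n s w (suc j) ≡ labelAt a (scaleHead s w) (suc j) × at w (n ℕ.+ 1 ℕ.∸ suc i) ≡ labelAt a (scaleHead s w) (suc i)
      same s i j i< j< = go w nonempty refl
        where
        go : ∀ w′ → w′ ≢ [] → w′ ≡ w → boundBy n s w (suc j) ≡ labelAt a (scaleHead s w) (suc j) × at w (n ℕ.+ 1 ℕ.∸ suc i) ≡ labelAt a (scaleHead s w) (suc i)
        go [] ne _ = ⊥-elim (ne refl)
        go (x ∷ w₀) _ refl = Bounds.bound-label x w₀ a s (subst (j <_) (sym a+n) j<) a≤n , Bounds.child-label x w₀ a s (ℕₚ.≤-<-trans i< e<n)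

    valleys⇒labels : ∀ s → All (ValleyBy n s w) (valleys b) → Val (ValleyLess a (scaleHead s w)) ρ
    valleys⇒labels s h = Val-map ρ (λ i j i< j< lt → subst₂ ℤ._<_ (proj₁ (same s i j i< j<)) (proj₂ (same s i j i< j<)) lt) (valleys⇒Val b h)

    labels⇒valleys : ∀ s → Val (ValleyLess a (scaleHead s w)) ρ → All (ValleyBy n s w) (valleys b)
    labels⇒valleys s v = Val⇒valleys b (Val-map ρ (λ i j i< j< lt → subst₂ ℤ._<_ (sym (proj₁ (same s i j i< j<))) (sym (proj₂ (same s i j i< j<))) lt) v)

abs-< : ∀ {x c} → 1ℤ ℤ.* x ℤ.< c → -1ℤ ℤ.* x ℤ.< c → + ∣ x ∣ ℤ.< c
abs-< {+ k} {c} p _ = subst (ℤ._< c) (ℤₚ.*-identityˡ (+ k)) p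
abs-< { -[1+ k ]} {c} _ q = subst (ℤ._< c) (ℤₚ.-1*i≡-i -[1+ k ]) q

<-abs : ∀ {x c} → + ∣ x ∣ ℤ.< c → x ℤ.< c × - x ℤ.< c
<-abs {+ k} p = p , ℤₚ.≤-<-trans (ℤₚ.≤-trans (neg+≤0 k) (+≤+ z≤n)) p
<-abs { -[1+ k ]} p = ℤₚ.<-trans ℤ.-<+ p , p

≡ᵇ-true : ∀ {j k} → (j ℕ.≡ᵇ k) ≡ true → j ≡ k
≡ᵇ-true {j} {k} eq = ℕₚ.≡ᵇ⇒≡ j k (subst Bool.T (sym eq) tt)

boundBy-at : ∀ n s w → boundBy n s w n ≡ s ℤ.* at w 1
boundBy-at n s w rewrite <ᵇ-false (ℕₚ.≤-refl {n}) | ≡ᵇ-refl n = refl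

-- Only the bounds at `suc n` and `suc (suc n)` contain the sign. Valleys of the second kind need an
-- East step after North step `suc n`, and for the first kind the condition with the absolute value
-- serves both signs.
flipped-valleys : ∀ n b w → nthNFollowedByEast (suc n) b ≡ false → All (ValleyBy (suc n) 1ℤ w) (valleys b) →
  (∀ i → (i , suc n) ∈ valleys b → + ∣ at w 1 ∣ ℤ.< at w (suc n ℕ.+ 1 ℕ.∸ i)) → All (ValleyBy (suc n) -1ℤ w) (valleys b)
flipped-valleys n b w nf h h′ = All.tabulate λ { {i , j} m → go i j m (All.lookup h m) (All.lookup (valleys-nthN n b nf) m) }
  where
  go : ∀ i j → (i , j) ∈ valleys b → ValleyBy (suc n) 1ℤ w (i , j) → j ≢ suc (suc n) → ValleyBy (suc n) -1ℤ w (i , j)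
  go i j m lt ne with j ℕ.<ᵇ suc n
  ... | true = lt
  ... | false with j ℕ.≡ᵇ suc n in eq
  ...   | true with ≡ᵇ-true {j} eq
  ...     | refl = subst (ℤ._< at w (suc n ℕ.+ 1 ℕ.∸ i)) (sym (ℤₚ.-1*i≡-i (at w 1))) (proj₂ (<-abs (h′ i m)))
  go i j m lt ne | false | false with j ℕ.≡ᵇ suc (suc n) in eq′
  ...     | true = ⊥-elim (ne (≡ᵇ-true {j} eq′))
  ...     | false = lt

-- With `l` zeros there are `n + l` N's and a final queue of `2 l` trees, hence `n - l` E's and
-- `2 n` letters in all. The word starts with N because the forest is not empty.
NF-word : ∀ {K} L → L ≢ [] → NF L → Bounded (suc K) (map proj₁ L) →
  ∃ λ ρ → reversedZeta (suc K) (map proj₁ L) ≡ N ∷ ρ × All Plain ρ × Ballot (N ∷ ρ) ×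
    countN (N ∷ ρ) ℕ.+ countE ρ ≡ length (reading (suc K) L) ℕ.+ length (reading (suc K) L)
NF-word {K} L ne (lk , st , e) b with flat-surjective L lk st e
... | zs , refl = go _ _ _ (λ eq → ne (cong flat (no-trees zs eq))) (flat-Reads-labelsOf zs b) refl refl refl
  where
  n = length (reading (suc K) (flat zs))
  no-trees : ∀ zs → trees zs ≡ [] → zs ≡ []
  no-trees [] _ = refl
  no-trees (z ∷ zs) eq with trans (cong suc (sym (length-negTrees zs))) (cong length (Lₚ.++-conicalʳ (posTrees (z ∷ zs)) (negTrees (z ∷ zs)) eq))
  ... | ()
  go : ∀ ρ ls Q → Q ≢ [] → Reads ρ ls Q [] → ρ ≡ reversedZeta (suc K) (map proj₁ (flat zs)) → ls ≡ labelsOf (length zs) (reading (suc K) (flat zs)) → Q ≡ trees zs →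
    ∃ λ ρ → reversedZeta (suc K) (map proj₁ (flat zs)) ≡ N ∷ ρ × All Plain ρ × Ballot (N ∷ ρ) × countN (N ∷ ρ) ℕ.+ countE ρ ≡ n ℕ.+ n
  go _ _ _ neQ start _ _ _ = ⊥-elim (neQ refl)
  go (N ∷ ρ) ls (t ∷ Q) neQ d@(north d′) eqρ _ eqQ =
    ρ , sym eqρ , Reads-plain d′ , Reads-ballot d , count
    where
    l = length zs
    N≡ : countN (N ∷ ρ) ≡ l ℕ.+ n
    N≡ = trans (cong countN eqρ) (countN-flat zs b)
    Q≡ : length (t ∷ Q) ≡ l ℕ.+ l
    Q≡ = trans (cong length eqQ) (trans (Lₚ.length-++ (posTrees zs)) (cong₂ ℕ._+_ (length-posTrees zs) (length-negTrees zs)))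
    e≡ : l ℕ.+ countE ρ ≡ n
    e≡ = ℕₚ.+-cancelˡ-≡ l _ _ (trans (sym (ℕₚ.+-assoc l l _)) (trans (cong (ℕ._+ countE ρ) (sym Q≡)) (trans (sym (Reads-balance d)) N≡)))
    count : countN (N ∷ ρ) ℕ.+ countE ρ ≡ n ℕ.+ n
    count = trans (cong (ℕ._+ countE ρ) (trans N≡ (ℕₚ.+-comm l n))) (trans (ℕₚ.+-assoc n l _) (cong (n ℕ.+_) e≡))

sum-bound : ∀ ms → Bounded (suc (sumℕ (map ∣_∣ ms))) ms
sum-bound [] = []
sum-bound (m ∷ ms) = s≤s (ℕₚ.m≤m+n ∣ m ∣ _) ∷ All.map (λ lt → ℕₚ.<-≤-trans lt (s≤s (ℕₚ.m≤n+m _ ∣ m ∣))) (sum-bound ms)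

splitEnds : {A : Set} → ∀ r (l : List A) → length l ≡ suc (suc (suc r)) →
  ∃₂ λ x xs → ∃₂ λ y z → l ≡ x ∷ xs ++ y ∷ z ∷ [] × length xs ≡ r
splitEnds {A} r (x ∷ l) len with go r l (ℕₚ.suc-injective len)
  where
  go : ∀ r (l : List A) → length l ≡ suc (suc r) → ∃ λ xs → ∃₂ λ y z → l ≡ xs ++ y ∷ z ∷ [] × length xs ≡ r
  go zero (y ∷ z ∷ []) len = [] , y , z , refl , refl
  go (suc r) (x ∷ l) len with go r l (ℕₚ.suc-injective len)
  ... | xs , y , z , refl , len′ = x ∷ xs , y , z , refl , cong suc len′
... | xs , y , z , refl , len′ = x , xs , y , z , refl , len′

signProduct-++ : ∀ xs ys → signProduct (xs ++ ys) ≡ signProduct xs ℤ.* signProduct ys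
signProduct-++ [] ys = sym (ℤₚ.*-identityˡ _)
signProduct-++ (x ∷ xs) ys = trans (cong (sgn x ℤ.*_) (signProduct-++ xs ys)) (sym (ℤₚ.*-assoc (sgn x) _ _))

signBit-square : ∀ b → signBit b ℤ.* signBit b ≡ 1ℤ
signBit-square true = refl
signBit-square false = refl

signBit-xnor : ∀ b c → signBit (xnor b c) ≡ signBit b ℤ.* signBit c
signBit-xnor true true = refl
signBit-xnor true false = refl
signBit-xnor false true = refl
signBit-xnor false false = refl

flipHead-scaleHead : ∀ b w → flipHead b w ≡ scaleHead (signBit b) w
flipHead-scaleHead b [] = refl
flipHead-scaleHead true (x ∷ w) = cong (_∷ w) (sym (ℤₚ.*-identityˡ x))
flipHead-scaleHead false (x ∷ w) = cong (_∷ w) (sym (ℤₚ.-1*i≡-i x))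

scaleHead-square : ∀ b w → scaleHead (signBit b) (scaleHead (signBit b) w) ≡ w
scaleHead-square b [] = refl
scaleHead-square b (x ∷ w) = cong (_∷ w) (trans (sym (ℤₚ.*-assoc (signBit b) (signBit b) x)) (trans (cong (ℤ._* x) (signBit-square b)) (ℤₚ.*-identityˡ x)))

scaleHead-one : ∀ w → scaleHead 1ℤ w ≡ w
scaleHead-one [] = refl
scaleHead-one (x ∷ w) = cong (_∷ w) (ℤₚ.*-identityˡ x)

abs-scaleHead : ∀ b w → map ∣_∣ (scaleHead (signBit b) w) ≡ map ∣_∣ w
abs-scaleHead b [] = refl
abs-scaleHead true (x ∷ w) = cong (λ y → ∣ y ∣ ∷ map ∣_∣ w) (ℤₚ.*-identityˡ x)
abs-scaleHead false (x ∷ w) = cong (_∷ map ∣_∣ w) (trans (cong ∣_∣ (ℤₚ.-1*i≡-i x)) (ℤₚ.∣-i∣≡∣i∣ x))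

signProduct-scaleHead : ∀ b x w → signProduct (scaleHead (signBit b) (x ∷ w)) ≡ signBit b ℤ.* signProduct (x ∷ w)
signProduct-scaleHead true x w = trans (cong (λ y → sgn y ℤ.* signProduct w) (ℤₚ.*-identityˡ x)) (sym (ℤₚ.*-identityˡ _))
signProduct-scaleHead false x w = trans (cong (λ y → sgn y ℤ.* signProduct w) (ℤₚ.-1*i≡-i x))
  (trans (cong (ℤ._* signProduct w) (sgn-neg x)) (trans (sym (ℤₚ.neg-distribˡ-* (sgn x) (signProduct w))) (sym (ℤₚ.-1*i≡-i (sgn x ℤ.* signProduct w)))))

-- Word and reading of a labelled path in terms of its normal form

module Key (p : List Step) (a₁ : ℕ) (as : List ℕ) (c d : ℕ) (v₁ : ℤ) (vs : List ℤ) (u w : ℤ) (e : ℕ) (x : ℤ)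
  (eqa : eastsBefore p ≡ a₁ ∷ as ++ c ∷ d ∷ []) (len : length as ≡ length vs)
  (f : Fold (suc (suc (length as))) c d w e x) (asc : Ascending (suc (suc (length as))) 0 (a₁ ∷ as ++ c ∷ e ∷ [])) where

  open ActualRows p a₁ as c d v₁ vs u w eqa len public

  K : ℕ
  K = 2 ℕ.* n

  areas : List ℕ
  areas = a₁ ∷ as ++ c ∷ e ∷ []

  labels : ℤ → List ℤ
  labels z = z ∷ vs ++ u ∷ x ∷ []

  -- The first label is a parameter because for `a₁ ≡ 0` both `v₁` and `- v₁` have to be considered,
  -- whereas the areas do not depend on it.
  rows : ℤ → List Row
  rows z = rowsFrom 0 areas (labels z)

  length-areas : length areas ≡ n
  length-areas = cong suc (trans (Lₚ.length-++ as) (ℕₚ.+-comm r 2))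

  length-labels : ∀ z → length areas ≡ length (labels z)
  length-labels z = trans length-areas (sym (cong suc (trans (Lₚ.length-++ vs) (trans (ℕₚ.+-comm (length vs) 2) (cong (suc ∘ suc) (sym len))))))

  rows-normal : ∀ z → NF (rows z)
  rows-normal z = rows-NF areas (labels z) (length-labels z) asc length-areas

  n<K : n < K
  n<K = ℕₚ.m<m+n n (s≤s z≤n)

  private
    mid : List Row
    mid = rowsFrom 1 (as ∷ʳ c) (vs ∷ʳ u)

    j : ℕ
    j = Fold-gap f

    len-mid : length (as ∷ʳ c) ≡ length (vs ∷ʳ u)
    len-mid = trans (Lₚ.length-++ as) (trans (cong (ℕ._+ 1) len) (sym (Lₚ.length-++ vs)))

  rows-eq : ∀ z → rows z ≡ (+ a₁ , z) ∷ mid ∷ʳ (- + j , x)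
  rows-eq z = begin
    rowsFrom 0 (a₁ ∷ as ++ c ∷ e ∷ []) (z ∷ vs ++ u ∷ x ∷ [])
      ≡⟨ cong₂ (λ xs us → rowsFrom 0 (a₁ ∷ xs) (z ∷ us)) (sym (Lₚ.++-assoc as (c ∷ []) (e ∷ []))) (sym (Lₚ.++-assoc vs (u ∷ []) (x ∷ []))) ⟩
    (+ a₁ ℤ.- + 0 , z) ∷ rowsFrom 1 ((as ∷ʳ c) ∷ʳ e) ((vs ∷ʳ u) ∷ʳ x)
      ≡⟨ cong₂ (λ m L → (m , z) ∷ L) (ℤₚ.+-identityʳ (+ a₁)) (rowsFrom-∷ʳ 1 (as ∷ʳ c) (vs ∷ʳ u) len-mid) ⟩
    (+ a₁ , z) ∷ mid ∷ʳ (+ e ℤ.- + suc (length (as ∷ʳ c)) , x)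
      ≡⟨ cong (λ m → (+ a₁ , z) ∷ mid ∷ʳ (m , x)) (trans (cong (λ k → + e ℤ.- + suc k) (trans (Lₚ.length-++ as) (ℕₚ.+-comm r 1))) (Fold-area f)) ⟩
    (+ a₁ , z) ∷ mid ∷ʳ (- + j , x) ∎
    where open ≡-Reasoning

  rows-bound : ∀ z → Bounded n (map proj₁ (rows z))
  rows-bound z = rows-bounded 0 areas (labels z) (Ascending-≤ areas asc) (ℕₚ.≤-reflexive length-areas) ℕₚ.≤-refl

  rows-boundK : ∀ z → Bounded K (map proj₁ (rows z))
  rows-boundK z = All.map (λ lt → ℕₚ.<-trans lt n<K) (rows-bound z)

  private
    κ t : Bool
    κ = xnor ε₀ x03
    t = xnor x03 s₀

    actual : Row → Row → List Row
    actual y z = y ∷ mid ∷ʳ z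

    last-row : reflectUnless t (lastArea r c d , w) ≡ (- + j , x) ⊎ reflectUnless t (lastArea r c d , w) ≡ (+ suc j , - x)
    last-row = Fold-last f t

    bound-parts : Bounded n ((+ a₁) ∷ map proj₁ (mid ∷ʳ (- + j , x)))
    bound-parts = subst (λ L → Bounded n (map proj₁ L)) (rows-eq 0ℤ) (rows-bound 0ℤ)

    bound-mid : Bounded n (map proj₁ mid) × suc j < K × ∣ - + j ∣ < n
    bound-mid with bound-parts
    ... | _ ∷ b with Allₚ.++⁻ (map proj₁ mid) (subst (Bounded n) (Lₚ.map-++ proj₁ mid _) b)
    ... | bm , bj ∷ [] = bm , ℕₚ.≤-<-trans (subst (_< n) (ℤₚ.∣-i∣≡∣i∣ (+ j)) bj) n<K , bj

    a₁<K : ∣ + a₁ ∣ < K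
    a₁<K with bound-parts
    ... | b ∷ _ = ℕₚ.<-trans b n<K

    actual-bound : Bounded K (map proj₁ (actualRows n p v))
    actual-bound = subst (Bounded K ∘ map proj₁) (sym actualRows-eq) (first κ ∷ subst (Bounded K) (sym (Lₚ.map-++ proj₁ mid _))
      (Allₚ.++⁺ (All.map (λ lt → ℕₚ.<-trans lt n<K) (proj₁ bound-mid)) (last last-row ∷ [])))
      where
      first : ∀ b → ∣ proj₁ (negateUnless b (+ a₁ , v₁)) ∣ < K
      first true = a₁<K
      first false = subst (_< K) (sym (ℤₚ.∣-i∣≡∣i∣ (+ a₁))) a₁<K
      last : ∀ {y} → y ≡ (- + j , x) ⊎ y ≡ (+ suc j , - x) → ∣ proj₁ y ∣ < K
      last (inj₁ refl) = ℕₚ.<-trans (proj₂ (proj₂ bound-mid)) n<K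
      last (inj₂ refl) = proj₁ (proj₂ bound-mid)

    zeta-first : ∀ b ms → reversedZeta K (proj₁ (negateUnless b (+ a₁ , v₁)) ∷ ms) ≡ reversedZeta K (+ a₁ ∷ ms)
    zeta-first true ms = refl
    zeta-first false ms = zeta-neg K (+ a₁) ms

    zeta-last : ∀ ms {y} → y ≡ (- + j , x) ⊎ y ≡ (+ suc j , - x) →
      dropLast (reverse (reversedZeta K (ms ∷ʳ proj₁ y))) ≡ dropLast (reverse (reversedZeta K (ms ∷ʳ - + j)))
    zeta-last ms (inj₁ refl) = refl
    -- The first argument is `2 n - 1` in the form to which `K` unfolds.
    zeta-last ms (inj₂ refl) = zeta-reflect (suc (suc r) ℕ.+ (n ℕ.+ 0)) ms j (proj₁ (proj₂ bound-mid))

  zetaRaw-rows : ∀ z → zetaRaw n p ≡ dropLast (reverse (reversedZeta K (map proj₁ (rows z))))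
  zetaRaw-rows z = begin
    dropLast (zetaFull K (muVec n p))
      ≡⟨ cong dropLast (trans (sym (Lₚ.reverse-involutive _)) (cong reverse (reverse-zetaFull K (muVec n p)))) ⟩
    dropLast (reverse (reversedZeta K (muVec n p)))
      ≡⟨ cong (dropLast ∘ reverse ∘ reversedZeta K) (trans (sym (actualRows-mu n p v)) (trans (cong (map proj₁) actualRows-eq)
           (cong (proj₁ (negateUnless κ (+ a₁ , v₁)) ∷_) (Lₚ.map-++ proj₁ mid _)))) ⟩
    dropLast (reverse (reversedZeta K (proj₁ (negateUnless κ (+ a₁ , v₁)) ∷ map proj₁ mid ∷ʳ proj₁ (reflectUnless t (lastArea r c d , w)))))
      ≡⟨ cong (dropLast ∘ reverse) (zeta-first κ (map proj₁ mid ∷ʳ proj₁ (reflectUnless t (lastArea r c d , w)))) ⟩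
    dropLast (reverse (reversedZeta K (+ a₁ ∷ map proj₁ mid ∷ʳ proj₁ (reflectUnless t (lastArea r c d , w)))))
      ≡⟨ zeta-last (+ a₁ ∷ map proj₁ mid) last-row ⟩
    dropLast (reverse (reversedZeta K (+ a₁ ∷ map proj₁ mid ∷ʳ - + j)))
      ≡⟨ cong (dropLast ∘ reverse ∘ reversedZeta K) (sym (trans (cong (map proj₁) (rows-eq z)) (cong (+ a₁ ∷_) (Lₚ.map-++ proj₁ mid _)))) ⟩
    dropLast (reverse (reversedZeta K (map proj₁ (rows z)))) ∎
    where open ≡-Reasoning

  rawLabels : List ℤ
  rawLabels = map (adjustRow n p v) (readingRaw n p v)

  private
    rawLabels-K : rawLabels ≡ reading K (actualRows n p v)
    rawLabels-K = begin
      rawLabels                                  ≡⟨ readingRaw-rows n p v ⟩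
      reading S (actualRows n p v)               ≡⟨ reading-stable (actualRows n p v) S-bound K ⟨
      reading (S ℕ.+ K) (actualRows n p v)       ≡⟨ cong (λ k → reading k (actualRows n p v)) (ℕₚ.+-comm S K) ⟩
      reading (K ℕ.+ S) (actualRows n p v)       ≡⟨ reading-stable (actualRows n p v) actual-bound S ⟩
      reading K (actualRows n p v)               ∎
      where
      open ≡-Reasoning
      S = suc (sumℕ (map ∣_∣ (muVec n p)))
      S-bound : Bounded S (map proj₁ (actualRows n p v))
      S-bound = subst (Bounded S) (sym (actualRows-mu n p v)) (sum-bound (muVec n p))

    reading-last : ∀ y {z} → z ≡ (- + j , x) ⊎ z ≡ (+ suc j , - x) → reading K (actual y z) ≡ reading K (actual y (- + j , x))
    reading-last y (inj₁ refl) = refl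
    reading-last y (inj₂ refl) = trans (reading-reflect K (y ∷ mid) (+ suc j) (- x))
      (cong₂ (λ m z → reading K (actual y (m , z))) (reflect-suc j) (ℤₚ.neg-involutive x))

    reading-first : ∀ b → ∃ λ z → reading K (actual (negateUnless b (+ a₁ , v₁)) (- + j , x)) ≡ reading K (rows z) ×
      (z ≡ v₁ ⊎ (a₁ ≡ 0 × z ≡ - v₁))
    reading-first true = v₁ , cong (reading K) (sym (rows-eq v₁)) , inj₁ refl
    reading-first false with a₁ ℕ.≟ 0
    ... | yes refl = - v₁ , cong (reading K) (sym (rows-eq (- v₁))) , inj₂ (refl , refl)
    ... | no ne = v₁ , trans (reading-neg K (+ a₁) v₁ (mid ∷ʳ (- + j , x)) (λ eq → ne (ℤₚ.+-injective eq)) a₁<K) (cong (reading K) (sym (rows-eq v₁))) , inj₁ refl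

  rawLabels-rows : ∃ λ z → rawLabels ≡ reading K (rows z) × (z ≡ v₁ ⊎ (a₁ ≡ 0 × z ≡ - v₁))
  rawLabels-rows with reading-first κ
  ... | z , eq , h = z , trans rawLabels-K (trans (cong (reading K) actualRows-eq) (trans (reading-last (negateUnless κ (+ a₁ , v₁)) last-row) eq)) , h

  evenPos : Bool
  evenPos = isEven (countᵇ isPos (muVec n p))

  rawLabels-abs : map ∣_∣ rawLabels ↭ map ∣_∣ v
  rawLabels-abs = ↭-trans (map⁺ ∣_∣ (↭-trans (↭-reflexive rawLabels-K) (reading-↭ K (actualRows n p v) actual-bound)))
    (↭-reflexive (trans (abs-readLabel (actualRows n p v)) (trans (cong (map ∣_∣ ∘ map proj₂) actualRows-eq) labels-abs)))
    where
    labels-abs : map ∣_∣ (map proj₂ (actual (negateUnless κ (+ a₁ , v₁)) (reflectUnless t (lastArea r c d , w)))) ≡ map ∣_∣ v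
    labels-abs = cong₂ _∷_ (first κ) (begin
      map ∣_∣ (map proj₂ (mid ∷ʳ reflectUnless t (lastArea r c d , w)))
        ≡⟨ cong (map ∣_∣) (trans (Lₚ.map-++ proj₂ mid _) (cong (_∷ʳ _) (proj₂-rows 1 (as ∷ʳ c) (vs ∷ʳ u) len-mid))) ⟩
      map ∣_∣ ((vs ∷ʳ u) ∷ʳ proj₂ (reflectUnless t (lastArea r c d , w)))
        ≡⟨ Lₚ.map-++ ∣_∣ (vs ∷ʳ u) _ ⟩
      map ∣_∣ (vs ∷ʳ u) ∷ʳ ∣ proj₂ (reflectUnless t (lastArea r c d , w)) ∣
        ≡⟨ cong (map ∣_∣ (vs ∷ʳ u) ∷ʳ_) (last t) ⟩
      map ∣_∣ (vs ∷ʳ u) ∷ʳ ∣ w ∣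
        ≡⟨ Lₚ.map-++ ∣_∣ (vs ∷ʳ u) (w ∷ []) ⟨
      map ∣_∣ ((vs ∷ʳ u) ∷ʳ w)
        ≡⟨ cong (map ∣_∣) (Lₚ.++-assoc vs (u ∷ []) (w ∷ [])) ⟩
      map ∣_∣ (vs ++ u ∷ w ∷ []) ∎)
      where
      open ≡-Reasoning
      first : ∀ b → ∣ proj₂ (negateUnless b (+ a₁ , v₁)) ∣ ≡ ∣ v₁ ∣
      first true = refl
      first false = ℤₚ.∣-i∣≡∣i∣ v₁
      last : ∀ b → ∣ proj₂ (reflectUnless b (lastArea r c d , w)) ∣ ≡ ∣ w ∣
      last true = refl
      last false = ℤₚ.∣-i∣≡∣i∣ w

  -- The case modulo 4 contributes a sign to the first and to the last row, and these cancel. There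
  -- remain the sign of the path, the parity correction and one sign for each positive entry.
  rawLabels-sign : signProduct rawLabels ≡ signBit evenPos ℤ.* (signBit ε₀ ℤ.* signBit s₀ ℤ.* signProduct v)
  rawLabels-sign = begin
    signProduct rawLabels
      ≡⟨ signProduct-↭ (↭-trans (↭-reflexive rawLabels-K) (reading-↭ K (actualRows n p v) actual-bound)) ⟩
    signProduct (map readLabel (actualRows n p v))
      ≡⟨ signProduct-readLabel (actualRows n p v) ⟩
    signBit (isEven (countᵇ isPos (map proj₁ (actualRows n p v)))) ℤ.* signProduct (map proj₂ (actualRows n p v))
      ≡⟨ cong₂ (λ ms L → signBit (isEven (countᵇ isPos ms)) ℤ.* signProduct (map proj₂ L)) (actualRows-mu n p v) actualRows-eq ⟩
    signBit evenPos ℤ.* signProduct (map proj₂ (actual (negateUnless κ (+ a₁ , v₁)) (reflectUnless t (lastArea r c d , w))))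
      ≡⟨ cong (signBit evenPos ℤ.*_) labels-sign ⟩
    signBit evenPos ℤ.* (signBit ε₀ ℤ.* signBit s₀ ℤ.* signProduct v) ∎
    where
    open ≡-Reasoning
    first : ∀ b → sgn (proj₂ (negateUnless b (+ a₁ , v₁))) ≡ signBit b ℤ.* sgn v₁
    first true = sym (ℤₚ.*-identityˡ _)
    first false = trans (sgn-neg v₁) (sym (ℤₚ.-1*i≡-i (sgn v₁)))
    last : ∀ b → sgn (proj₂ (reflectUnless b (lastArea r c d , w))) ≡ signBit b ℤ.* sgn w
    last true = sym (ℤₚ.*-identityˡ _)
    last false = trans (sgn-neg w) (sym (ℤₚ.-1*i≡-i (sgn w)))
    split-v : ∀ y → signProduct ((vs ∷ʳ u) ∷ʳ y) ≡ signProduct (vs ∷ʳ u) ℤ.* sgn y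
    split-v y = trans (signProduct-++ (vs ∷ʳ u) (y ∷ [])) (cong (signProduct (vs ∷ʳ u) ℤ.*_) (ℤₚ.*-identityʳ (sgn y)))
    labels-sign : signProduct (map proj₂ (actual (negateUnless κ (+ a₁ , v₁)) (reflectUnless t (lastArea r c d , w)))) ≡
      signBit ε₀ ℤ.* signBit s₀ ℤ.* signProduct v
    labels-sign = begin
      sgn (proj₂ (negateUnless κ (+ a₁ , v₁))) ℤ.* signProduct (map proj₂ (mid ∷ʳ reflectUnless t (lastArea r c d , w)))
        ≡⟨ cong₂ ℤ._*_ (first κ) (trans (cong signProduct (trans (Lₚ.map-++ proj₂ mid _) (cong (_∷ʳ _) (proj₂-rows 1 (as ∷ʳ c) (vs ∷ʳ u) len-mid))))
             (trans (split-v _) (cong (signProduct (vs ∷ʳ u) ℤ.*_) (last t)))) ⟩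
      (signBit κ ℤ.* sgn v₁) ℤ.* (signProduct (vs ∷ʳ u) ℤ.* (signBit t ℤ.* sgn w))
        ≡⟨ cong₂ (λ k t → (k ℤ.* sgn v₁) ℤ.* (signProduct (vs ∷ʳ u) ℤ.* (t ℤ.* sgn w))) (signBit-xnor ε₀ x03) (signBit-xnor x03 s₀) ⟩
      (signBit ε₀ ℤ.* signBit x03 ℤ.* sgn v₁) ℤ.* (signProduct (vs ∷ʳ u) ℤ.* (signBit x03 ℤ.* signBit s₀ ℤ.* sgn w))
        ≡⟨ solve 6 (λ e c s a b d → (e :* c :* a) :* (b :* (c :* s :* d)) := (c :* c) :* (e :* s :* (a :* (b :* d)))) refl
             (signBit ε₀) (signBit x03) (signBit s₀) (sgn v₁) (signProduct (vs ∷ʳ u)) (sgn w) ⟩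
      (signBit x03 ℤ.* signBit x03) ℤ.* (signBit ε₀ ℤ.* signBit s₀ ℤ.* (sgn v₁ ℤ.* (signProduct (vs ∷ʳ u) ℤ.* sgn w)))
        ≡⟨ trans (cong (ℤ._* (signBit ε₀ ℤ.* signBit s₀ ℤ.* (sgn v₁ ℤ.* (signProduct (vs ∷ʳ u) ℤ.* sgn w)))) (signBit-square x03)) (ℤₚ.*-identityˡ _) ⟩
      signBit ε₀ ℤ.* signBit s₀ ℤ.* (sgn v₁ ℤ.* (signProduct (vs ∷ʳ u) ℤ.* sgn w))
        ≡⟨ cong (λ y → signBit ε₀ ℤ.* signBit s₀ ℤ.* (sgn v₁ ℤ.* y)) (trans (sym (split-v w)) (cong signProduct (Lₚ.++-assoc vs (u ∷ []) (w ∷ [])))) ⟩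
      signBit ε₀ ℤ.* signBit s₀ ℤ.* signProduct v ∎
      where open +-*-Solver

  dD-rawLabels : dD n p v ≡ scaleHead (signBit evenPos) rawLabels
  dD-rawLabels = trans (dD-adjustRow n p v) (flipHead-scaleHead evenPos rawLabels)

  rows≢[] : ∀ z → rows z ≢ []
  rows≢[] z ()

  reading-scale : a₁ ≡ 0 → ∀ s z → scaleHead s (reading K (rows z)) ≡ reading K (rows (s ℤ.* z))
  reading-scale 0≡ s z = trans (cong (scaleHead s) (head-eq z)) (sym (head-eq (s ℤ.* z)))
    where
    headed = reading-zero (suc (suc r) ℕ.+ (n ℕ.+ 0)) (rowsFrom 1 (as ++ c ∷ e ∷ []) (vs ++ u ∷ x ∷ [])) (cong (λ a → + a ℤ.- + 0) 0≡)
    head-eq : ∀ z → reading K (rows z) ≡ z ∷ proj₁ headed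
    head-eq = proj₂ headed

  proj₁-rows-eq : ∀ z z′ → map proj₁ (rows z) ≡ map proj₁ (rows z′)
  proj₁-rows-eq z z′ = proj₁-rows 0 areas (labels z) (labels z′) (length-labels z) (length-labels z′)

  headIsZero-rows : ∀ z → headIsZero (rows z) ≡ (+ a₁ ==ℤ 0ℤ)
  headIsZero-rows z = cong (_==ℤ 0ℤ) (ℤₚ.+-identityʳ (+ a₁))

  length-reading : ∀ z → length (reading K (rows z)) ≡ n
  length-reading z = trans (↭-length (reading-↭ K (rows z) (rows-boundK z)))
    (trans (Lₚ.length-map readLabel (rows z)) (trans (length-rows 0 areas (labels z) (length-labels z)) (trans (sym (length-labels z)) length-areas)))

  nthN-rows : ∀ z → nthNFollowedByEast n (zetaRaw n p) ≡ not (+ a₁ ==ℤ 0ℤ)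
  nthN-rows z = trans (cong₂ nthNFollowedByEast (sym (length-reading z)) (zetaRaw-rows z))
    (trans (NF-nthN (rows z) (rows≢[] z) (rows-normal z) (rows-boundK z)) (cong not (headIsZero-rows z)))

  word : ∀ z → ∃ λ ρ → reversedZeta K (map proj₁ (rows z)) ≡ N ∷ ρ × All Plain ρ × Ballot (N ∷ ρ) × countN (N ∷ ρ) ℕ.+ countE ρ ≡ n ℕ.+ n
  word z = let (ρ , eq , pl , bal , total) = NF-word (rows z) (rows≢[] z) (rows-normal z) (rows-boundK z)
           in ρ , eq , pl , bal , trans total (cong₂ ℕ._+_ (length-reading z) (length-reading z))

  zetaRaw-word : ∀ {ρ} z → reversedZeta K (map proj₁ (rows z)) ≡ N ∷ ρ → zetaRaw n p ≡ reverse ρ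
  zetaRaw-word {ρ} z eq = trans (zetaRaw-rows z) (trans (cong (dropLast ∘ reverse) eq)
    (trans (cong dropLast (Lₚ.unfold-reverse N ρ)) (dropLast-∷ʳ (reverse ρ) N)))

  rawLabels-length : length rawLabels ≡ n
  rawLabels-length = trans (cong length (proj₁ (proj₂ rawLabels-rows))) (length-reading (proj₁ rawLabels-rows))

  -- The sign condition of `Vert` cancels every factor but that of the positive entries, which is
  -- the sign by which `dD` finally multiplies the first entry. This makes the window an element of
  -- type D.
  rawLabels-parity : signProduct v ≡ ε p ℤ.* signBit s₀ → signProduct rawLabels ≡ signBit evenPos
  rawLabels-parity sign-v = trans rawLabels-sign (trans (cong (λ y → signBit evenPos ℤ.* (signBit ε₀ ℤ.* signBit s₀ ℤ.* y)) sign-v)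
    (trans (solve 3 (λ q e s → q :* (e :* s :* (e :* s)) := q :* ((e :* e) :* (s :* s))) refl (signBit evenPos) (signBit ε₀) (signBit s₀))
      (trans (cong₂ (λ y z → signBit evenPos ℤ.* (y ℤ.* z)) (signBit-square ε₀) (signBit-square s₀)) (ℤₚ.*-identityʳ _))))
    where open +-*-Solver

valleys-Linked : ∀ {K} L → L ≢ [] → NF L → Bounded (suc K) (map proj₁ L) → ∀ b w s → w ≢ [] →
  reversedZeta (suc K) (map proj₁ L) ≡ N ∷ reverse (map unsign b) → reading (suc K) L ≡ scaleHead s w →
  (Linked (Drop ℤ._<_) L → All (ValleyBy (length w) s w) (valleys b)) × (All (ValleyBy (length w) s w) (valleys b) → Linked (Drop ℤ._<_) L)
valleys-Linked {K} L neL nf bd b w s ne eqρ eqw with NF-word L neL nf bd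
... | ρ′ , eq , pl , bal , total with Lₚ.∷-injectiveʳ (trans (sym eq) eqρ)
... | refl =
  (λ lk → labels⇒valleys bal total′ s (subst id V≡ (proj₁ (NF-Val L nf bd) lk))) ,
  (λ h → proj₂ (NF-Val L nf bd) (subst id (sym V≡) (valleys⇒labels bal total′ s h)))
  where
  open Translate b w ne
  len : length (reading (suc K) L) ≡ length w
  len = trans (cong length eqw) (length-scaleHead s w)
  total′ : countN ρ ℕ.+ countE ρ ≡ length w ℕ.+ length w
  total′ = trans total (cong (λ k → k ℕ.+ k) len)
  V≡ : Val (ValleyLess (countN (reversedZeta (suc K) (map proj₁ L)) ℕ.∸ length (reading (suc K) L)) (reading (suc K) L)) (reversedZeta (suc K) (map proj₁ L))
     ≡ Val (ValleyLess (countN ρ ℕ.∸ length w) (scaleHead s w)) ρ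
  V≡ = trans (cong₂ (λ ρ k → Val (ValleyLess (countN ρ ℕ.∸ k) (reading (suc K) L)) ρ) eqρ len)
             (cong (λ u → Val (ValleyLess (countN ρ ℕ.∸ length w) u) ρ) eqw)

signOfBit : Bool → Step
signOfBit b = if b then E⁺ else E⁻

signOfBit-Sign : ∀ b → Sign (signOfBit b)
signOfBit-Sign true = plus
signOfBit-Sign false = minus

signOf-signOfBit : ∀ b → signOf (signOfBit b) ≡ signBit b
signOf-signOfBit true = refl
signOf-signOfBit false = refl

Sign-injective : ∀ {s s′} → Sign s → Sign s′ → signOf s ≡ signOf s′ → s ≡ s′
Sign-injective plus plus _ = refl
Sign-injective minus minus _ = refl
Sign-injective plus minus ()
Sign-injective minus plus ()

signBit-injective : ∀ {b c} → signBit b ≡ signBit c → b ≡ c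
signBit-injective {true} {true} _ = refl
signBit-injective {false} {false} _ = refl

range1-nonzero : ∀ n → All (λ k → k ≢ 0) (range1 n)
range1-nonzero n = Allₚ.map⁺ (All.universal (λ _ ()) (upTo n))

perm-nonzero : ∀ {n w} → map ∣_∣ w ↭ range1 n → All (λ x → x ≢ 0ℤ) w
perm-nonzero {n} p = All.map (λ { h refl → h refl }) (Allₚ.map⁻ (All-resp-↭ (↭-sym p) (range1-nonzero n)))

length-range1 : ∀ n → length (range1 n) ≡ n
length-range1 n = trans (Lₚ.length-map suc (upTo n)) (Lₚ.length-upTo n)

perm-length : ∀ {n w} → map ∣_∣ w ↭ range1 n → length w ≡ n
perm-length {n} {w} p = trans (sym (Lₚ.length-map ∣_∣ w)) (trans (↭-length p) (length-range1 n))

Ascending-replace : ∀ {M k} xs {c d e} → c ≤ e → e ≤ M → Ascending M k (xs ++ c ∷ d ∷ []) → Ascending M k (xs ++ c ∷ e ∷ [])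
Ascending-replace [] c≤e e≤M (k≤c , _) = k≤c , c≤e , e≤M
Ascending-replace (x ∷ xs) c≤e e≤M (le , asc) = le , Ascending-replace xs c≤e e≤M asc

Ascending-end : ∀ {M k} xs {c d} → Ascending M k (xs ++ c ∷ d ∷ []) → c ≤ d × d ≤ M
Ascending-end [] (_ , c≤d , d≤M) = c≤d , d≤M
Ascending-end (x ∷ xs) (_ , asc) = Ascending-end xs asc

Linked-head : ∀ {y z z′} xs us → Linked Rise ((y , z) ∷ zipped xs us) →
  (∀ {x′ xs′ u′ us′} → xs ≡ x′ ∷ xs′ → us ≡ u′ ∷ us′ → y ≡ x′ → z′ ℤ.< u′) → Linked Rise ((y , z′) ∷ zipped xs us)
Linked-head [] us lk h = tt
Linked-head (x ∷ xs) [] lk h = tt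
Linked-head (x ∷ xs) (u ∷ us) (_ , lk) h = h refl refl , lk

Linked-first : ∀ {y z x′ xs′ u′ us′} xs us → xs ≡ x′ ∷ xs′ → us ≡ u′ ∷ us′ → Linked Rise ((y , z) ∷ zipped xs us) → y ≡ x′ → z ℤ.< u′
Linked-first _ _ refl refl (r , _) = r

plusBit-zero : ∀ {p a₁ as} → FirstSigned p → eastsBefore p ≡ a₁ ∷ as → a₁ ≡ 0 → ε p ≡ 1ℤ
plusBit-zero {p} fs eqa refl with FirstSigned-split p fs
... | s , sg , eq = trans (cong ε eq) (trans (ε-setFirst sg (unsign-plain p))
  (cong (λ b → if b then signOf s else 1ℤ) (headEast-easts (unsign-plain p) (trans (eastsFrom-unsign 0 p) eqa))))

-- Recovering the labelled path from its normal form

record Recover (r : ℕ) (L : List Row) (p : List Step) (v : List ℤ) : Set where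
  field
    {a₁ c d e} : ℕ
    {as} : List ℕ
    {v₁ u w x z} : ℤ
    {vs} : List ℤ
    eqa : eastsBefore p ≡ a₁ ∷ as ++ c ∷ d ∷ []
    eqv : v ≡ v₁ ∷ vs ++ u ∷ w ∷ []
    len-as : length as ≡ r
    len-vs : length vs ≡ r
    folded : Fold (suc (suc r)) c d w e x
    rows≡ : L ≡ rowsFrom 0 (a₁ ∷ as ++ c ∷ e ∷ []) (z ∷ vs ++ u ∷ x ∷ [])
    first : z ≡ v₁ ⊎ (a₁ ≡ 0 × z ≡ - v₁)
    lattice : SignedLatticePath (suc (suc (suc r))) p
    sign : signProduct v ≡ ε p ℤ.* signBit (signParity (suc (suc (suc r))) p)
    nonzero : signProduct v ≢ 0ℤ

signParity-easts : ∀ n {p p′} → eastsBefore p ≡ eastsBefore p′ → signParity n p ≡ signParity n p′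
signParity-easts n eq = cong (λ l → isEven (sumℕ (map (atD 0 l) (range1 (n ℕ.∸ 2))))) eq

signBit-cancel : ∀ {x y} b → x ℤ.* signBit b ≡ y ℤ.* signBit b → x ≡ y
signBit-cancel true eq = trans (sym (ℤₚ.*-identityʳ _)) (trans eq (ℤₚ.*-identityʳ _))
signBit-cancel {x} {y} false eq = ℤₚ.neg-injective (trans (sym (neg x)) (trans eq (neg y)))
  where
  neg : ∀ x → x ℤ.* -1ℤ ≡ - x
  neg x = trans (ℤₚ.*-comm x -1ℤ) (ℤₚ.-1*i≡-i x)

self-neg : ∀ {x} → x ≡ - x → x ≡ 0ℤ
self-neg {+ zero} _ = refl
self-neg {+ suc _} ()
self-neg { -[1+ _ ]} ()

signProduct-neg : ∀ v vs → signProduct (- v ∷ vs) ≡ - signProduct (v ∷ vs)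
signProduct-neg v vs = trans (cong (ℤ._* signProduct vs) (sgn-neg v)) (sym (ℤₚ.neg-distribˡ-* (sgn v) (signProduct vs)))

lattice-unsign : ∀ {n p p′} → SignedLatticePath n p → SignedLatticePath n p′ → eastsBefore p ≡ eastsBefore p′ → map unsign p ≡ map unsign p′
lattice-unsign {n} {p} {p′} (_ , cE , _) (_ , cE′ , _) eq =
  trans (sym (path p cE)) (trans (cong (pathOf (n ℕ.∸ 1) 0) eq) (path p′ cE′))
  where
  path : ∀ p → countE p ≡ n ℕ.∸ 1 → pathOf (n ℕ.∸ 1) 0 (eastsBefore p) ≡ map unsign p
  path p cE = trans (cong (pathOf (n ℕ.∸ 1) 0) (sym (eastsFrom-unsign 0 p)))
    (pathOf-eastsFrom 0 (unsign-plain p) (trans (ℕₚ.+-identityʳ _) (trans (countE-unsign p) cE)))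

setFirst-injective : ∀ {p p′} → FirstSigned p → FirstSigned p′ → map unsign p ≡ map unsign p′ → ε p ≡ ε p′ → p ≡ p′
setFirst-injective {p} {p′} fs fs′ eq eqε with FirstSigned-split p fs | FirstSigned-split p′ fs′
... | s , sg , e | s′ , sg′ , e′ = trans e (trans (go (map unsign p) refl) (trans (cong (setFirst s′) eq) (sym e′)))
  where
  signs : (if headEast (map unsign p) then signOf s else 1ℤ) ≡ (if headEast (map unsign p) then signOf s′ else 1ℤ)
  signs = trans (sym (trans (cong ε e) (ε-setFirst sg (unsign-plain p)))) (trans eqε
    (trans (trans (cong ε e′) (ε-setFirst sg′ (unsign-plain p′))) (cong (λ q → if headEast q then signOf s′ else 1ℤ) (sym eq))))
  go : ∀ q → q ≡ map unsign p → setFirst s q ≡ setFirst s′ q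
  go [] _ = refl
  go (N ∷ q) _ = refl
  go (E⁺ ∷ q) _ = refl
  go (E⁻ ∷ q) _ = refl
  go (E ∷ q) eq′ = cong (_∷ q) (Sign-injective sg sg′ (subst (λ q → (if headEast q then signOf s else 1ℤ) ≡ (if headEast q then signOf s′ else 1ℤ)) (sym eq′) signs))

-- The normal form leaves open the sign of the first East step and, for `a₁ ≡ 0`, that of the first
-- label. Equal labels force equal path signs through the sign identity. Opposite first labels would
-- belong to paths of sign 1 with the same parity, hence with equal but also opposite nonzero sign
-- products.
Recover-unique : ∀ {r L p p′ v v′} → Recover r L p v → Recover r L p′ v′ → p ≡ p′ × v ≡ v′
Recover-unique {r} {L} {p} {p′} {v} {v′} R R′ = finish
  where
  open Recover
  lengths : ∀ {p v} (R : Recover r L p v) → length (a₁ R ∷ as R ++ c R ∷ e R ∷ []) ≡ length (z R ∷ vs R ++ u R ∷ x R ∷ [])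
  lengths R = cong suc (trans (Lₚ.length-++ (as R)) (trans (cong (ℕ._+ 2) (trans (len-as R) (sym (len-vs R)))) (sym (Lₚ.length-++ (vs R)))))
  both = rows-injective 0 _ _ _ _ (lengths R) (lengths R′) (trans (sym (rows≡ R)) (rows≡ R′))
  a₁≡ : a₁ R ≡ a₁ R′
  a₁≡ = Lₚ.∷-injectiveˡ (proj₁ both)
  as-split = ++-cancel-length (as R) (as R′) (trans (len-as R) (sym (len-as R′))) (Lₚ.∷-injectiveʳ (proj₁ both))
  vs-split = ++-cancel-length (vs R) (vs R′) (trans (len-vs R) (sym (len-vs R′))) (Lₚ.∷-injectiveʳ (proj₂ both))
  c≡ : c R ≡ c R′
  c≡ = Lₚ.∷-injectiveˡ (proj₂ as-split)
  e≡ : e R ≡ e R′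
  e≡ = Lₚ.∷-injectiveˡ (Lₚ.∷-injectiveʳ (proj₂ as-split))
  x≡ : x R ≡ x R′
  x≡ = Lₚ.∷-injectiveˡ (Lₚ.∷-injectiveʳ (proj₂ vs-split))
  unfolded : d R ≡ d R′ × w R ≡ w R′
  unfolded = Fold-injective (folded R) (subst (λ c → Fold _ c _ _ _ _) (sym c≡) (folded R′)) e≡ x≡
  eastsEq : eastsBefore p ≡ eastsBefore p′
  eastsEq = trans (eqa R) (trans (cong₂ _∷_ a₁≡ (cong₂ _++_ (proj₁ as-split) (cong₂ (λ c d → c ∷ d ∷ []) c≡ (proj₁ unfolded)))) (sym (eqa R′)))
  tails : vs R ++ u R ∷ w R ∷ [] ≡ vs R′ ++ u R′ ∷ w R′ ∷ []
  tails = cong₂ _++_ (proj₁ vs-split) (cong₂ (λ u w → u ∷ w ∷ []) (Lₚ.∷-injectiveˡ (proj₂ vs-split)) (proj₂ unfolded))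
  unsigned : map unsign p ≡ map unsign p′
  unsigned = lattice-unsign (lattice R) (lattice R′) eastsEq
  sign′ : signProduct v′ ≡ ε p′ ℤ.* signBit (signParity (suc (suc (suc r))) p)
  sign′ = trans (sign R′) (cong (λ b → ε p′ ℤ.* signBit b) (signParity-easts (suc (suc (suc r))) {p′} {p} (sym eastsEq)))
  same-v : v₁ R ≡ v₁ R′ → p ≡ p′ × v ≡ v′
  same-v eq = setFirst-injective (proj₂ (proj₂ (lattice R))) (proj₂ (proj₂ (lattice R′))) unsigned
      (signBit-cancel (signParity (suc (suc (suc r))) p) (trans (sym (sign R)) (trans (cong signProduct v≡) sign′))) , v≡
    where
    v≡ : v ≡ v′
    v≡ = trans (eqv R) (trans (cong₂ _∷_ eq tails) (sym (eqv R′)))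
  opposite : a₁ R ≡ 0 → v₁ R ≡ - v₁ R′ → p ≡ p′ × v ≡ v′
  opposite a₁0 eq = ⊥-elim (nonzero R′ (self-neg (trans (sym (trans (sign R) (trans (cong (ℤ._* _) (trans ε≡ (sym ε′≡))) (sym sign′)))) neg)))
    where
    ε≡ : ε p ≡ 1ℤ
    ε≡ = plusBit-zero (proj₂ (proj₂ (lattice R))) (eqa R) a₁0
    ε′≡ : ε p′ ≡ 1ℤ
    ε′≡ = plusBit-zero (proj₂ (proj₂ (lattice R′))) (eqa R′) (trans (sym a₁≡) a₁0)
    neg : signProduct v ≡ - signProduct v′
    neg = trans (cong signProduct (trans (eqv R) (cong₂ _∷_ eq tails)))
      (trans (signProduct-neg (v₁ R′) (vs R′ ++ u R′ ∷ w R′ ∷ [])) (cong (λ v → - signProduct v) (sym (eqv R′))))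
  z≡ : z R ≡ z R′
  z≡ = Lₚ.∷-injectiveˡ (proj₂ both)
  finish : p ≡ p′ × v ≡ v′
  finish with first R | first R′
  ... | inj₁ h | inj₁ h′ = same-v (trans (sym h) (trans z≡ h′))
  ... | inj₁ h | inj₂ (0≡ , h′) = opposite (trans a₁≡ 0≡) (trans (sym h) (trans z≡ h′))
  ... | inj₂ (0≡ , h) | inj₁ h′ = opposite 0≡ (trans (sym (ℤₚ.neg-involutive _)) (cong -_ (trans (sym h) (trans z≡ h′))))
  ... | inj₂ (0≡ , h) | inj₂ (_ , h′) = same-v (ℤₚ.neg-injective (trans (sym h) (trans z≡ h′)))

-- The image is a diagonally labelled path and determines the normal form

module Forward (p : List Step) (a₁ : ℕ) (as : List ℕ) (c d : ℕ) (v₁ : ℤ) (vs : List ℤ) (u w : ℤ) (e : ℕ) (x : ℤ)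
  (eqa : eastsBefore p ≡ a₁ ∷ as ++ c ∷ d ∷ []) (len : length as ≡ length vs)
  (f : Fold (suc (suc (length as))) c d w e x) (asc : Ascending (suc (suc (length as))) 0 (a₁ ∷ as ++ c ∷ e ∷ []))
  (vert : Vert (suc (suc (suc (length as)))) p (v₁ ∷ vs ++ u ∷ w ∷ [])) where

  open Key p a₁ as c d v₁ vs u w e x eqa len f asc

  private
    lat = proj₁ vert
    perm = proj₁ (proj₂ vert)
    ris = proj₁ (proj₂ (proj₂ vert))
    nn = proj₁ (proj₂ (proj₂ (proj₂ vert)))
    sgnp = proj₂ (proj₂ (proj₂ (proj₂ vert)))
    pl = unsign-plain p

    b : List Step
    b = zetaD n p
    win : List ℤ
    win = dD n p v

    eqa′ : eastsFrom 0 (map unsign p) ≡ a₁ ∷ as ++ c ∷ d ∷ []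
    eqa′ = trans (eastsFrom-unsign 0 p) eqa

    len-v : length v ≡ length (eastsFrom 0 (map unsign p))
    len-v = trans (perm-length {w = v} perm) (sym (trans (cong length eqa′) (cong suc (trans (Lₚ.length-++ as) (ℕₚ.+-comm r 2)))))

    rise : Linked Rise (zipped (a₁ ∷ as ++ c ∷ d ∷ []) v)
    rise = subst (λ l → Linked Rise (zipped l v)) eqa′
      (risesFrom⇒Rise 0 [] v pl refl len-v (subst (All _) (sym (risesFrom-unsign 0 p)) ris))

    -- When `a₁ ≡ 0`, a rise at the first row means that the path begins with two North steps; the
    -- condition with the absolute value then bounds `- v₁` as well.
    rise-neg : a₁ ≡ 0 → Linked Rise (zipped (a₁ ∷ as ++ c ∷ d ∷ []) (- v₁ ∷ vs ++ u ∷ w ∷ []))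
    rise-neg refl = Linked-head (as ++ c ∷ d ∷ []) (vs ++ u ∷ w ∷ []) rise small
      where
      small : ∀ {x′ xs′ u′ us′} → as ++ c ∷ d ∷ [] ≡ x′ ∷ xs′ → vs ++ u ∷ w ∷ [] ≡ u′ ∷ us′ → 0 ≡ x′ → - v₁ ℤ.< u′
      small {u′ = u′} eq eq′ refl = proj₂ (<-abs (subst (λ l → + ∣ v₁ ∣ ℤ.< at l 1) eq′
        (subst (+ ∣ v₁ ∣ ℤ.<_) (shift eq′) (nn (trans (sym (startsNN-unsign p)) (easts-startsNN pl (trans eqa′ (cong (0 ∷_) eq))))))))
        where
        shift : ∀ {l : List ℤ} → l ≡ u′ ∷ _ → at (v₁ ∷ l) 2 ≡ at l 1
        shift refl = refl

    tight : ∀ z → z ≡ v₁ ⊎ (a₁ ≡ 0 × z ≡ - v₁) → Linked (Drop ℤ._<_) (rows z)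
    tight z h = rows-Linked⁺ 0 areas (labels z) asc (Rise-replace-last (a₁ ∷ as) (z ∷ vs) (cong suc len) (proj₁ (Fold-tight f u)) (rise-of z h))
      where
      rise-of : ∀ z → z ≡ v₁ ⊎ (a₁ ≡ 0 × z ≡ - v₁) → Linked Rise (zipped (a₁ ∷ as ++ c ∷ d ∷ []) (z ∷ vs ++ u ∷ w ∷ []))
      rise-of _ (inj₁ refl) = rise
      rise-of _ (inj₂ (eq , refl)) = rise-neg eq

    z₀ = proj₁ rawLabels-rows
    raw≡ = proj₁ (proj₂ rawLabels-rows)
    z₀-choice = proj₂ (proj₂ rawLabels-rows)

    ρ = proj₁ (word v₁)
    eqρ = proj₁ (proj₂ (word v₁))
    plρ = proj₁ (proj₂ (proj₂ (word v₁)))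
    bal = proj₁ (proj₂ (proj₂ (proj₂ (word v₁))))
    total = proj₂ (proj₂ (proj₂ (proj₂ (word v₁))))

    plain-raw : All Plain (zetaRaw n p)
    plain-raw = subst (All Plain) (sym (zetaRaw-word v₁ eqρ)) (All-reverse plρ)

    unsign-b : map unsign b ≡ reverse ρ
    unsign-b = trans (unsign-signAfter n (signOfBit-Sign evenPos) plain-raw) (zetaRaw-word v₁ eqρ)

    reverse-b : reverse (map unsign b) ≡ ρ
    reverse-b = trans (cong reverse unsign-b) (Lₚ.reverse-involutive ρ)

    nthN-b : nthNFollowedByEast n b ≡ not (+ a₁ ==ℤ 0ℤ)
    nthN-b = trans (sym (nthN-unsign n b)) (trans (cong (nthNFollowedByEast n) (trans unsign-b (sym (zetaRaw-word v₁ eqρ)))) (nthN-rows v₁))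

    ε-b : ε b ≡ (if not (+ a₁ ==ℤ 0ℤ) then signBit evenPos else 1ℤ)
    ε-b = trans (ε-signAfter (suc (suc r)) (signOfBit-Sign evenPos) plain-raw)
      (cong₂ (λ c s → if c then s else 1ℤ) (nthN-rows v₁) (signOf-signOfBit evenPos))

    length-win : length win ≡ n
    length-win = trans (cong length dD-rawLabels) (trans (length-scaleHead (signBit evenPos) rawLabels) rawLabels-length)

    win≢[] : win ≢ []
    win≢[] eq = ℕₚ.0≢1+n (trans (sym (cong length eq)) length-win)

    perm-win : IsSignedPerm n win
    perm-win = ↭-trans (↭-reflexive (trans (cong (map ∣_∣) dD-rawLabels) (abs-scaleHead evenPos rawLabels))) (↭-trans rawLabels-abs perm)

    sign-v : signProduct v ≡ ε p ℤ.* signBit s₀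
    sign-v = trans sgnp (cong (ε p ℤ.*_) vertSign)

    sign-win : signProduct win ≡ 1ℤ
    sign-win = trans (cong signProduct dD-rawLabels) (go rawLabels rawLabels-length (rawLabels-parity sign-v))
      where
      go : ∀ l → length l ≡ n → signProduct l ≡ signBit evenPos → signProduct (scaleHead (signBit evenPos) l) ≡ 1ℤ
      go (y ∷ l) _ eq = trans (signProduct-scaleHead evenPos y l) (trans (cong (signBit evenPos ℤ.*_) eq) (signBit-square evenPos))

    typeD : IsTypeD win
    typeD = signBit-injective {isEven (countᵇ isNeg win)} {true} (trans (sym (signProduct-nonzero (perm-nonzero perm-win))) sign-win)

    sign-choice : ∀ s z → z ≡ v₁ ⊎ (a₁ ≡ 0 × z ≡ - v₁) → a₁ ≡ 0 → signBit s ℤ.* z ≡ v₁ ⊎ (a₁ ≡ 0 × signBit s ℤ.* z ≡ - v₁)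
    sign-choice true z h _ = subst (λ y → y ≡ v₁ ⊎ (a₁ ≡ 0 × y ≡ - v₁)) (sym (ℤₚ.*-identityˡ z)) h
    sign-choice false z (inj₁ refl) 0≡ = inj₂ (0≡ , ℤₚ.-1*i≡-i z)
    sign-choice false z (inj₂ (_ , refl)) 0≡ = inj₁ (trans (ℤₚ.-1*i≡-i (- v₁)) (ℤₚ.neg-involutive v₁))

    scaled : a₁ ≡ 0 → ∀ s → ∃ λ z → reading K (rows z) ≡ scaleHead (signBit s) win × (z ≡ v₁ ⊎ (a₁ ≡ 0 × z ≡ - v₁))
    scaled 0≡ s = signBit s ℤ.* (signBit evenPos ℤ.* z₀) ,
      sym (trans (cong (scaleHead (signBit s)) (trans dD-rawLabels (trans (cong (scaleHead (signBit evenPos)) raw≡) (reading-scale 0≡ (signBit evenPos) z₀))))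
        (reading-scale 0≡ (signBit s) (signBit evenPos ℤ.* z₀))) ,
      sign-choice s (signBit evenPos ℤ.* z₀) (sign-choice evenPos z₀ z₀-choice 0≡) 0≡

    -- For `a₁ ≢ 0` the sign of the ballot path equals the final flip in `dD` and undoes it. For
    -- `a₁ ≡ 0` that sign is 1, and the flip is absorbed into the choice of the first label.
    representative : ∃ λ z → reading K (rows z) ≡ scaleHead (ε b) win × (z ≡ v₁ ⊎ (a₁ ≡ 0 × z ≡ - v₁))
    representative = by-first (a₁ ℕ.≟ 0)
      where
      by-first : Dec (a₁ ≡ 0) → ∃ λ z → reading K (rows z) ≡ scaleHead (ε b) win × (z ≡ v₁ ⊎ (a₁ ≡ 0 × z ≡ - v₁))
      by-first (yes 0≡) = subst (λ s → ∃ λ z → reading K (rows z) ≡ scaleHead s win × (z ≡ v₁ ⊎ (a₁ ≡ 0 × z ≡ - v₁)))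
        (sym (trans ε-b (cong (λ c → if not c then signBit evenPos else 1ℤ) (==-true (cong +_ 0≡))))) (scaled 0≡ true)
      by-first (no ne) = z₀ , trans (sym raw≡) (sym (trans (cong₂ scaleHead
        (trans ε-b (cong (λ c → if not c then signBit evenPos else 1ℤ) (==-false {+ a₁} {0ℤ} (ne ∘ ℤₚ.+-injective)))) dD-rawLabels)
        (scaleHead-square evenPos rawLabels))) , z₀-choice

    rows-ρ : ∀ z → reversedZeta K (map proj₁ (rows z)) ≡ N ∷ reverse (map unsign b)
    rows-ρ z = trans (cong (reversedZeta K) (proj₁-rows-eq z v₁)) (trans eqρ (cong (N ∷_) (sym reverse-b)))

    valleys-by : ∀ s z → reading K (rows z) ≡ scaleHead s win → z ≡ v₁ ⊎ (a₁ ≡ 0 × z ≡ - v₁) → All (ValleyBy n s win) (valleys b)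
    valleys-by s z eq h = subst (λ k → All (ValleyBy k s win) (valleys b)) length-win
      (proj₁ (valleys-Linked (rows z) (rows≢[] z) (rows-normal z) (rows-boundK z) b win s win≢[] (rows-ρ z) eq) (tight z h))

    length-b : length b ≡ 2 ℕ.* n ℕ.∸ 1
    length-b = ℕₚ.suc-injective (begin
      suc (length b)                     ≡⟨ cong suc (sym (trans (Lₚ.length-reverse (map unsign b)) (Lₚ.length-map unsign b))) ⟩
      suc (length (reverse (map unsign b))) ≡⟨ cong (suc ∘ length) reverse-b ⟩
      suc (length ρ)                     ≡⟨ cong suc (sym (countN+countE ρ)) ⟩
      countN (N ∷ ρ) ℕ.+ countE ρ        ≡⟨ total ⟩
      n ℕ.+ n                            ≡⟨ cong (n ℕ.+_) (sym (ℕₚ.+-identityʳ n)) ⟩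
      2 ℕ.* n                            ∎)
      where open ≡-Reasoning

  diagonal : Diag n (zetaD n p) (dD n p v)
  diagonal =
    (length-b , Ballot⇒ballot b (subst Ballot (sym reverse-b) (proj₂ bal)) , SignShape-signAfter (suc (suc r)) (signOfBit-Sign evenPos) plain-raw) ,
    perm-win , typeD ,
    valleys-by (ε b) (proj₁ representative) (proj₁ (proj₂ representative)) (proj₂ (proj₂ representative)) ,
    extra
    where
    zero-first : nthNFollowedByEast n b ≡ false → a₁ ≡ 0
    zero-first nf = by-first (a₁ ℕ.≟ 0)
      where
      true≢false : true ≡ false → a₁ ≡ 0
      true≢false ()
      by-first : Dec (a₁ ≡ 0) → a₁ ≡ 0
      by-first (yes 0≡) = 0≡
      by-first (no ne) = true≢false (trans (sym (trans nthN-b (cong not (==-false {+ a₁} {0ℤ} (ne ∘ ℤₚ.+-injective))))) nf)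
    extra : ∀ i → (i , n) ∈ valleys b → nthNFollowedByEast n b ≡ false → + ∣ at win 1 ∣ ℤ.< at win (n ℕ.+ 1 ℕ.∸ i)
    -- With a zero in the first row both signs of its label are admissible; the two resulting valley
    -- conditions together bound the absolute value.
    extra i m nf =
      let (z , eq , h) = scaled (zero-first nf) true
          (z′ , eq′ , h′) = scaled (zero-first nf) false
      in abs-<
        (subst (ℤ._< at win (n ℕ.+ 1 ℕ.∸ i)) (boundBy-at n 1ℤ win) (All.lookup (valleys-by 1ℤ z eq h) m))
        (subst (ℤ._< at win (n ℕ.+ 1 ℕ.∸ i)) (boundBy-at n -1ℤ win) (All.lookup (valleys-by -1ℤ z′ eq′ h′) m))

  encoding : ∃ λ L → NF L × Bounded K (map proj₁ L) × reversedZeta K (map proj₁ L) ≡ N ∷ reverse (map unsign (zetaD n p)) ×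
    reading K L ≡ scaleHead (ε (zetaD n p)) (dD n p v) × Recover r L p v
  encoding = let (z , eq , h) = representative in rows z , rows-normal z , rows-boundK z , rows-ρ z , eq , record
    { eqa = eqa ; eqv = refl ; len-as = refl ; len-vs = sym len ; folded = f ; rows≡ = refl ; first = h ; lattice = lat ; sign = sign-v
    ; nonzero = λ eq → signBit≢0 (isEven (countᵇ isNeg v)) (trans (sym (signProduct-nonzero {v} (perm-nonzero {w = v} perm))) eq) }
    where
    signBit≢0 : ∀ b → signBit b ≢ 0ℤ
    signBit≢0 true ()
    signBit≢0 false ()

Encoded : ℕ → List Step → List ℤ → Set
Encoded r p v = let n = suc (suc (suc r)) in
  ∃ λ L → NF L × Bounded (2 ℕ.* n) (map proj₁ L) × reversedZeta (2 ℕ.* n) (map proj₁ L) ≡ N ∷ reverse (map unsign (zetaD n p)) ×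
    reading (2 ℕ.* n) L ≡ scaleHead (ε (zetaD n p)) (dD n p v) × Recover r L p v

forward : ∀ r p v → let n = suc (suc (suc r)) in Vert n p v → Diag n (zetaD n p) (dD n p v) × Encoded r p v
forward r p v vert@((cN , cE , fs) , perm , _) =
  split-easts (splitEnds r (eastsBefore p)
    (trans (cong length (sym (eastsFrom-unsign 0 p))) (trans (length-eastsFrom 0 (unsign-plain p)) (trans (countN-unsign p) cN))))
    (eastsFrom-ascending 0 (unsign-plain p) (trans (ℕₚ.+-identityʳ _) (trans (countE-unsign p) cE))) (perm-length perm) vert
  where
  Goal : ℕ → List ℤ → Set
  Goal r v = Diag (suc (suc (suc r))) (zetaD (suc (suc (suc r))) p) (dD (suc (suc (suc r))) p v) × Encoded r p v
  folded : ∀ {a₁ as c d v₁ vs u w} → eastsBefore p ≡ a₁ ∷ as ++ c ∷ d ∷ [] → length vs ≡ length as →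
    Ascending (suc (suc (length as))) 0 (a₁ ∷ as ++ c ∷ d ∷ []) → Vert (suc (suc (suc (length as)))) p (v₁ ∷ vs ++ u ∷ w ∷ []) →
    (∃₂ λ e x → Fold (suc (suc (length as))) c d w e x) → Goal (length as) (v₁ ∷ vs ++ u ∷ w ∷ [])
  folded {a₁} {as} {c} {d} {v₁} {vs} {u} {w} eqa len asc vert (e , x , f) = F.diagonal , F.encoding
    where
    module F = Forward p a₁ as c d v₁ vs u w e x eqa (sym len) f
      (Ascending-replace (a₁ ∷ as) (proj₁ (proj₂ (proj₂ (Fold-≤ f)))) (proj₂ (proj₂ (proj₂ (Fold-≤ f)))) asc) vert
  split-labels : ∀ {a₁ as c d v} → eastsBefore p ≡ a₁ ∷ as ++ c ∷ d ∷ [] →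
    Ascending (suc (suc (length as))) 0 (a₁ ∷ as ++ c ∷ d ∷ []) → Vert (suc (suc (suc (length as)))) p v →
    (∃₂ λ v₁ vs → ∃₂ λ u w → v ≡ v₁ ∷ vs ++ u ∷ w ∷ [] × length vs ≡ length as) → Goal (length as) v
  split-labels {a₁} {as} eqa asc vert (v₁ , vs , u , w , refl , len) =
    folded eqa len asc vert (fold w (proj₁ (Ascending-end (a₁ ∷ as) asc)) (proj₂ (Ascending-end (a₁ ∷ as) asc)))
  split-easts : ∀ {r v} → (∃₂ λ a₁ as → ∃₂ λ c d → eastsBefore p ≡ a₁ ∷ as ++ c ∷ d ∷ [] × length as ≡ r) →
    Ascending (suc (suc r)) 0 (eastsFrom 0 (map unsign p)) → length v ≡ suc (suc (suc r)) → Vert (suc (suc (suc r))) p v → Goal r v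
  split-easts {v = v} (a₁ , as , c , d , eqa , refl) asc len vert =
    split-labels eqa (subst (Ascending (suc (suc (length as))) 0) (trans (eastsFrom-unsign 0 p) eqa) asc) vert (splitEnds (length as) v len)

injective : ∀ r p p′ v v′ → let n = suc (suc (suc r)) in Vert n p v → Vert n p′ v′ →
  zetaD n p ≡ zetaD n p′ → dD n p v ≡ dD n p′ v′ → p ≡ p′ × v ≡ v′
injective r p p′ v v′ vert vert′ eqz eqd =
  let (L , nf , bd , word , read , rec) = proj₂ (forward r p v vert)
      (L′ , nf′ , bd′ , word′ , read′ , rec′) = proj₂ (forward r p′ v′ vert′)
      same = NF-injective L L′ nf nf′ bd bd′
        (trans word (trans (cong (λ b → N ∷ reverse (map unsign b)) eqz) (sym word′)))
        (trans read (trans (cong₂ (λ b w → scaleHead (ε b) w) eqz eqd) (sym read′)))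
  in Recover-unique rec (subst (λ L → Recover r L p′ v′) (sym same) rec′)

-- Construction of preimages

signAfter-irrelevant : ∀ k {s s′ xs} → All Plain xs → nthNFollowedByEast (suc k) xs ≡ false →
  signAfterNthN (suc k) s xs ≡ signAfterNthN (suc k) s′ xs
signAfter-irrelevant k [] nf = refl
signAfter-irrelevant zero (inj₁ refl ∷ []) nf = refl
signAfter-irrelevant zero (inj₁ refl ∷ inj₁ refl ∷ pl) nf = refl
signAfter-irrelevant zero (inj₁ refl ∷ inj₂ refl ∷ pl) ()
signAfter-irrelevant (suc k) (inj₁ refl ∷ pl) nf = cong (N ∷_) (signAfter-irrelevant k pl nf)
signAfter-irrelevant k {s} {s′} {E ∷ xs} (inj₂ refl ∷ pl) nf =
  trans (signAfter-skip k s xs) (trans (cong (E ∷_) (signAfter-irrelevant k pl (trans (sym (nthN-skip-east k xs refl)) nf))) (sym (signAfter-skip k s′ xs)))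

++-nonempty : {A : Set} → ∀ (xs : List A) {y z} → ∃₂ λ h t → xs ++ y ∷ z ∷ [] ≡ h ∷ t
++-nonempty [] = _ , _ , refl
++-nonempty (x ∷ xs) = _ , _ , refl

Coded : List Step → List ℤ → List Row → Set
Coded b w L = ∀ {K} → Bounded (suc K) (map proj₁ L) →
  reversedZeta (suc K) (map proj₁ L) ≡ N ∷ reverse (map unsign b) × reading (suc K) L ≡ scaleHead (ε b) w

module Backward (b : List Step) (win : List ℤ) (a₁ : ℕ) (as : List ℕ) (c d : ℕ) (z : ℤ) (vs : List ℤ) (u w : ℤ) (e : ℕ) (x : ℤ)
  (len : length as ≡ length vs) (f : Fold (suc (suc (length as))) c d w e x)
  (asc : Ascending (suc (suc (length as))) 0 (a₁ ∷ as ++ c ∷ e ∷ []))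
  (diag : Diag (suc (suc (suc (length as)))) b win)
  (coded : Coded b win (rowsFrom 0 (a₁ ∷ as ++ c ∷ e ∷ []) (z ∷ vs ++ u ∷ x ∷ []))) where

  -- The normal form leaves a sign `s` for an initial East step and, if `a₁ ≡ 0`, the sign of the
  -- first label. A candidate fixes both, and `result` makes it a preimage as soon as the sign
  -- condition of `Vert` holds.
  module Candidate (v₁ : ℤ) (s : Bool) (choice : v₁ ≡ z ⊎ (a₁ ≡ 0 × v₁ ≡ - z)) where

    private
      M : ℕ
      M = suc (suc (length as))
      a : List ℕ
      a = a₁ ∷ as ++ c ∷ d ∷ []
      ascA : Ascending M 0 a
      ascA = Ascending-replace (a₁ ∷ as) (proj₁ (Fold-≤ f)) (proj₁ (proj₂ (Fold-≤ f))) asc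
      q : List Step
      q = pathOf M 0 a
      plq = pathOf-plain M 0 a
      easts-q : eastsFrom 0 q ≡ a
      easts-q = eastsFrom-pathOf 0 a ascA

    p : List Step
    p = setFirst (signOfBit s) q

    private
      unsign-p : map unsign p ≡ q
      unsign-p = unsign-setFirst (signOfBit-Sign s) plq
      eqa : eastsBefore p ≡ a
      eqa = trans (sym (eastsFrom-unsign 0 p)) (trans (cong (eastsFrom 0) unsign-p) easts-q)

    open Key p a₁ as c d v₁ vs u w e x eqa len f asc public

    -- Computed from the abscissae instead of the path, so that all candidates share it by
    -- definition.
    parity₀ : Bool
    parity₀ = isEven (sumℕ (map (atD 0 a) (range1 (n ℕ.∸ 2))))

    ε-p : ε p ≡ (if not (+ a₁ ==ℤ 0ℤ) then signBit s else 1ℤ)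
    ε-p = trans (ε-setFirst (signOfBit-Sign s) plq) (cong₂ (λ b y → if b then y else 1ℤ) (headEast-easts plq easts-q) (signOf-signOfBit s))

    private
      lenb = proj₁ (proj₁ diag)
      shape = proj₂ (proj₂ (proj₁ diag))
      perm = proj₁ (proj₂ diag)
      td = proj₁ (proj₂ (proj₂ diag))
      vall = proj₁ (proj₂ (proj₂ (proj₂ diag)))
      extra = proj₂ (proj₂ (proj₂ (proj₂ diag)))

      length-win : length win ≡ n
      length-win = perm-length perm

      win≢[] : win ≢ []
      win≢[] eq = ℕₚ.0≢1+n (trans (sym (cong length eq)) length-win)

      rows-ρ : ∀ y → reversedZeta K (map proj₁ (rows y)) ≡ N ∷ reverse (map unsign b)
      rows-ρ y = trans (cong (reversedZeta K) (proj₁-rows-eq y z)) (proj₁ (coded (rows-boundK z)))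

      read-z : reading K (rows z) ≡ scaleHead (ε b) win
      read-z = proj₂ (coded (rows-boundK z))

      zetaRaw-b : zetaRaw n p ≡ map unsign b
      zetaRaw-b = trans (zetaRaw-word z (rows-ρ z)) (Lₚ.reverse-involutive (map unsign b))

      nthN-b : nthNFollowedByEast n (map unsign b) ≡ not (+ a₁ ==ℤ 0ℤ)
      nthN-b = trans (cong (nthNFollowedByEast n) (sym zetaRaw-b)) (nthN-rows z)

      split = SignShape-split M b shape
      s″ = proj₁ split
      sg″ = proj₁ (proj₂ split)
      eqb = proj₂ (proj₂ split)

      ε-b : ε b ≡ (if not (+ a₁ ==ℤ 0ℤ) then signOf s″ else 1ℤ)
      ε-b = trans (cong ε eqb) (trans (ε-signAfter M sg″ (unsign-plain b)) (cong (λ c → if c then signOf s″ else 1ℤ) nthN-b))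

      zero-true : a₁ ≡ 0 → (+ a₁ ==ℤ 0ℤ) ≡ true
      zero-true 0≡ = ==-true (cong +_ 0≡)

      zero-false : a₁ ≢ 0 → (+ a₁ ==ℤ 0ℤ) ≡ false
      zero-false ne = ==-false {+ a₁} {0ℤ} (ne ∘ ℤₚ.+-injective)

      ε-b-zero : a₁ ≡ 0 → ε b ≡ 1ℤ
      ε-b-zero 0≡ = trans ε-b (cong (λ c → if not c then signOf s″ else 1ℤ) (zero-true 0≡))

      nthN-zero : a₁ ≡ 0 → nthNFollowedByEast n b ≡ false
      nthN-zero 0≡ = trans (sym (nthN-unsign n b)) (trans nthN-b (cong not (zero-true 0≡)))

      read-neg : a₁ ≡ 0 → reading K (rows (- z)) ≡ scaleHead -1ℤ win
      read-neg 0≡ = trans (cong (reading K ∘ rows) (sym (ℤₚ.-1*i≡-i z))) (trans (sym (reading-scale 0≡ -1ℤ z))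
        (cong (scaleHead -1ℤ) (trans read-z (trans (cong (λ s → scaleHead s win) (ε-b-zero 0≡)) (scaleHead-one win)))))

      tight-by : ∀ y t → reading K (rows y) ≡ scaleHead t win → All (ValleyBy n t win) (valleys b) → Linked (Drop ℤ._<_) (rows y)
      tight-by y t eq h = proj₂ (valleys-Linked (rows y) (rows≢[] y) (rows-normal y) (rows-boundK y) b win t win≢[] (rows-ρ y) eq)
        (subst (λ k → All (ValleyBy k t win) (valleys b)) (sym length-win) h)

      tight-z : Linked (Drop ℤ._<_) (rows z)
      tight-z = tight-by z (ε b) read-z vall

      tight-neg : a₁ ≡ 0 → Linked (Drop ℤ._<_) (rows (- z))
      tight-neg 0≡ = tight-by (- z) -1ℤ (read-neg 0≡)
        (flipped-valleys M b win (nthN-zero 0≡) (subst (λ s → All (ValleyBy n s win) (valleys b)) (ε-b-zero 0≡) vall) (λ i m → extra i m (nthN-zero 0≡)))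

      rise-of : ∀ y → Linked (Drop ℤ._<_) (rows y) → Linked Rise (zipped a (y ∷ vs ++ u ∷ w ∷ []))
      rise-of y lk = Rise-replace-last (a₁ ∷ as) (y ∷ vs) (cong suc len) (proj₂ (Fold-tight f u)) (rows-Linked⁻ 0 areas (labels y) lk)

      rise-v₁ : Linked Rise (zipped a v)
      rise-v₁ = by-choice choice
        where
        by-choice : ∀ {y} → y ≡ z ⊎ (a₁ ≡ 0 × y ≡ - z) → Linked Rise (zipped a (y ∷ vs ++ u ∷ w ∷ []))
        by-choice (inj₁ refl) = rise-of z tight-z
        by-choice (inj₂ (0≡ , refl)) = rise-of (- z) (tight-neg 0≡)

      rise-neg : a₁ ≡ 0 → Linked Rise (zipped a (- v₁ ∷ vs ++ u ∷ w ∷ []))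
      rise-neg 0≡ = by-choice choice
        where
        by-choice : ∀ {y} → y ≡ z ⊎ (a₁ ≡ 0 × y ≡ - z) → Linked Rise (zipped a (- y ∷ vs ++ u ∷ w ∷ []))
        by-choice (inj₁ refl) = rise-of (- z) (tight-neg 0≡)
        by-choice (inj₂ (_ , refl)) = subst (λ y → Linked Rise (zipped a (y ∷ vs ++ u ∷ w ∷ []))) (sym (ℤₚ.neg-involutive z)) (rise-of z tight-z)

      Scaled : Set
      Scaled = ∃ λ t → rawLabels ≡ scaleHead (signBit t) win × (a₁ ≢ 0 → signBit t ≡ ε b)

      raw-scaled : Scaled
      raw-scaled = by-choices choice (proj₂ (proj₂ rawLabels-rows))
        where
        z₀ = proj₁ rawLabels-rows
        eq = proj₁ (proj₂ rawLabels-rows)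
        direct : z₀ ≡ z → Scaled
        direct z₀≡ = plusBit b , trans eq (trans (cong (reading K ∘ rows) z₀≡) read-z) , λ _ → refl
        flipped : a₁ ≡ 0 → z₀ ≡ - z → Scaled
        flipped 0≡ z₀≡ = false , trans eq (trans (cong (reading K ∘ rows) z₀≡) (read-neg 0≡)) , λ ne → ⊥-elim (ne 0≡)
        by-choices : v₁ ≡ z ⊎ (a₁ ≡ 0 × v₁ ≡ - z) → z₀ ≡ v₁ ⊎ (a₁ ≡ 0 × z₀ ≡ - v₁) → Scaled
        by-choices (inj₁ v₁≡) (inj₁ z₀≡) = direct (trans z₀≡ v₁≡)
        by-choices (inj₁ v₁≡) (inj₂ (0≡ , z₀≡)) = flipped 0≡ (trans z₀≡ (cong -_ v₁≡))
        by-choices (inj₂ (0≡ , v₁≡)) (inj₁ z₀≡) = flipped 0≡ (trans z₀≡ v₁≡)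
        by-choices (inj₂ (0≡ , v₁≡)) (inj₂ (_ , z₀≡)) = direct (trans z₀≡ (trans (cong -_ v₁≡) (ℤₚ.neg-involutive z)))

      t = proj₁ raw-scaled
      raw≡ = proj₁ (proj₂ raw-scaled)
      t≡ = proj₂ (proj₂ raw-scaled)

    perm-v : IsSignedPerm n v
    perm-v = ↭-trans (↭-sym rawLabels-abs) (↭-trans (↭-reflexive (trans (cong (map ∣_∣) raw≡) (abs-scaleHead t win))) perm)

    result : signProduct v ≡ ε p ℤ.* signBit parity₀ → Vert n p v × zetaD n p ≡ b × dD n p v ≡ win
    result sign = (lattice , perm-v , rise , starts , trans sign-v (cong (ε p ℤ.*_) (sym vertSign))) , zeta≡ , dD≡
      where
      sign-v : signProduct v ≡ ε p ℤ.* signBit s₀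
      sign-v = trans sign (cong (λ l → ε p ℤ.* signBit (isEven (sumℕ (map (atD 0 l) (range1 (n ℕ.∸ 2)))))) (sym eqa))
      len-a : length a ≡ n
      len-a = cong suc (trans (Lₚ.length-++ as) (ℕₚ.+-comm r 2))
      lattice : SignedLatticePath n p
      lattice = trans (sym (countN-unsign p)) (trans (cong countN unsign-p) (trans (sym (length-eastsFrom 0 plq)) (trans (cong length easts-q) len-a))) ,
        trans (sym (countE-unsign p)) (trans (cong countE unsign-p) (countE-pathOf 0 a ascA)) ,
        FirstSigned-setFirst (signOfBit-Sign s) plq
      rise : All (λ i → at v i ℤ.< at v (suc i)) (rises p)
      rise = subst (All (λ i → at v i ℤ.< at v (suc i))) (trans (cong (risesFrom 0) (sym unsign-p)) (risesFrom-unsign 0 p))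
        (Rise⇒risesFrom 0 [] v plq refl (trans (perm-length {w = v} perm-v) (sym (trans (cong length easts-q) len-a)))
          (subst (λ l → Linked Rise (zipped l v)) (sym easts-q) rise-v₁))
      starts : startsNN p ≡ true → + ∣ v₁ ∣ ℤ.< at v 2
      starts nn =
        let (y , ys , eq) = ++-nonempty as {c} {d}
            (y′ , ys′ , eq′) = ++-nonempty vs {u} {w}
            (0≡ , y0) = startsNN-easts plq (trans easts-q (cong (a₁ ∷_) eq)) (trans (cong startsNN (sym unsign-p)) (trans (startsNN-unsign p) nn))
            a₁≡y = trans 0≡ (sym y0)
        in abs-<
          (subst₂ ℤ._<_ (sym (ℤₚ.*-identityˡ v₁)) (second eq′) (Linked-first (as ++ c ∷ d ∷ []) (vs ++ u ∷ w ∷ []) eq eq′ rise-v₁ a₁≡y))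
          (subst₂ ℤ._<_ (sym (ℤₚ.-1*i≡-i v₁)) (second eq′) (Linked-first (as ++ c ∷ d ∷ []) (vs ++ u ∷ w ∷ []) eq eq′ (rise-neg 0≡) a₁≡y))
        where
        second : ∀ {y′ ys′} {l : List ℤ} → l ≡ y′ ∷ ys′ → y′ ≡ at (v₁ ∷ l) 2
        second refl = refl
      sign-win : signProduct win ≡ 1ℤ
      sign-win = trans (signProduct-nonzero (perm-nonzero perm)) (cong signBit td)
      -- Both bits give the sign product of `rawLabels`: `t` because the given window has product 1,
      -- `evenPos` by the sign condition on `v`. Hence the final flip in `dD` returns exactly this
      -- window.
      t-evenPos : t ≡ evenPos
      t-evenPos = signBit-injective (trans (sym (go win win≢[] sign-win)) (trans (cong signProduct (sym raw≡)) (rawLabels-parity sign-v)))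
        where
        go : ∀ l → l ≢ [] → signProduct l ≡ 1ℤ → signProduct (scaleHead (signBit t) l) ≡ signBit t
        go [] ne _ = ⊥-elim (ne refl)
        go (y ∷ l) _ eq = trans (signProduct-scaleHead t y l) (trans (cong (signBit t ℤ.*_) eq) (ℤₚ.*-identityʳ (signBit t)))
      dD≡ : dD n p v ≡ win
      dD≡ = trans dD-rawLabels (trans (cong₂ (λ q l → scaleHead (signBit q) l) (sym t-evenPos) raw≡) (scaleHead-square t win))
      zeta≡ : zetaD n p ≡ b
      zeta≡ = trans (cong (signAfterNthN n (signOfBit evenPos)) zetaRaw-b) (trans signs (sym eqb))
        where
        signs : signAfterNthN n (signOfBit evenPos) (map unsign b) ≡ signAfterNthN n s″ (map unsign b)
        signs = by-first (a₁ ℕ.≟ 0)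
          where
          by-first : Dec (a₁ ≡ 0) → signAfterNthN n (signOfBit evenPos) (map unsign b) ≡ signAfterNthN n s″ (map unsign b)
          by-first (yes 0≡) = signAfter-irrelevant M (unsign-plain b) (trans nthN-b (cong not (zero-true 0≡)))
          by-first (no ne) = cong (λ s → signAfterNthN n s (map unsign b)) (Sign-injective (signOfBit-Sign evenPos) sg″
            (trans (signOf-signOfBit evenPos) (trans (cong signBit (sym t-evenPos)) (trans (t≡ ne)
            (trans ε-b (cong (λ c → if not c then signOf s″ else 1ℤ) (zero-false ne)))))))

  private
    module Plus = Candidate z true (inj₁ refl)
    n = suc (suc (suc (length as)))
    t : Bool
    t = isEven (countᵇ isNeg (z ∷ vs ++ u ∷ w ∷ []))
    sign-t : signProduct (z ∷ vs ++ u ∷ w ∷ []) ≡ signBit t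
    sign-t = signProduct-nonzero {z ∷ vs ++ u ∷ w ∷ []} (perm-nonzero {w = z ∷ vs ++ u ∷ w ∷ []} Plus.perm-v)

    Preimage : Set
    Preimage = ∃₂ λ p v → Vert n p v × zetaD n p ≡ b × dD n p v ≡ win

    -- The path begins with an East step, whose sign is free; it is chosen to be the sign product of
    -- the labels times the parity sign.
    via-sign : a₁ ≢ 0 → Preimage
    via-sign ne = _ , _ , Signed.result (trans sign-t (trans (sym product) (cong (ℤ._* signBit Plus.parity₀) (sym
        (trans Signed.ε-p (cong (λ c → if not c then signBit (xnor t Plus.parity₀) else 1ℤ) (==-false {+ a₁} {0ℤ} (ne ∘ ℤₚ.+-injective))))))))
      where
      module Signed = Candidate z (xnor t Plus.parity₀) (inj₁ refl)
      product : signBit (xnor t Plus.parity₀) ℤ.* signBit Plus.parity₀ ≡ signBit t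
      product = trans (cong (ℤ._* signBit Plus.parity₀) (signBit-xnor t Plus.parity₀))
        (trans (ℤₚ.*-assoc (signBit t) _ _) (trans (cong (signBit t ℤ.*_) (signBit-square Plus.parity₀)) (ℤₚ.*-identityʳ (signBit t))))

    unit : ∀ {p} → a₁ ≡ 0 → ε p ≡ (if not (+ a₁ ==ℤ 0ℤ) then 1ℤ else 1ℤ) → signBit Plus.parity₀ ≡ ε p ℤ.* signBit Plus.parity₀
    unit 0≡ eq = trans (sym (ℤₚ.*-identityˡ (signBit Plus.parity₀))) (cong (ℤ._* signBit Plus.parity₀)
      (sym (trans eq (cong (λ c → if not c then 1ℤ else 1ℤ) (==-true (cong +_ 0≡))))))

    -- The path begins with a North step and has sign 1. Only the first label can be adapted, and
    -- negating it changes the sign product if that is required.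
    via-label : a₁ ≡ 0 → Dec (t ≡ Plus.parity₀) → Preimage
    via-label 0≡ (yes eq) = _ , _ , Plus.result (trans sign-t (trans (cong signBit eq) (unit {Plus.p} 0≡ Plus.ε-p)))
    via-label 0≡ (no ne) = _ , _ , Minus.result (trans (signProduct-neg z (vs ++ u ∷ w ∷ [])) (trans (cong -_ sign-t)
        (trans (sym (signBit-not t)) (trans (cong signBit (other t Plus.parity₀ ne)) (unit {Minus.p} 0≡ Minus.ε-p)))))
      where
      module Minus = Candidate (- z) true (inj₂ (0≡ , refl))
      other : ∀ a b → a ≢ b → not a ≡ b
      other true true ne = ⊥-elim (ne refl)
      other true false ne = refl
      other false true ne = refl
      other false false ne = ⊥-elim (ne refl)

    by-first : Dec (a₁ ≡ 0) → Preimage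
    by-first (yes 0≡) = via-label 0≡ (t Bool.≟ Plus.parity₀)
    by-first (no ne) = via-sign ne

  preimage : ∃₂ λ p v → Vert n p v × zetaD n p ≡ b × dD n p v ≡ win
  preimage = by-first (a₁ ℕ.≟ 0)

surjective : ∀ r b w → let n = suc (suc (suc r)) in Diag n b w → ∃₂ λ p v → Vert n p v × zetaD n p ≡ b × dD n p v ≡ w
surjective r b w diag@((lenb , pre , shape) , perm , _) =
  let (L , (lk , st , en) , coded) = NF-surjective (reverse (map unsign b)) (scaleHead (ε b) w) (All-reverse (unsign-plain b))
        (ℕₚ.m≤n⇒m≤1+n (Ballot-top _ (ballot⇒Ballot b pre)) , ballot⇒Ballot b pre) total
  in nonempty L lk st en coded
  where
  open ≡-Reasoning
  n = suc (suc (suc r))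
  len : length (scaleHead (ε b) w) ≡ n
  len = trans (length-scaleHead (ε b) w) (perm-length perm)
  total : countN (N ∷ reverse (map unsign b)) ℕ.+ countE (reverse (map unsign b)) ≡ length (scaleHead (ε b) w) ℕ.+ length (scaleHead (ε b) w)
  total = begin
    suc (countN (reverse (map unsign b)) ℕ.+ countE (reverse (map unsign b)))
      ≡⟨ cong suc (countN+countE (reverse (map unsign b))) ⟩
    suc (length (reverse (map unsign b)))
      ≡⟨ cong suc (trans (Lₚ.length-reverse (map unsign b)) (trans (Lₚ.length-map unsign b) lenb)) ⟩
    2 ℕ.* n
      ≡⟨ cong (n ℕ.+_) (ℕₚ.+-identityʳ n) ⟩
    n ℕ.+ n
      ≡⟨ cong₂ ℕ._+_ len len ⟨
    length (scaleHead (ε b) w) ℕ.+ length (scaleHead (ε b) w) ∎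
  Goal : ℕ → Set
  Goal r = ∃₂ λ p v → Vert (suc (suc (suc r))) p v × zetaD (suc (suc (suc r))) p ≡ b × dD (suc (suc (suc r))) p v ≡ w
  length-L : ∀ L → Coded b w L → length L ≡ n
  length-L L coded = trans (sym (Lₚ.length-map readLabel L)) (trans (sym (↭-length (reading-↭ _ L (sum-bound (map proj₁ L)))))
    (trans (cong length (proj₂ (coded (sum-bound (map proj₁ L))))) len))
  unfolded : ∀ {a₁ as c e z vs u x} → length vs ≡ length as → Ascending (suc (suc (length as))) 0 (a₁ ∷ as ++ c ∷ e ∷ []) →
    Diag (suc (suc (suc (length as)))) b w → Coded b w (rowsFrom 0 (a₁ ∷ as ++ c ∷ e ∷ []) (z ∷ vs ++ u ∷ x ∷ [])) →
    (∃₂ λ d wn → Fold (suc (suc (length as))) c d wn e x) → Goal (length as)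
  unfolded {a₁} {as} {c} {e} {z} {vs} {u} {x} len asc diag coded (d , wn , f) =
    Backward.preimage b w a₁ as c d z vs u wn e x (sym len) f asc diag coded
  split-labels : ∀ {a₁ as c e us} → Ascending (suc (suc (length as))) 0 (a₁ ∷ as ++ c ∷ e ∷ []) →
    Diag (suc (suc (suc (length as)))) b w → Coded b w (rowsFrom 0 (a₁ ∷ as ++ c ∷ e ∷ []) us) →
    (∃₂ λ z vs → ∃₂ λ u x → us ≡ z ∷ vs ++ u ∷ x ∷ [] × length vs ≡ length as) → Goal (length as)
  split-labels {a₁} {as} asc diag coded (z , vs , u , x , refl , len) =
    unfolded len asc diag coded (unfold x (proj₁ (Ascending-end (a₁ ∷ as) asc)) (proj₂ (Ascending-end (a₁ ∷ as) asc)))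
  split-areas : ∀ {r xs us} → Ascending (suc (suc r)) 0 xs → Diag (suc (suc (suc r))) b w → Coded b w (rowsFrom 0 xs us) → length us ≡ suc (suc (suc r)) →
    (∃₂ λ a₁ as → ∃₂ λ c e → xs ≡ a₁ ∷ as ++ c ∷ e ∷ [] × length as ≡ r) → Goal r
  split-areas {us = us} asc diag coded len (a₁ , as , c , e , refl , refl) = split-labels asc diag coded (splitEnds (length as) us len)
  ascend : ∀ {L} → Coded b w L → length L ≡ n → (∃₂ λ xs us → L ≡ rowsFrom 0 xs us × Ascending (suc (suc r)) 0 xs × length xs ≡ length us) → Goal r
  ascend coded lenL (xs , us , refl , asc , len) = split-areas asc diag coded len-us (splitEnds r xs (trans len len-us))
    where
    len-us : length us ≡ n
    len-us = trans (sym (length-rows 0 xs us len)) lenL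
  nonempty : ∀ L → Linked (Drop Any◁) L → StartNonNeg L → EndNonPos L → Coded b w L → Goal r
  nonempty [] _ _ _ coded = ⊥-elim (ℕₚ.0≢1+n (length-L [] coded))
  nonempty ((m , v) ∷ L) lk st en coded =
    ascend coded (length-L ((m , v) ∷ L) coded) (rows-surjective {suc (suc r)} 0 0 m v L st lk en (length-L ((m , v) ∷ L) coded))

theorem5p22 : (n : ℕ) → 3 ≤ n →
    ((p : List Step) (v : List ℤ) → Vert n p v → Diag n (zetaD n p) (dD n p v))
    × ((p p′ : List Step) (v v′ : List ℤ) → Vert n p v → Vert n p′ v′ →
    zetaD n p ≡ zetaD n p′ → dD n p v ≡ dD n p′ v′ → (p ≡ p′) × (v ≡ v′))
    × ((b : List Step) (w : List ℤ) → Diag n b w →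
    Σ (List Step × List ℤ) (λ { (p , v) → Vert n p v × (zetaD n p ≡ b) × (dD n p v ≡ w) }))
theorem5p22 (suc (suc (suc r))) (s≤s (s≤s (s≤s z≤n))) =
  (λ p v vert → proj₁ (forward r p v vert)) ,
  injective r ,
  (λ b w diag → let (p , v , h) = surjective r b w diag in (p , v) , h)
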